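{- The satisfiability problem and the finite satisfiability problem for modal inclusion logic $\mathcal{ML}(\subseteq)$ with strict semantics are in $\mathrm{NEXPTIME}$.
   Context: Let $\Pi$ be a countably infinite set of proposition symbols. Formulas of modal inclusion logic $\mathcal{ML}(\subseteq)$ are given by the grammar $\varphi ::= p \mid \neg p \mid (\varphi_1\wedge\varphi_2)\mid(\varphi_1\vee\varphi_2)\mid p_1\cdots p_k\subseteq q_1\cdots q_k \mid \Box\varphi\mid\Diamond\varphi$, where $p,p_i,q_i\in\Pi$ and $k\geq 1$. A Kripke model is $M=(W,R,V)$ with $W\neq\emptyset$, $R\subseteq W\times W$, $V:\Pi\to\mathcal{P}(W)$. A team is a subset $T\subseteq W$; $R(T)=\{s\in W\mid \exists s'\in T: (s',s)\in R\}$. Strict team semantics: $M,T\models p$ iff $T\subseteq V(p)$; $M,T\models\neg p$ iff $T\cap V(p)=\emptyset$; $M,T\models p_1\cdots p_k\subseteq q_1\cdots q_k$ iff for every $u\in T$ there is $v\in T$ with $u\in V(p_i)\Leftrightarrow v\in V(q_i)$ for all $i$; $M,T\models\varphi\wedge\psi$ iff both hold on $T$; $M,T\models\varphi\vee\psi$ iff there are $S,S'\subseteq T$ with $S\cup S'=T$, $S\cap S'=\emptyset$, $M,S\models\varphi$, $M,S'\models\psi$; $M,T\models\Box\varphi$ iff $M,R(T)\models\varphi$; $M,T\models\Diamond\varphi$ iff $M,f(T)\models\varphi$ for some function $f:T\to W$ with $(u,f(u))\in R$ for all $u\in T$, where $f(T)=\{f(u)\mid u\in T\}$. The satisfiability problem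 asks whether there exist $M$ and a nonempty team $T$ with $M,T\models\varphi$; finite satisfiability additionally requires $W$ finite. -}

module Defs where

open import Level using (Lift)
open import Data.Nat using (ℕ; zero; suc; _+_; _^_)
open import Data.Nat.Binary using (ℕᵇ; 2[1+_]; 1+[2_]) renaming (zero to bzero; fromℕ to toℕᵇ)
open import Data.Integer using (ℤ; +_; -[1+_]) renaming (_≟_ to _≟ℤ_)
import Data.Integer renaming (_≟_ to _≟ℤ_)
open import Data.Fin using (Fin) renaming (zero to fzero; suc to fsuc)
open import Data.Vec using (Vec; lookup)
import Data.Vec as Vec
open import Data.List using (List; []; _∷_; _++_; length; concatMap)
open import Data.List.Membership.Propositional using (_∈_)
open import Data.Bool using (Bool; true; false; if_then_else_)
open import Data.Product using (Σ; ∃; _×_; _,_)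
open import Data.Sum using (_⊎_)
open import Data.Empty using (⊥)
open import Relation.Nullary using (Dec; yes; no; does)
open import Relation.Binary.PropositionalEquality using (_≡_)

data Fml : Set where
  var  : ℕ → Fml
  nvar : ℕ → Fml
  _∧ᵐ_ : Fml → Fml → Fml
  _∨ᵐ_ : Fml → Fml → Fml
  incl : (k : ℕ) → Vec ℕ (suc k) → Vec ℕ (suc k) → Fml
  □ᵐ   : Fml → Fml
  ◇ᵐ   : Fml → Fml

record Kripke (W : Set) : Set₁ where
  field
    R : W → W → Set
    V : ℕ → W → Set

Team : Set → Set₁
Team W = W → Set

image : {W : Set} → Kripke W → Team W → Team W
image M T s = ∃ λ s' → T s' × Kripke.R M s' s

Lift₁ : Set → Set₁
Lift₁ A = Lift _ A

_,_⊨_ : {W : Set} → Kripke W → Team W → Fml → Set₁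
_,_⊨_ {W} M T (var p)  = Lift₁ (∀ w → T w → Kripke.V M p w)
_,_⊨_ {W} M T (nvar p) = Lift₁ (∀ w → T w → Kripke.V M p w → ⊥)
_,_⊨_ {W} M T (φ ∧ᵐ ψ) = (M , T ⊨ φ) × (M , T ⊨ ψ)
_,_⊨_ {W} M T (φ ∨ᵐ ψ) =
  Σ (Team W) λ S → Σ (Team W) λ S' →
    ((∀ w → S w → T w) × (∀ w → S' w → T w)
     × (∀ w → T w → S w ⊎ S' w) × (∀ w → S w → S' w → ⊥))
    × (M , S ⊨ φ) × (M , S' ⊨ ψ)
_,_⊨_ {W} M T (incl k ps qs) = Lift₁ (
  ∀ u → T u → ∃ λ v → T v × ∀ i →
    (Kripke.V M (lookup ps i) u → Kripke.V M (lookup qs i) v)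
    × (Kripke.V M (lookup qs i) v → Kripke.V M (lookup ps i) u))
_,_⊨_ {W} M T (□ᵐ φ) = M , image M T ⊨ φ
_,_⊨_ {W} M T (◇ᵐ φ) =
  Σ (W → W) λ f → (∀ u → T u → Kripke.R M u (f u))
    × (M , (λ w → ∃ λ u → T u × f u ≡ w) ⊨ φ)

Satisfiable : Fml → Set₁
Satisfiable φ = Σ Set λ W → Σ (Kripke W) λ M → Σ (Team W) λ T →
  (∃ λ w → T w) × (M , T ⊨ φ)

FinSatisfiable : Fml → Set₁
FinSatisfiable φ = Σ ℕ λ n → Σ (Kripke (Fin n)) λ M → Σ (Team (Fin n)) λ T →
  (∃ λ w → T w) × (M , T ⊨ φ)

data Tok : Set where
  tVAR tNVAR tAND tOR tINCL tBOX tDIA tD0 tD1 tEND : Tok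

tokBits : Tok → List Bool
tokBits tVAR  = false ∷ false ∷ false ∷ false ∷ []
tokBits tNVAR = false ∷ false ∷ false ∷ true  ∷ []
tokBits tAND  = false ∷ false ∷ true  ∷ false ∷ []
tokBits tOR   = false ∷ false ∷ true  ∷ true  ∷ []
tokBits tINCL = false ∷ true  ∷ false ∷ false ∷ []
tokBits tBOX  = false ∷ true  ∷ false ∷ true  ∷ []
tokBits tDIA  = false ∷ true  ∷ true  ∷ false ∷ []
tokBits tD0   = false ∷ true  ∷ true  ∷ true  ∷ []
tokBits tD1   = true  ∷ false ∷ false ∷ false ∷ []
tokBits tEND  = true  ∷ false ∷ false ∷ true  ∷ []

-- bijective base-2 digits (least significant first) of a ℕᵇ:
-- 2[1+ n] = 2n+2 contributes digit "2" (token tD0), 1+[2 n] = 2n+1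
-- contributes digit "1" (token tD1).  Injective, length O(log n).
digitsᵇ : ℕᵇ → List Tok
digitsᵇ bzero     = []
digitsᵇ 2[1+ n ]  = tD0 ∷ digitsᵇ n
digitsᵇ 1+[2 n ]  = tD1 ∷ digitsᵇ n

numToks : ℕ → List Tok
numToks n = digitsᵇ (toℕᵇ n) ++ (tEND ∷ [])

vecToks : {m : ℕ} → Vec ℕ m → List Tok
vecToks Vec.[] = []
vecToks (x Vec.∷ xs) = numToks x ++ vecToks xs

fmlToks : Fml → List Tok
fmlToks (var p)  = tVAR ∷ numToks p
fmlToks (nvar p) = tNVAR ∷ numToks p
fmlToks (φ ∧ᵐ ψ) = tAND ∷ fmlToks φ ++ fmlToks ψ
fmlToks (φ ∨ᵐ ψ) = tOR ∷ fmlToks φ ++ fmlToks ψ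
fmlToks (incl k ps qs) = tINCL ∷ numToks k ++ vecToks ps ++ vecToks qs
fmlToks (□ᵐ φ) = tBOX ∷ fmlToks φ
fmlToks (◇ᵐ φ) = tDIA ∷ fmlToks φ

encode : Fml → List Bool
encode φ = concatMap tokBits (fmlToks φ)

-- Nondeterministic single-tape Turing machines and NEXPTIME.
-- Tape alphabet Fin (3 + Γ): 0 = blank, 1 = input bit false, 2 = input bit true.

data Move : Set where
  mL mR mS : Move

record NTM : Set where
  field
    nQ     : ℕ
    nΓ     : ℕ
    start  : Fin nQ
    accept : Fin nQ
    δ      : Fin nQ → Fin (3 + nΓ) → List (Fin nQ × Fin (3 + nΓ) × Move)

module _ (M : NTM) where
  open NTM M

  Sym : Set
  Sym = Fin (3 + nΓ)

  record Config : Set where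
    constructor cfg
    field
      state : Fin nQ
      head  : ℤ
      tape  : ℤ → Sym

  blank : Sym
  blank = fzero

  bitSym : Bool → Sym
  bitSym false = fsuc fzero
  bitSym true  = fsuc (fsuc fzero)

  inputAt : List Bool → ℕ → Sym
  inputAt []       _       = blank
  inputAt (b ∷ bs) zero    = bitSym b
  inputAt (b ∷ bs) (suc k) = inputAt bs k

  initTape : List Bool → ℤ → Sym
  initTape x (+ k)     = inputAt x k
  initTape x -[1+ k ]  = blank

  initial : List Bool → Config
  initial x = cfg start (+ 0) (initTape x)

  moveHead : Move → ℤ → ℤ
  moveHead mL h = h Data.Integer.- + 1
  moveHead mR h = h Data.Integer.+ + 1
  moveHead mS h = h

  write : (ℤ → Sym) → ℤ → Sym → ℤ → Sym
  write t h a i = if does (i ≟ℤ h) then a else t i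

  data Step : Config → Config → Set where
    step : ∀ {q h t q' a m} → (q' , a , m) ∈ δ q (t h) →
           Step (cfg q h t) (cfg q' (moveHead m h) (write t h a))

  data Within : ℕ → Config → Config → Set where
    here  : ∀ {n c} → Within n c c
    there : ∀ {n c c' c''} → Step c c' → Within n c' c'' → Within (suc n) c c''

  AcceptsWithin : ℕ → List Bool → Set
  AcceptsWithin n x = ∃ λ c → Within n (initial x) c × Config.state c ≡ accept

InNEXPTIME : (List Bool → Set₁) → Set₁
InNEXPTIME L = Σ NTM λ M → Σ ℕ λ c → ∀ x →
  (L x → AcceptsWithin M (2 ^ (suc (length x) ^ c)) x)
  × (AcceptsWithin M (2 ^ (suc (length x) ^ c)) x → L x)

SAT : List Bool → Set₁
SAT x = Σ Fml λ φ → (encode φ ≡ x) × Satisfiable φ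

FINSAT : List Bool → Set₁
FINSAT x = Σ Fml λ φ → (encode φ ≡ x) × FinSatisfiable φ

{-# OPTIONS --safe #-}
-- The type of a world records the truth values of the variables and, for every occurrence of a
-- subformula, whether the world belongs to the team of that occurrence.  A formula is satisfiable iff
-- there is a finite set of types, locally correct and with one type in the team of the whole formula,
-- in which every type finds its witnesses: for inclusion atoms, for diamonds, and for the types in the
-- team of the argument of a modal operator, which need a predecessor.  The types of the worlds of a
-- model form such a set.  Conversely, only the surjectivity of the strict diamond functions needs more
-- than one world per type, and since teams at different modal depths are independent, enough copies can
-- be added from the innermost depth outwards; the model is finite, so satisfiability and finite
-- satisfiability coincide.
--
-- There are at most 2^|φ| types, so a machine can guess the set as a list and verify it in time
-- polynomial in the length of the list.  Acceptance within a time bound is decidable, hence stable under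
-- double negation, which justifies the classical reasoning about the given model.
module Submission where

open import Level using (lift; lower)
open import Defs
open import Data.Nat using (ℕ; zero; suc; _+_; _*_; _^_; _≤_; _<_; _⊔_; z≤n; s≤s; s≤s⁻¹)
open import Data.Nat.Properties
import Data.Nat.Tactic.RingSolver as RingSolver
open import Data.Nat.Binary as ℕᵇ using (ℕᵇ; 2[1+_]; 1+[2_])
import Data.Nat.Binary.Properties as ℕᵇ
open import Data.Integer as ℤ using (ℤ)
open import Data.Bool as Bool using (Bool; true; false; if_then_else_; not; _∧_; _∨_; _xor_)
open import Data.Fin as Fin using (Fin; zero; suc; toℕ)
open import Data.Fin.Patterns
import Data.Fin.Properties as Fin
open import Data.Maybe using (Maybe; just; nothing)
import Data.Maybe.Properties as Maybe
open import Data.Vec as Vec using (Vec; []; _∷_; lookup; _[_]≔_; replicate)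
import Data.Vec.Properties as Vec
open import Data.List as List using (List; []; _∷_; _++_; _ʳ++_; length; concatMap; allFin)
open import Data.Nat.ListAction using (sum)
open import Data.List.Properties using (length-map; length-reverse; length-++; length-replicate; unfold-reverse; concatMap-++; map-++; ∷-injective; ++-assoc; ++-identityʳ;
  map-∘; map-injective; ʳ++-defn; reverse-involutive; reverse-map)
open import Data.List.Membership.Propositional using (_∈_; find; lose)
open import Data.List.Membership.Propositional.Properties
  using (∈-map⁺; ∈-map⁻; ∈-concatMap⁺; ∈-++⁺ˡ; ∈-++⁺ʳ; ∈-allFin; ∈-lookup; ∈-++⁻; ∈-∃++)
open import Data.List.Relation.Unary.Any using (here; there; index; any?)
import Data.List.Relation.Unary.Any as Any
open import Data.List.Relation.Unary.Any.Properties using (lookup-index)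
import Data.Product.Properties as Product
import Data.Sum.Properties as Sum
open import Data.List.Relation.Unary.All using (All; []; _∷_)
import Data.List.Relation.Unary.All as All
import Data.List.Relation.Unary.All.Properties as All
open import Data.List.Relation.Binary.Pointwise as Pointwise using (Pointwise; []; _∷_; Pointwise-length)
open import Data.Product using (Σ; ∃; _×_; _,_; proj₁; proj₂)
open import Data.Sum using (_⊎_; inj₁; inj₂)
open import Data.Empty using (⊥)
open import Data.Unit using (⊤; tt)
open import Function using (_∘_; id)
open import Relation.Nullary using (¬_; Dec; yes; no; does; contradiction)
open import Relation.Nullary.Decidable using (map′; dec-true; dec-false; _×-dec_; _→-dec_; decidable-stable; ¬¬-excluded-middle)
open import Relation.Binary.Definitions using (DecidableEquality)
open import Relation.Binary.PropositionalEquality hiding (J)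

-- The team of the argument of a strict diamond is exactly the range of a function on the team of
-- the diamond. With one world per type, two types in that range might both depend on the same
-- predecessor, which has only one value to give; this is the obstacle to taking the types
-- themselves as worlds. A world is therefore a type followed by a suggested successor: if the type
-- `a` may precede the world `w`, then `a ∷ w` is a world that can be mapped to `w`. For boxes, a
-- condition on every edge keeps the image inside the team of the argument, and predecessors give
-- the converse.
--
-- For the machine, a list of types is a word of blocks. All types of one formula have the same
-- length as words, so a subformula occurrence has the same position in every block, and every
-- comparison of two types proceeds letter by letter.
--
-- Programs have a predicate transformer semantics with a parameter restricting the number of loop
-- iterations. Unrestricted, it is what acceptance implies; restricted by `N`, it implies acceptance
-- in time polynomial in `N` and the input length. One definition serves both halves of correctness.

-- Finite types given by enumerations

record Finite (X : Set) : Set where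
  field
    enum     : List X
    complete : ∀ x → x ∈ enum

  card : ℕ
  card = length enum

  -- Repetitions in the enumeration are harmless: `code` picks one index of each element, and
  -- everything rests on `decode-code`.
  code : X → Fin card
  code x = index (complete x)

  decode : Fin card → X
  decode = List.lookup enum

  decode-code : ∀ x → decode (code x) ≡ x
  decode-code x = sym (lookup-index (complete x))

open Finite

finite-image : ∀ {X Y : Set} (f : X → Y) (g : Y → X) → (∀ y → f (g y) ≡ y) → Finite X → Finite Y
finite-image f g fg X .enum = List.map f (X .enum)
finite-image f g fg X .complete y = subst (_∈ _) (fg y) (∈-map⁺ f (X .complete (g y)))

finite-⊤ : Finite ⊤
finite-⊤ .enum = tt ∷ []
finite-⊤ .complete tt = here refl

finite-Bool : Finite Bool
finite-Bool .enum = true ∷ false ∷ []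
finite-Bool .complete true = here refl
finite-Bool .complete false = there (here refl)

finite-Fin : ∀ n → Finite (Fin n)
finite-Fin n .enum = allFin n
finite-Fin n .complete = ∈-allFin

finite-⊎ : ∀ {X Y : Set} → Finite X → Finite Y → Finite (X ⊎ Y)
finite-⊎ X Y .enum = List.map inj₁ (X .enum) ++ List.map inj₂ (Y .enum)
finite-⊎ X Y .complete (inj₁ x) = ∈-++⁺ˡ (∈-map⁺ inj₁ (X .complete x))
finite-⊎ X Y .complete (inj₂ y) = ∈-++⁺ʳ (List.map inj₁ (X .enum)) (∈-map⁺ inj₂ (Y .complete y))

finite-Σ : ∀ {X : Set} {Y : X → Set} → Finite X → (∀ x → Finite (Y x)) → Finite (Σ X Y)
finite-Σ X Y .enum = concatMap (λ x → List.map (x ,_) (Y x .enum)) (X .enum)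
finite-Σ X Y .complete (x , y) =
  ∈-concatMap⁺ (λ x → List.map (x ,_) (Y x .enum))
    (Any.map (λ { refl → ∈-map⁺ (x ,_) (Y x .complete y) }) (X .complete x))

finite-× : ∀ {X Y : Set} → Finite X → Finite Y → Finite (X × Y)
finite-× X Y = finite-Σ X (λ _ → Y)

finite-Maybe : ∀ {X : Set} → Finite X → Finite (Maybe X)
finite-Maybe X .enum = nothing ∷ List.map just (X .enum)
finite-Maybe X .complete nothing = here refl
finite-Maybe X .complete (just x) = there (∈-map⁺ just (X .complete x))

finite-Vec : ∀ {X : Set} → Finite X → ∀ n → Finite (Vec X n)
finite-Vec X zero .enum = [] ∷ []
finite-Vec X zero .complete [] = here refl
finite-Vec X (suc n) =
  finite-image (λ (x , xs) → x ∷ xs) (λ { (x ∷ xs) → x , xs }) (λ { (x ∷ xs) → refl })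
    (finite-× X (finite-Vec X n))

-- Stack positions

module _ {A : Set} where

  -- Indexing from the bottom of the stack, so that pushing and popping change a single position.
  at : List A → ℕ → Maybe A
  at []       i = nothing
  at (a ∷ as) i with i ≟ length as
  ... | yes _ = just a
  ... | no  _ = at as i

  at-top : ∀ a as → at (a ∷ as) (length as) ≡ just a
  at-top a as with length as ≟ length as
  ... | yes _ = refl
  ... | no ≢  = contradiction refl ≢

  at-below : ∀ a as {i} → i ≢ length as → at (a ∷ as) i ≡ at as i
  at-below a as {i} ≢ with i ≟ length as
  ... | yes eq = contradiction eq ≢
  ... | no  _  = refl

  at-beyond : ∀ as {i} → length as ≤ i → at as i ≡ nothing
  at-beyond []       le = refl
  at-beyond (a ∷ as) {i} le =
    trans (at-below a as (λ { refl → 1+n≰n le })) (at-beyond as (≤-trans (n≤1+n _) le))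

  at-just : ∀ as {i b} → at as i ≡ just b → i < length as
  at-just (a ∷ as) {i} eq with i ≟ length as
  ... | yes refl = ≤-refl
  ... | no  _    = ≤-trans (at-just as eq) (n≤1+n _)

  at-nothing : ∀ as {i} → at as i ≡ nothing → length as ≤ i
  at-nothing as {i} eq with length as ≤? i
  ... | yes le = le
  ... | no ¬le = contradiction (≰⇒> ¬le) (go as eq)
    where
    go : ∀ as → at as i ≡ nothing → ¬ i < length as
    go (a ∷ as) eq (s≤s le) with i ≟ length as
    ... | no ≢ = go as eq (≤∧≢⇒< le ≢)

  at-≤ : ∀ as {i j} → i ≤ j → at as i ≡ nothing → at as j ≡ nothing
  at-≤ as le eq = at-beyond as (≤-trans (at-nothing as eq) le)

  -- The tape shows the first input bit at position 0, the bottom of a stack, so the input is a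
  -- reversed list. This equation and the next one peel off its bottom letter.
  at-∷ʳ-zero : ∀ as (a : A) → at (as List.∷ʳ a) 0 ≡ just a
  at-∷ʳ-zero []       a = refl
  at-∷ʳ-zero (b ∷ as) a with 0 ≟ length (as List.∷ʳ a)
  ... | no  _  = at-∷ʳ-zero as a
  ... | yes eq with as
  ...   | []    = contradiction eq λ ()
  ...   | _ ∷ _ = contradiction eq λ ()

  at-∷ʳ-suc : ∀ as (a : A) i → at (as List.∷ʳ a) (suc i) ≡ at as i
  at-∷ʳ-suc []       a i = refl
  at-∷ʳ-suc (b ∷ as) a i = go (i ≟ length as)
    where
    len : ∀ as → length (as List.∷ʳ a) ≡ suc (length as)
    len []       = refl
    len (_ ∷ as) = cong suc (len as)
    go : Dec (i ≡ length as) → at ((b ∷ as) List.∷ʳ a) (suc i) ≡ at (b ∷ as) i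
    go (yes refl) = trans (cong (at ((b ∷ as) List.∷ʳ a)) (sym (len as)))
                      (trans (at-top b (as List.∷ʳ a)) (sym (at-top b as)))
    go (no ≢) = trans (at-below b (as List.∷ʳ a) (λ eq → ≢ (suc-injective (trans eq (len as)))))
                  (trans (at-∷ʳ-suc as a i) (sym (at-below b as ≢)))

-- Nondeterministic programs over K stacks.  A test runs its body on a scratch copy of the stacks,
-- kept at a deeper level, and then goes on with the original stacks.
module Language (A : Set) (K D : ℕ) where

  Stacks : Set
  Stacks = Vec (List A) K

  infixr 5 _⨾_

  data Cmd : Fin D → Set₁ where
    pop push : ∀ {ℓ} → Fin K → A → Cmd ℓ
    isNil    : ∀ {ℓ} → Fin K → Cmd ℓ
    guard    : ∀ {ℓ} → Bool → Cmd ℓ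
    _⨾_      : ∀ {ℓ} → Cmd ℓ → Cmd ℓ → Cmd ℓ
    pick     : ∀ {ℓ} {I : Set} → Finite I → (I → Cmd ℓ) → Cmd ℓ
    loop     : ∀ {ℓ} → Cmd ℓ → Cmd ℓ
    test     : ∀ {ℓ} ℓ' → ℓ Fin.< ℓ' → Cmd ℓ' → Cmd ℓ

  iterate : ((Stacks → Set) → Stacks → Set) → ℕ → (Stacks → Set) → Stacks → Set
  iterate F zero    k = k
  iterate F (suc n) k = F (iterate F n k)

  -- wp B c k s: some run of c from s ends in k, where B holds for every number of loop iterations.
  wp : (ℕ → Set) → ∀ {ℓ} → Cmd ℓ → (Stacks → Set) → Stacks → Set
  wp B (pop r a)    k s = ∃ λ as → lookup s r ≡ a ∷ as × k (s [ r ]≔ as)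
  wp B (push r a)   k s = k (s [ r ]≔ (a ∷ lookup s r))
  wp B (isNil r)    k s = lookup s r ≡ [] × k s
  wp B (guard b)    k s = b ≡ true × k s
  wp B (c ⨾ d)      k s = wp B c (wp B d k) s
  wp B (pick _ f)   k s = ∃ λ i → wp B (f i) k s
  wp B (loop c)     k s = ∃ λ n → B n × iterate (wp B c) n k s
  wp B (test _ _ c) k s = wp B c (λ _ → ⊤) s × k s

  -- Holds because `wp` is angelic: it describes a single run, which ends in a single state. It
  -- brings data found at the end of a run, such as the number of further loop iterations, to its
  -- beginning.
  wp-∃ : ∀ {B ℓ} (c : Cmd ℓ) {J : Set} {F : J → Stacks → Set} {s} →
    wp B c (λ s → ∃ λ j → F j s) s → ∃ λ j → wp B c (F j) s
  iterate-∃ : ∀ {B ℓ} (c : Cmd ℓ) n {J : Set} {F : J → Stacks → Set} {s} →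
    iterate (wp B c) n (λ s → ∃ λ j → F j s) s → ∃ λ j → iterate (wp B c) n (F j) s
  wp-mono : ∀ {B ℓ} (c : Cmd ℓ) {k k' : Stacks → Set} → (∀ s → k s → k' s) →
    ∀ {s} → wp B c k s → wp B c k' s
  iterate-mono : ∀ {B ℓ} (c : Cmd ℓ) n {k k' : Stacks → Set} → (∀ s → k s → k' s) →
    ∀ {s} → iterate (wp B c) n k s → iterate (wp B c) n k' s

  wp-mono (pop r a)    h (as , eq , p) = as , eq , h _ p
  wp-mono (push r a)   h p = h _ p
  wp-mono (isNil r)    h (eq , p) = eq , h _ p
  wp-mono (guard b)    h (eq , p) = eq , h _ p
  wp-mono (c ⨾ d)      h p = wp-mono c (λ s → wp-mono d h) p
  wp-mono (pick _ f)   h (i , p) = i , wp-mono (f i) h p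
  wp-mono (loop c)     h (n , b , p) = n , b , iterate-mono c n h p
  wp-mono (test _ _ c) h (t , p) = t , h _ p
  iterate-mono c zero    h p = h _ p
  iterate-mono c (suc n) h p = wp-mono c (λ s → iterate-mono c n h) p

  wp-∃ (pop r a)    (as , eq , j , p) = j , as , eq , p
  wp-∃ (push r a)   (j , p) = j , p
  wp-∃ (isNil r)    (eq , j , p) = j , eq , p
  wp-∃ (guard b)    (eq , j , p) = j , eq , p
  wp-∃ (c ⨾ d)      p = wp-∃ c (wp-mono c (λ s → wp-∃ d) p)
  wp-∃ (pick _ f)   (i , p) with wp-∃ (f i) p
  ... | j , q = j , i , q
  wp-∃ (loop c)     (n , b , p) with iterate-∃ c n p
  ... | j , q = j , n , b , q
  wp-∃ (test _ _ c) (t , j , p) = j , t , p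
  iterate-∃ c zero    p = p
  iterate-∃ c (suc n) p = wp-∃ c (wp-mono c (λ s → iterate-∃ c n) p)

  -- The cost of a program

  -- Bounds the number of atoms executed when no loop exceeds `N` iterations. A choice is charged
  -- the sum over its alternatives, which dominates their maximum; a loop pays one atom for each
  -- decision to go on or to stop.
  cost : ℕ → ∀ {ℓ} → Cmd ℓ → ℕ
  cost N (pop r a)      = 1
  cost N (push r a)     = 1
  cost N (isNil r)      = 1
  cost N (guard b)      = 1
  cost N (c ⨾ d)        = cost N c + cost N d
  cost N (pick I f)     = suc (sum (List.map (λ i → cost N (f i)) (I .enum)))
  cost N (loop c)       = suc (N * suc (cost N c))
  cost N (test _ _ c)   = suc (cost N c)

  degree : ∀ {ℓ} → Cmd ℓ → ℕ
  degree (pop r a)      = 0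
  degree (push r a)     = 0
  degree (isNil r)      = 0
  degree (guard b)      = 0
  degree (c ⨾ d)        = suc (degree c + degree d)
  degree (pick I f)     = suc (sum (List.map (λ i → suc (degree (f i))) (I .enum)))
  degree (loop c)       = 2 + degree c
  degree (test _ _ c)   = suc (degree c)

  private
    -- The base is at least two, so doubling raises the exponent by one. This fixes the shape of
    -- `degree`.
    sum-power : ∀ N {a b} i j → a ≤ (2 + N) ^ i → b ≤ (2 + N) ^ j → a + b ≤ (2 + N) ^ suc (i + j)
    sum-power N {a} {b} i j p q = begin
      a + b                     ≤⟨ +-mono-≤ (≤-trans p (^-monoʳ-≤ (2 + N) (m≤m+n i j)))
                                            (≤-trans q (^-monoʳ-≤ (2 + N) (m≤n+m j i))) ⟩
      M + M                     ≡⟨ cong (M +_) (sym (+-identityʳ M)) ⟩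
      2 * M                     ≤⟨ *-monoˡ-≤ M (m≤m+n 2 N) ⟩
      (2 + N) * M ∎
      where
      open ≤-Reasoning
      M = (2 + N) ^ (i + j)

  cost≤ : ∀ N {ℓ} (c : Cmd ℓ) → cost N c ≤ (2 + N) ^ degree c
  cost≤ N (pop r a)      = s≤s z≤n
  cost≤ N (push r a)     = s≤s z≤n
  cost≤ N (isNil r)      = s≤s z≤n
  cost≤ N (guard b)      = s≤s z≤n
  cost≤ N (c ⨾ d)        = sum-power N (degree c) (degree d) (cost≤ N c) (cost≤ N d)
  cost≤ N (pick I f)     = sum-power N 0 (sum (List.map (λ i → suc (degree (f i))) (I .enum))) (s≤s z≤n) (go (I .enum))
    where
    go : ∀ is → sum (List.map (λ i → cost N (f i)) is)
              ≤ (2 + N) ^ sum (List.map (λ i → suc (degree (f i))) is)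
    go []       = z≤n
    go (i ∷ is) = sum-power N (degree (f i)) (sum (List.map (λ i → suc (degree (f i))) is)) (cost≤ N (f i)) (go is)
  cost≤ N (loop c) = begin
    suc (N * suc (cost N c))      ≤⟨ s≤s (m≤n+m _ _) ⟩
    suc N * suc (cost N c)        ≤⟨ *-mono-≤ (n≤1+n (suc N)) (sum-power N 0 (degree c) (s≤s z≤n) (cost≤ N c)) ⟩
    (2 + N) * (2 + N) ^ suc (degree c) ∎
    where open ≤-Reasoning
  cost≤ N (test _ _ c) = sum-power N 0 (degree c) (s≤s z≤n) (cost≤ N c)

within-mono : ∀ M {m n c c'} → m ≤ n → Within M m c c' → Within M n c c'
within-mono M le       here        = here
within-mono M (s≤s le) (there s w) = there s (within-mono M le w)

-- Compilation of stack programs to Turing machines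

module Compiler (A : Set) (finite-A : Finite A) (_≟A_ : DecidableEquality A) (K D : ℕ)
  (ℓ₀ : Fin D) (r₀ : Fin K) (bit : Bool → A) where

  open Language A K D

  Frames : Set → Set
  Frames X = Vec (Vec X K) D

  get : ∀ {X} → Frames X → Fin D → Fin K → X
  get v ℓ r = lookup (lookup v ℓ) r

  put : ∀ {X} → Frames X → Fin D → Fin K → X → Frames X
  put v ℓ r x = v [ ℓ ]≔ (lookup v ℓ [ r ]≔ x)

  put-get : ∀ {X} (v : Frames X) ℓ r → put v ℓ r (get v ℓ r) ≡ v
  put-get v ℓ r = trans (cong (v [ ℓ ]≔_) (Vec.[]≔-lookup _ r)) (Vec.[]≔-lookup v ℓ)

  Store Tracks : Set
  Store  = Frames (List A)
  Tracks = Frames (Maybe A)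

  slice : Store → ℕ → Tracks
  slice σ i = Vec.map (Vec.map (λ as → at as i)) σ

  slice-lookup : ∀ σ i ℓ → lookup (slice σ i) ℓ ≡ Vec.map (λ as → at as i) (lookup σ ℓ)
  slice-lookup σ i ℓ = Vec.lookup-map ℓ _ σ

  slice-get : ∀ σ i ℓ r → get (slice σ i) ℓ r ≡ at (get σ ℓ r) i
  slice-get σ i ℓ r = trans (cong (λ u → lookup u r) (slice-lookup σ i ℓ)) (Vec.lookup-map r _ (lookup σ ℓ))

  slice-put : ∀ σ i ℓ r as → slice (put σ ℓ r as) i ≡ put (slice σ i) ℓ r (at as i)
  slice-put σ i ℓ r as = trans (Vec.map-[]≔ _ σ ℓ) (cong (slice σ i [ ℓ ]≔_)
    (trans (Vec.map-[]≔ _ (lookup σ ℓ) r) (cong (_[ r ]≔ at as i) (sym (slice-lookup σ i ℓ)))))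

  slice-put-same : ∀ σ i ℓ r as → at as i ≡ at (get σ ℓ r) i → slice (put σ ℓ r as) i ≡ slice σ i
  slice-put-same σ i ℓ r as eq = trans (slice-put σ i ℓ r as)
    (trans (cong (put (slice σ i) ℓ r) (trans eq (sym (slice-get σ i ℓ r)))) (put-get (slice σ i) ℓ r))

  -- Atomic instructions as sweeps over the tape

  data Atom : Set where
    nop         : Atom
    popᴬ pushᴬ  : Fin D → Fin K → A → Atom
    isNilᴬ      : Fin D → Fin K → Atom
    copyᴬ       : Fin D → Fin D → Atom

  finite-Atom : Finite Atom
  finite-Atom = finite-image to from to∘from
    (finite-⊎ finite-⊤ (finite-⊎ finite-reg-sym (finite-⊎ finite-reg-sym
      (finite-⊎ (finite-× (finite-Fin D) (finite-Fin K)) (finite-× (finite-Fin D) (finite-Fin D))))))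
    where
    finite-reg-sym = finite-× (finite-Fin D) (finite-× (finite-Fin K) finite-A)
    RS = Fin D × Fin K × A
    to : ⊤ ⊎ RS ⊎ RS ⊎ (Fin D × Fin K) ⊎ (Fin D × Fin D) → Atom
    to (inj₁ _) = nop
    to (inj₂ (inj₁ (ℓ , r , a))) = popᴬ ℓ r a
    to (inj₂ (inj₂ (inj₁ (ℓ , r , a)))) = pushᴬ ℓ r a
    to (inj₂ (inj₂ (inj₂ (inj₁ (ℓ , r))))) = isNilᴬ ℓ r
    to (inj₂ (inj₂ (inj₂ (inj₂ (ℓ , ℓ'))))) = copyᴬ ℓ ℓ'
    from : Atom → ⊤ ⊎ RS ⊎ RS ⊎ (Fin D × Fin K) ⊎ (Fin D × Fin D)
    from nop = inj₁ tt
    from (popᴬ ℓ r a) = inj₂ (inj₁ (ℓ , r , a))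
    from (pushᴬ ℓ r a) = inj₂ (inj₂ (inj₁ (ℓ , r , a)))
    from (isNilᴬ ℓ r) = inj₂ (inj₂ (inj₂ (inj₁ (ℓ , r))))
    from (copyᴬ ℓ ℓ') = inj₂ (inj₂ (inj₂ (inj₂ (ℓ , ℓ'))))
    to∘from : ∀ a → to (from a) ≡ a
    to∘from nop = refl
    to∘from (popᴬ ℓ r a) = refl
    to∘from (pushᴬ ℓ r a) = refl
    to∘from (isNilᴬ ℓ r) = refl
    to∘from (copyᴬ ℓ ℓ') = refl

  Does : Atom → Store → Store → Set
  Does nop           σ σ' = σ' ≡ σ
  Does (popᴬ ℓ r a)  σ σ' = ∃ λ as → get σ ℓ r ≡ a ∷ as × σ' ≡ put σ ℓ r as
  Does (pushᴬ ℓ r a) σ σ' = σ' ≡ put σ ℓ r (a ∷ get σ ℓ r)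
  Does (isNilᴬ ℓ r)  σ σ' = get σ ℓ r ≡ [] × σ' ≡ σ
  Does (copyᴬ ℓ ℓ')  σ σ' = σ' ≡ σ [ ℓ' ]≔ lookup σ ℓ

  blanks : ∀ {n} → Vec (Maybe A) n
  blanks = replicate _ nothing

  _≟V_ : ∀ {n} → DecidableEquality (Vec (Maybe A) n)
  _≟V_ = Vec.≡-dec (Maybe.≡-dec _≟A_)

  -- One cell of the left-to-right sweep that executes an atom; nothing ends the sweep.
  -- A pop guesses the top of the stack, and the state true checks that the next cell is blank.
  scan : Atom → Bool → Tracks → List (Maybe Bool × Tracks)
  scan nop _ v = (nothing , v) ∷ []
  scan (popᴬ ℓ r a) false v with get v ℓ r
  ... | nothing = []
  ... | just b with b ≟A a
  ...   | yes _ = (just true , put v ℓ r nothing) ∷ (just false , v) ∷ []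
  ...   | no  _ = (just false , v) ∷ []
  scan (popᴬ ℓ r a) true v with get v ℓ r
  ... | nothing = (nothing , v) ∷ []
  ... | just _  = []
  scan (pushᴬ ℓ r a) _ v with get v ℓ r
  ... | nothing = (nothing , put v ℓ r (just a)) ∷ []
  ... | just _  = (just false , v) ∷ []
  scan (isNilᴬ ℓ r) _ v with get v ℓ r
  ... | nothing = (nothing , v) ∷ []
  ... | just _  = []
  scan (copyᴬ ℓ ℓ') _ v with lookup v ℓ ≟V blanks | lookup v ℓ' ≟V blanks
  ... | yes _ | yes _ = (nothing , v) ∷ []
  ... | _     | _     = (just false , v [ ℓ' ]≔ lookup v ℓ) ∷ []

  -- The control flow graph of a program

  -- The program points. A choice, a loop and a test have a point of their own, `nothing`, at which
  -- they decide or copy; a sequence only has the points of its parts.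
  Node : ∀ {ℓ} → Cmd ℓ → Set
  Node (pop r a)    = ⊤
  Node (push r a)   = ⊤
  Node (isNil r)    = ⊤
  Node (guard b)    = ⊤
  Node (c ⨾ d)      = Node c ⊎ Node d
  Node (pick {I = I} _ f) = Maybe (Σ I (λ i → Node (f i)))
  Node (loop c)     = Maybe (Node c)
  Node (test _ _ c) = Maybe (Node c)

  finite-Node : ∀ {ℓ} (c : Cmd ℓ) → Finite (Node c)
  finite-Node (pop r a)    = finite-⊤
  finite-Node (push r a)   = finite-⊤
  finite-Node (isNil r)    = finite-⊤
  finite-Node (guard b)    = finite-⊤
  finite-Node (c ⨾ d)      = finite-⊎ (finite-Node c) (finite-Node d)
  finite-Node (pick I f)   = finite-Maybe (finite-Σ I (λ i → finite-Node (f i)))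
  finite-Node (loop c)     = finite-Maybe (finite-Node c)
  finite-Node (test _ _ c) = finite-Maybe (finite-Node c)

  module _ {N : Set} where

    -- `ι` embeds the points of a part into those of the whole program, and `x` is where control
    -- goes afterwards; the target `nothing` is the end of the program.
    entry : ∀ {ℓ} (c : Cmd ℓ) → (Node c → N) → Maybe N → Maybe N
    entry (pop r a)    ι x = just (ι tt)
    entry (push r a)   ι x = just (ι tt)
    entry (isNil r)    ι x = just (ι tt)
    entry (guard b)    ι x = just (ι tt)
    entry (c ⨾ d)      ι x = entry c (ι ∘ inj₁) (entry d (ι ∘ inj₂) x)
    entry (pick _ f)   ι x = just (ι nothing)
    entry (loop c)     ι x = just (ι nothing)
    entry (test _ _ c) ι x = just (ι nothing)

    instr : ∀ {ℓ} (c : Cmd ℓ) → (Node c → N) → Maybe N → Node c → List (Atom × Maybe N)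
    instr {ℓ} (pop r a)       ι x _ = (popᴬ ℓ r a , x) ∷ []
    instr {ℓ} (push r a)      ι x _ = (pushᴬ ℓ r a , x) ∷ []
    instr {ℓ} (isNil r)       ι x _ = (isNilᴬ ℓ r , x) ∷ []
    instr (guard true)        ι x _ = (nop , x) ∷ []
    instr (guard false)       ι x _ = []
    instr (c ⨾ d)             ι x (inj₁ n) = instr c (ι ∘ inj₁) (entry d (ι ∘ inj₂) x) n
    instr (c ⨾ d)             ι x (inj₂ n) = instr d (ι ∘ inj₂) x n
    instr (pick I f)          ι x nothing  =
      List.map (λ i → nop , entry (f i) (λ n → ι (just (i , n))) x) (I .enum)
    instr (pick I f)          ι x (just (i , n)) = instr (f i) (λ n → ι (just (i , n))) x n
    instr (loop c)            ι x nothing  =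
      (nop , x) ∷ (nop , entry c (ι ∘ just) (just (ι nothing))) ∷ []
    instr (loop c)            ι x (just n) = instr c (ι ∘ just) (just (ι nothing)) n
    -- The body leaves through the exit of the test: it works on deeper levels, so the original
    -- stacks are still in place.
    instr {ℓ} (test ℓ' _ c)   ι x nothing  = (copyᴬ ℓ ℓ' , entry c (ι ∘ just) x) ∷ []
    instr (test ℓ' _ c)       ι x (just n) = instr c (ι ∘ just) x n

  -- The Turing machine of a program

  module Machine (main : Cmd ℓ₀) where

    Target : Set
    Target = Maybe (Node main)

    next : Target → List (Atom × Target)
    next nothing  = []
    next (just n) = instr main id nothing n

    -- Between two atoms the head rests on cell 0, in state `home`. An atom is one sweep to the
    -- right followed by a return, `ret`, to the mark on cell 0 that `boot` has written.
    data Control : Set where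
      boot  : Control
      home  : Target → Control
      sweep : Atom → Target → Bool → Control
      ret   : Target → Control

    abstract
      finite-Control : Finite Control
      finite-Control = finite-image to from to∘from
        (finite-⊎ finite-⊤ (finite-⊎ finite-Target
          (finite-⊎ (finite-× finite-Atom (finite-× finite-Target finite-Bool)) finite-Target)))
        where
        finite-Target : Finite Target
        finite-Target = finite-Maybe (finite-Node main)
        to : ⊤ ⊎ Target ⊎ (Atom × Target × Bool) ⊎ Target → Control
        to (inj₁ _) = boot
        to (inj₂ (inj₁ x)) = home x
        to (inj₂ (inj₂ (inj₁ (α , x , b)))) = sweep α x b
        to (inj₂ (inj₂ (inj₂ x))) = ret x
        from : Control → ⊤ ⊎ Target ⊎ (Atom × Target × Bool) ⊎ Target
        from boot = inj₁ tt
        from (home x) = inj₂ (inj₁ x)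
        from (sweep α x b) = inj₂ (inj₂ (inj₁ (α , x , b)))
        from (ret x) = inj₂ (inj₂ (inj₂ x))
        to∘from : ∀ q → to (from q) ≡ q
        to∘from boot = refl
        to∘from (home x) = refl
        to∘from (sweep α x b) = refl
        to∘from (ret x) = refl

    -- The flag of a cell marks position 0.
    Cell : Set
    Cell = Bool × Tracks

    abstract
      finite-Cell : Finite Cell
      finite-Cell = finite-× finite-Bool (finite-Vec (finite-Vec (finite-Maybe finite-A) K) D)

    encCell : Cell → Fin (3 + card finite-Cell)
    encCell c = suc (suc (suc (code finite-Cell c)))

    noTracks : Tracks
    noTracks = replicate D blanks

    -- The blank and the two input symbols are read as cells too, so the raw input already
    -- represents a store.
    decCell : Fin (3 + card finite-Cell) → Cell
    decCell zero                = false , noTracks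
    decCell (suc zero)          = false , put noTracks ℓ₀ r₀ (just (bit false))
    decCell (suc (suc zero))    = false , put noTracks ℓ₀ r₀ (just (bit true))
    decCell (suc (suc (suc k))) = decode finite-Cell k

    Action : Set
    Action = Control × Cell × Move

    swept : Atom → Target → Bool → Maybe Bool × Tracks → Action
    swept α x flag (just b , v)  = sweep α x b , (flag , v) , mR
    swept α x flag (nothing , v) = ret x , (flag , v) , mS

    act : Control → Cell → List Action
    act boot (flag , v)              = (home (entry main id nothing) , (true , v) , mS) ∷ []
    act (home x) c                   = List.map (λ (α , y) → sweep α y false , c , mS) (next x)
    act (sweep α x b) (flag , v)     = List.map (swept α x flag) (scan α b v)
    act (ret x) (true , v)           = (home x , (true , v) , mS) ∷ []
    act (ret x) (false , v)          = (ret x , (false , v) , mL) ∷ []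

    encAction : Action → Fin (card finite-Control) × Fin (3 + card finite-Cell) × Move
    encAction (q , c , m) = code finite-Control q , encCell c , m

    machine : NTM
    machine .NTM.nQ     = card finite-Control
    machine .NTM.nΓ     = card finite-Cell
    machine .NTM.start  = code finite-Control boot
    machine .NTM.accept = code finite-Control (home nothing)
    machine .NTM.δ q c  = List.map encAction (act (decode finite-Control q) (decCell c))

    Tape : Set
    Tape = ℤ → Fin (3 + card finite-Cell)

    record Accepts (n : ℕ) (q : Control) (h : ℤ) (t : Tape) : Set where
      constructor accepts
      field
        final     : Config machine
        run       : Within machine n (cfg (code finite-Control q) h t) final
        accepting : Config.state final ≡ code finite-Control (home nothing)

    Accepts-mono : ∀ {m n q h t} → m ≤ n → Accepts m q h t → Accepts n q h t
    Accepts-mono le (accepts c w eq) = accepts c (within-mono machine le w) eq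

    Accepts-step : ∀ {n q h t q' c m} → (q' , c , m) ∈ act q (decCell (t h)) →
      Accepts n q' (moveHead machine m h) (write machine t h (encCell c)) → Accepts (suc n) q h t
    Accepts-step {q = q} mem (accepts c w eq) = accepts c (there (step mem') w) eq
      where
      mem' = subst (λ p → encAction _ ∈ List.map encAction (act p _)) (sym (decode-code finite-Control q))
               (∈-map⁺ encAction mem)

    Accepts-inv : ∀ {n q h t} → q ≢ home nothing → Accepts n q h t →
      ∃ λ n' → n ≡ suc n' × ∃ λ ((q' , c , m) : Action) → (q' , c , m) ∈ act q (decCell (t h))
        × Accepts n' q' (moveHead machine m h) (write machine t h (encCell c))
    Accepts-inv {q = q} q≢ (accepts c here eq) = contradiction
      (trans (sym (decode-code finite-Control q))
        (trans (cong (decode finite-Control) eq) (decode-code finite-Control (home nothing)))) q≢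
    Accepts-inv {q = q} q≢ (accepts c (there (step mem) w) eq)
      with ∈-map⁻ encAction (subst (λ p → _ ∈ List.map encAction (act p _)) (decode-code finite-Control q) mem)
    ... | action , mem' , refl = _ , refl , action , mem' , accepts c w eq

    isZero : ℕ → Bool
    isZero zero    = true
    isZero (suc _) = false

    -- Only the positions from 0 on are described, because the head turns back at the mark of cell
    -- 0.
    record Rep (t : Tape) (f : ℕ → Tracks) : Set where
      constructor represents
      field cell : ∀ i → decCell (t (ℤ.+ i)) ≡ (isZero i , f i)

    open Rep

    update : (ℕ → Tracks) → ℕ → Tracks → ℕ → Tracks
    update f i v j with j ≟ i
    ... | yes _ = v
    ... | no  _ = f j

    update-at : ∀ f i v → update f i v i ≡ v
    update-at f i v with i ≟ i
    ... | yes _ = refl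
    ... | no ≢  = contradiction refl ≢

    update-off : ∀ f {i} v {j} → j ≢ i → update f i v j ≡ f j
    update-off f {i} v {j} ≢ with j ≟ i
    ... | yes eq = contradiction eq ≢
    ... | no  _  = refl

    update-≗ : ∀ {f g : ℕ → Tracks} {i v} → (∀ j → j ≢ i → f j ≡ g j) → v ≡ g i → ∀ j → update f i v j ≡ g j
    update-≗ {i = i} off on j with j ≟ i
    ... | yes refl = on
    ... | no  ≢    = off j ≢

    Rep-write : ∀ {t f} i v → Rep t f → Rep (write machine t (ℤ.+ i) (encCell (isZero i , v))) (update f i v)
    Rep-write i v rep .cell j with j ≟ i
    ... | yes refl rewrite dec-true (i ≟ i) refl = decode-code finite-Cell (isZero i , v)
    ... | no  ≢    rewrite dec-false (j ≟ i) ≢   = rep .cell j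

    Rep-≗ : ∀ {t f g} → (∀ j → f j ≡ g j) → Rep t f → Rep t g
    Rep-≗ h rep .cell j = trans (rep .cell j) (cong (isZero j ,_) (h j))

    -- The two readings of "the machine accepts within n steps from control q, head position i and
    -- tape contents f": for some tape (used for soundness) and for every tape (completeness).
    Can Must : ℕ → Control → ℕ → (ℕ → Tracks) → Set
    Can  n q i f = ∃ λ t → Rep t f × Accepts n q (ℤ.+ i) t
    Must n q i f = ∀ t → Rep t f → Accepts n q (ℤ.+ i) t

    Can-≗ : ∀ {n q i f g} → (∀ j → f j ≡ g j) → Can n q i f → Can n q i g
    Can-≗ h (t , rep , acc) = t , Rep-≗ h rep , acc

    Must-≗ : ∀ {n q i f g} → (∀ j → g j ≡ f j) → Must n q i f → Must n q i g
    Must-≗ h must t rep = must t (Rep-≗ h rep)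

    Must-mono : ∀ {m n q i f} → m ≤ n → Must m q i f → Must n q i f
    Must-mono le must t rep = Accepts-mono le (must t rep)

    +-1 : ∀ i → moveHead machine mR (ℤ.+ i) ≡ ℤ.+ (suc i)
    +-1 i = cong ℤ.+_ (+-comm i 1)

    Swept : ℕ → Atom → Target → ℕ → (ℕ → Tracks) → Maybe Bool → Set
    Swept n α x i f (just b) = Can n (sweep α x b) (suc i) f
    Swept n α x i f nothing  = Can n (ret x) i f

    sweep-inv : ∀ {n α x b i f} → Can n (sweep α x b) i f →
      ∃ λ n' → n ≡ suc n' × ∃ λ ((o , v) : Maybe Bool × Tracks) → (o , v) ∈ scan α b (f i)
        × Swept n' α x i (update f i v) o
    sweep-inv {α = α} {x} {b} {i} {f} (t , rep , acc) with Accepts-inv {q = sweep α x b} (λ ()) acc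
    ... | n' , refl , action , mem , acc' rewrite rep .cell i with ∈-map⁻ (swept α x (isZero i)) mem
    ... | (just b' , v) , mem' , refl =
            n' , refl , _ , mem' , _ , Rep-write i v rep , subst (λ h → Accepts n' (sweep α x b') h (write machine t (ℤ.+ i) (encCell (isZero i , v)))) (+-1 i) acc'
    ... | (nothing , v) , mem' , refl = n' , refl , _ , mem' , _ , Rep-write i v rep , acc'

    sweep-on : ∀ {n α x b i f b' v} → (just b' , v) ∈ scan α b (f i) →
      Must n (sweep α x b') (suc i) (update f i v) → Must (suc n) (sweep α x b) i f
    sweep-on {n} {α} {x} {b} {i} {f} {b'} {v} mem must t rep = Accepts-step
      (subst (λ c → swept α x (isZero i) (just b' , v) ∈ act (sweep α x b) c) (sym (rep .cell i))
        (∈-map⁺ (swept α x (isZero i)) mem))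
      (subst (λ h → Accepts n (sweep α x b') h (write machine t (ℤ.+ i) (encCell (isZero i , v)))) (sym (+-1 i)) (must _ (Rep-write i v rep)))

    sweep-end : ∀ {n α x b i f v} → (nothing , v) ∈ scan α b (f i) →
      Must n (ret x) i (update f i v) → Must (suc n) (sweep α x b) i f
    sweep-end {n} {α} {x} {b} {i} {f} {v} mem must t rep = Accepts-step
      (subst (λ c → swept α x (isZero i) (nothing , v) ∈ act (sweep α x b) c) (sym (rep .cell i))
        (∈-map⁺ (swept α x (isZero i)) mem))
      (must _ (Rep-write i v rep))

    rewritten : ∀ {t f} i → Rep t f → Rep (write machine t (ℤ.+ i) (encCell (isZero i , f i))) f
    rewritten {f = f} i rep = Rep-≗ (update-≗ {f = f} (λ _ _ → refl) refl) (Rep-write i (f i) rep)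

    ret-inv : ∀ {n x} i {f} → Can n (ret x) i f → ∃ λ n' → n' < n × Can n' (home x) 0 f
    ret-inv {x = x} i (t , rep , acc) with Accepts-inv {q = ret x} (λ ()) acc
    ret-inv {x = x} zero (t , rep , acc) | n' , refl , action , mem , acc' rewrite rep .cell 0 with mem
    ... | here refl = n' , ≤-refl , _ , rewritten 0 rep , acc'
    ret-inv {x = x} (suc i) (t , rep , acc) | n' , refl , action , mem , acc' rewrite rep .cell (suc i) with mem
    ... | here refl with ret-inv i (_ , rewritten (suc i) rep , acc')
    ... | n'' , lt , can = n'' , ≤-trans lt (n≤1+n n') , can

    ret-run : ∀ {n x} i {f} → Must n (home x) 0 f → Must (suc i + n) (ret x) i f
    ret-run {x = x} zero {f} must t rep = Accepts-step
      (subst (λ c → (home x , (true , f 0) , mS) ∈ act (ret x) c) (sym (rep .cell 0)) (here refl))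
      (must _ (rewritten 0 rep))
    ret-run {x = x} (suc i) {f} must t rep = Accepts-step
      (subst (λ c → (ret x , (false , f (suc i)) , mL) ∈ act (ret x) c) (sym (rep .cell (suc i))) (here refl))
      (ret-run i must _ (rewritten (suc i) rep))

    home-inv : ∀ {n m f} → Can n (home (just m)) 0 f →
      ∃ λ n' → n ≡ suc n' × ∃ λ ((α , x) : Atom × Target) → (α , x) ∈ next (just m) × Can n' (sweep α x false) 0 f
    home-inv {m = m} {f} (t , rep , acc) with Accepts-inv {q = home (just m)} (λ ()) acc
    ... | n' , refl , action , mem , acc' rewrite rep .cell 0 with ∈-map⁻ _ mem
    ... | (α , x) , mem' , refl = n' , refl , (α , x) , mem' , _ , rewritten 0 rep , acc'

    home-run : ∀ {n m f α x} → (α , x) ∈ next (just m) → Must n (sweep α x false) 0 f →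
      Must (suc n) (home (just m)) 0 f
    home-run {m = m} {f} {α} {x} mem must t rep = Accepts-step
      (subst (λ c → (sweep α x false , (true , f 0) , mS) ∈ act (home (just m)) c) (sym (rep .cell 0))
        (∈-map⁺ (λ (α , y) → sweep α y false , (true , f 0) , mS) mem))
      (must _ (rewritten 0 rep))

    Home : ℕ → Target → Store → Set
    Home n x σ = Can n (home x) 0 (slice σ)

    unchanged : ∀ (f : ℕ → Tracks) i j → update f i (f i) j ≡ f j
    unchanged f i = update-≗ {f = f} (λ _ _ → refl) refl

    -- Soundness of the sweeps

    -- The strict decrease of the number of steps makes the later induction over loop iterations
    -- well-founded.
    record AtomDone (n : ℕ) (α : Atom) (x : Target) (σ : Store) : Set where
      constructor atomDone
      field
        {rest}  : ℕ
        {store} : Store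
        shorter : rest < n
        effect  : Does α σ store
        resumed : Home rest x store

    later : ∀ {n α x σ} → AtomDone n α x σ → AtomDone (suc n) α x σ
    later (atomDone lt does h) = atomDone (≤-trans lt (n≤1+n _)) does h

    finished : ∀ {n α x σ σ' i f} → Does α σ σ' → (∀ j → f j ≡ slice σ' j) → Can n (ret x) i f →
      AtomDone (suc n) α x σ
    finished {i = i} does eq can with ret-inv i (Can-≗ eq can)
    ... | n' , lt , h = atomDone (≤-trans lt (n≤1+n _)) does h

    pushed-slice : ∀ σ ℓ r a i → i ≡ length (get σ ℓ r) → ∀ j →
      update (slice σ) i (put (slice σ i) ℓ r (just a)) j ≡ slice (put σ ℓ r (a ∷ get σ ℓ r)) j
    pushed-slice σ ℓ r a i refl = update-≗ {f = slice σ}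
      (λ j ≢ → sym (slice-put-same σ j ℓ r _ (at-below a (get σ ℓ r) ≢)))
      (trans (cong (put (slice σ i) ℓ r) (sym (at-top a (get σ ℓ r)))) (sym (slice-put σ i ℓ r _)))

    popped-slice : ∀ σ ℓ r a as i → get σ ℓ r ≡ a ∷ as → i ≡ length as → ∀ j →
      update (slice σ) i (put (slice σ i) ℓ r nothing) j ≡ slice (put σ ℓ r as) j
    popped-slice σ ℓ r a as i eq refl = update-≗ {f = slice σ}
      (λ j ≢ → sym (slice-put-same σ j ℓ r as
        (trans (sym (at-below a as ≢)) (cong (λ bs → at bs j) (sym eq)))))
      (trans (cong (put (slice σ i) ℓ r) (sym (at-beyond as ≤-refl))) (sym (slice-put σ i ℓ r as)))

    -- By the invariant `i ≤ length`, the head has not passed the top; the first blank cell it meets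
    -- is therefore the one just above the top.
    push-inv : ∀ n {ℓ r a x b σ i} → i ≤ length (get σ ℓ r) →
      Can n (sweep (pushᴬ ℓ r a) x b) i (slice σ) → AtomDone n (pushᴬ ℓ r a) x σ
    push-inv n {ℓ} {r} {a} {x} {b} {σ} {i} le can with sweep-inv can
    ... | n' , refl , (o , v) , mem , can' with get (slice σ i) ℓ r in eq | mem
    ...   | nothing | here refl = finished refl (pushed-slice σ ℓ r a i
              (≤-antisym le (at-nothing (get σ ℓ r) (trans (sym (slice-get σ i ℓ r)) eq)))) can'
    ...   | just c  | here refl = later (push-inv n' (at-just (get σ ℓ r) (trans (sym (slice-get σ i ℓ r)) eq))
              (Can-≗ (unchanged (slice σ) i) can'))

    -- A wrong guess fails here: cell `i` was occupied and cell `i + 1` has to be blank, so the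
    -- erased letter was the top.
    pop-check : ∀ n {ℓ r a x σ} i f → at (get σ ℓ r) i ≡ just a →
      (∀ j → j ≢ i → f j ≡ slice σ j) → f i ≡ put (slice σ i) ℓ r nothing →
      Can n (sweep (popᴬ ℓ r a) x true) (suc i) f → AtomDone n (popᴬ ℓ r a) x σ
    pop-check n {ℓ} {r} {a} {x} {σ} i f top off on can with sweep-inv can
    ... | n' , refl , (o , v) , mem , can' rewrite off (suc i) 1+n≢n with get (slice σ (suc i)) ℓ r in eq | mem
    ...   | nothing | here refl = go (get σ ℓ r) refl top
              (at-nothing (get σ ℓ r) (trans (sym (slice-get σ (suc i) ℓ r)) eq))
      where
      go : ∀ bs → get σ ℓ r ≡ bs → at bs i ≡ just a → length bs ≤ suc i → AtomDone (suc n') (popᴬ ℓ r a) x σ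
      go (b ∷ bs) eq' top le with i ≟ length bs
      ... | no ≢ = contradiction (at-just bs top) (≤⇒≯ (s≤s⁻¹ le))
      go (b ∷ bs) eq' refl le | yes len = finished (bs , eq' , refl) h can'
        where
        h : ∀ j → update f (suc i) (slice σ (suc i)) j ≡ slice (put σ ℓ r bs) j
        h j = trans (update-≗ {f = f} {g = f} (λ _ _ → refl) (sym (off (suc i) 1+n≢n)) j)
          (trans (sym (update-≗ {f = slice σ} {g = f} (λ j ≢ → sym (off j ≢)) (sym on) j))
            (popped-slice σ ℓ r a bs i eq' len j))

    pop-inv : ∀ n {ℓ r a x σ i} →
      Can n (sweep (popᴬ ℓ r a) x false) i (slice σ) → AtomDone n (popᴬ ℓ r a) x σ
    pop-inv n {ℓ} {r} {a} {x} {σ} {i} can with sweep-inv can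
    ... | n' , refl , (o , v) , mem , can' with get (slice σ i) ℓ r in eq
    ...   | just c with c ≟A a | mem
    ...     | yes refl | here refl = later (pop-check n' i _ (trans (sym (slice-get σ i ℓ r)) eq)
                (λ j ≢ → update-off (slice σ) _ ≢) (update-at (slice σ) i _) can')
    ...     | yes _ | there (here refl) = later (pop-inv n' (Can-≗ (unchanged (slice σ) i) can'))
    ...     | no  _ | here refl = later (pop-inv n' (Can-≗ (unchanged (slice σ) i) can'))

    slice-copy : ∀ σ ℓ ℓ' i → slice (σ [ ℓ' ]≔ lookup σ ℓ) i ≡ slice σ i [ ℓ' ]≔ lookup (slice σ i) ℓ
    slice-copy σ ℓ ℓ' i = trans (Vec.map-[]≔ _ σ ℓ') (cong (slice σ i [ ℓ' ]≔_) (sym (slice-lookup σ i ℓ)))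

    -- Stacks have no gaps, which lets a copy stop at the first cell that is blank on both levels.
    -- Both matter: a target stack higher than its source has to be erased above it.
    blanks-beyond : ∀ σ ℓ {i j} → i ≤ j → lookup (slice σ i) ℓ ≡ blanks → lookup (slice σ j) ℓ ≡ blanks
    blanks-beyond σ ℓ {i} {j} le eq = trans (slice-lookup σ j ℓ)
      (go (lookup σ ℓ) (trans (sym (slice-lookup σ i ℓ)) eq))
      where
      go : ∀ {n} (s : Vec (List A) n) → Vec.map (λ as → at as i) s ≡ blanks → Vec.map (λ as → at as j) s ≡ blanks
      go []       eq = refl
      go (as ∷ s) eq = cong₂ _∷_ (at-≤ as le (cong Vec.head eq)) (go s (cong Vec.tail eq))

    copy-blank : ∀ σ ℓ ℓ' j → lookup (slice σ j) ℓ ≡ blanks → lookup (slice σ j) ℓ' ≡ blanks →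
      slice σ j ≡ slice (σ [ ℓ' ]≔ lookup σ ℓ) j
    copy-blank σ ℓ ℓ' j p q = sym (trans (slice-copy σ ℓ ℓ' j)
      (trans (cong (slice σ j [ ℓ' ]≔_) (trans p (sym q))) (Vec.[]≔-lookup (slice σ j) ℓ')))

    record Copied (σ : Store) (ℓ ℓ' : Fin D) (i : ℕ) (f : ℕ → Tracks) : Set where
      field
        done : ∀ j → j < i → f j ≡ slice (σ [ ℓ' ]≔ lookup σ ℓ) j
        todo : ∀ j → i ≤ j → f j ≡ slice σ j

    open Copied

    copied-next : ∀ {σ ℓ ℓ' i f} → Copied σ ℓ ℓ' i f →
      Copied σ ℓ ℓ' (suc i) (update f i (f i [ ℓ' ]≔ lookup (f i) ℓ))
    copied-next {σ} {ℓ} {ℓ'} {i} {f} cp .done j (s≤s le) with j ≟ i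
    ... | yes refl rewrite cp .todo j ≤-refl = sym (slice-copy σ ℓ ℓ' j)
    ... | no ≢ = cp .done j (≤∧≢⇒< le ≢)
    copied-next {f = f} cp .todo j le = trans (update-off f _ (λ { refl → 1+n≰n le })) (cp .todo j (≤-trans (n≤1+n _) le))

    copied-end : ∀ {σ ℓ ℓ' i f} → Copied σ ℓ ℓ' i f → lookup (f i) ℓ ≡ blanks → lookup (f i) ℓ' ≡ blanks →
      ∀ j → update f i (f i) j ≡ slice (σ [ ℓ' ]≔ lookup σ ℓ) j
    copied-end {σ} {ℓ} {ℓ'} {i} {f} cp p q j rewrite cp .todo i ≤-refl with j ≟ i | j <? i
    ... | yes refl | _      = copy-blank σ ℓ ℓ' j p q
    ... | no _     | yes lt = cp .done j lt
    ... | no _     | no ≮   = trans (cp .todo j (≮⇒≥ ≮))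
      (copy-blank σ ℓ ℓ' j (blanks-beyond σ ℓ (≮⇒≥ ≮) p) (blanks-beyond σ ℓ' (≮⇒≥ ≮) q))

    copy-inv : ∀ n {ℓ ℓ' x b σ i f} → Copied σ ℓ ℓ' i f →
      Can n (sweep (copyᴬ ℓ ℓ') x b) i f → AtomDone n (copyᴬ ℓ ℓ') x σ
    copy-inv n {ℓ} {ℓ'} {i = i} {f} cp can with sweep-inv can
    ... | n' , refl , (o , v) , mem , can' with lookup (f i) ℓ ≟V blanks | lookup (f i) ℓ' ≟V blanks | mem
    ...   | yes p | yes q | here refl = finished refl (copied-end cp p q) can'
    ...   | yes _ | no  _ | here refl = later (copy-inv n' (copied-next cp) can')
    ...   | no  _ | yes _ | here refl = later (copy-inv n' (copied-next cp) can')
    ...   | no  _ | no  _ | here refl = later (copy-inv n' (copied-next cp) can')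

    atom-inv : ∀ α {n x σ} → Can n (sweep α x false) 0 (slice σ) → AtomDone n α x σ
    atom-inv nop {σ = σ} can with sweep-inv can
    ... | n' , refl , _ , here refl , can' = finished refl (unchanged (slice σ) 0) can'
    atom-inv (popᴬ ℓ r a) can = pop-inv _ can
    atom-inv (pushᴬ ℓ r a) can = push-inv _ z≤n can
    atom-inv (isNilᴬ ℓ r) {σ = σ} can with sweep-inv can
    ... | n' , refl , _ , mem , can' with get (slice σ 0) ℓ r in eq | mem
    ...   | nothing | here refl = finished (nil (get σ ℓ r) (at-nothing (get σ ℓ r) (trans (sym (slice-get σ 0 ℓ r)) eq)) , refl)
              (unchanged (slice σ) 0) can'
      where
      nil : ∀ (as : List A) → length as ≤ 0 → as ≡ []
      nil [] _ = refl
    atom-inv (copyᴬ ℓ ℓ') can = copy-inv _ (record { done = λ _ () ; todo = λ _ _ → refl }) can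

    -- Completeness and duration of the sweeps

    MustHome : ℕ → Target → Store → Set
    MustHome n x σ = Must n (home x) 0 (slice σ)

    at-occupied : ∀ (as : List A) {i} → i < length as → ∃ λ c → at as i ≡ just c
    at-occupied as {i} lt with at as i in eq
    ... | just c  = c , refl
    ... | nothing = contradiction (at-nothing as eq) (<⇒≱ lt)

    -- One step ends the sweep, and `i + 1` steps lead home, the last of them changing the state on
    -- cell 0.
    land : ∀ {n α x b i f v σ'} → (nothing , v) ∈ scan α b (f i) →
      (∀ j → slice σ' j ≡ update f i v j) → MustHome n x σ' → Must (2 + i + n) (sweep α x b) i f
    land {i = i} mem eq must = sweep-end mem (ret-run i (Must-≗ (λ j → sym (eq j)) must))

    push-run : ∀ d i {ℓ r a n x b σ} → i + d ≡ length (get σ ℓ r) →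
      MustHome n x (put σ ℓ r (a ∷ get σ ℓ r)) →
      Must (d + (2 + length (get σ ℓ r) + n)) (sweep (pushᴬ ℓ r a) x b) i (slice σ)
    push-run zero i {ℓ} {r} {a} {n} {x} {b} {σ} eq must = Must-mono (≤-reflexive (cong (λ l → 2 + l + n) i≡))
      (land (mem (trans (slice-get σ i ℓ r) (at-beyond (get σ ℓ r) (≤-reflexive (sym i≡)))))
        (λ j → sym (pushed-slice σ ℓ r a i i≡ j)) must)
      where
      i≡ : i ≡ length (get σ ℓ r)
      i≡ = trans (sym (+-identityʳ i)) eq
      mem : ∀ {v} → get v ℓ r ≡ nothing → (nothing , put v ℓ r (just a)) ∈ scan (pushᴬ ℓ r a) b v
      mem {v} eq with get v ℓ r | eq
      ... | nothing | refl = here refl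
    push-run (suc d) i {ℓ} {r} {a} {n} {x} {b} {σ} eq must
      with at-occupied (get σ ℓ r) {i} (≤-trans (m≤m+n (suc i) d) (≤-reflexive (trans (sym (+-suc i d)) eq)))
    ... | c , occ = sweep-on (mem (trans (slice-get σ i ℓ r) occ))
      (Must-≗ (unchanged (slice σ) i) (push-run d (suc i) (trans (sym (+-suc i d)) eq) must))
      where
      mem : ∀ {v c} → get v ℓ r ≡ just c → (just false , v) ∈ scan (pushᴬ ℓ r a) b v
      mem {v} eq with get v ℓ r | eq
      ... | just _ | refl = here refl

    pop-run : ∀ d i {ℓ r a as n x σ} → get σ ℓ r ≡ a ∷ as → i + d ≡ length as →
      MustHome n x (put σ ℓ r as) →
      Must (d + (4 + length as + n)) (sweep (popᴬ ℓ r a) x false) i (slice σ)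
    -- The constant four: one step erases the top, one checks the next cell, and the return from
    -- that cell takes `i + 2`.
    pop-run zero i {ℓ} {r} {a} {as} {n} {x} {σ} top eq must =
      Must-mono (≤-reflexive (cong (λ l → 4 + l + n) i≡))
        (sweep-on (mem (trans (slice-get σ i ℓ r) (trans (cong₂ at top i≡) (at-top a as))))
          (land (mem' (trans (cong (λ v → get v ℓ r) (update-off (slice σ) _ 1+n≢n))
              (trans (slice-get σ (suc i) ℓ r) (trans (cong (λ bs → at bs (suc i)) top)
                (at-beyond (a ∷ as) (≤-reflexive (cong suc (sym i≡))))))))
            (λ j → sym (trans (unchanged _ (suc i) j) (popped-slice σ ℓ r a as i top i≡ j))) must))
      where
      i≡ : i ≡ length as
      i≡ = trans (sym (+-identityʳ i)) eq
      mem : ∀ {v} → get v ℓ r ≡ just a → (just true , put v ℓ r nothing) ∈ scan (popᴬ ℓ r a) false v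
      mem {v} eq with get v ℓ r | eq
      ... | just _ | refl with a ≟A a
      ...   | yes _ = here refl
      ...   | no ≢ = contradiction refl ≢
      mem' : ∀ {v} → get v ℓ r ≡ nothing → (nothing , v) ∈ scan (popᴬ ℓ r a) true v
      mem' {v} eq with get v ℓ r | eq
      ... | nothing | refl = here refl
    pop-run (suc d) i {ℓ} {r} {a} {as} {n} {x} {σ} top eq must
      with at-occupied (get σ ℓ r) {i} (≤-trans (m≤m+n (suc i) d)
             (≤-trans (≤-reflexive (trans (sym (+-suc i d)) eq)) (≤-trans (n≤1+n _) (≤-reflexive (sym (cong length top))))))
    ... | c , occ = sweep-on (mem (trans (slice-get σ i ℓ r) occ))
      (Must-≗ (unchanged (slice σ) i) (pop-run d (suc i) top (trans (sym (+-suc i d)) eq) must))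
      where
      mem : ∀ {v c} → get v ℓ r ≡ just c → (just false , v) ∈ scan (popᴬ ℓ r a) false v
      mem {v} eq with get v ℓ r | eq
      ... | just c | refl with c ≟A a
      ...   | yes _ = there (here refl)
      ...   | no _  = here refl

    Bounded : ℕ → Store → Set
    Bounded L σ = ∀ ℓ r → length (get σ ℓ r) ≤ L

    bounded-blank : ∀ {L σ i} → Bounded L σ → L ≤ i → ∀ ℓ → lookup (slice σ i) ℓ ≡ blanks
    bounded-blank {σ = σ} {i} bd le ℓ = trans (slice-lookup σ i ℓ) (go (lookup σ ℓ) (bd ℓ))
      where
      go : ∀ {n} (s : Vec (List A) n) → (∀ r → length (lookup s r) ≤ _) → Vec.map (λ as → at as i) s ≡ blanks
      go []       h = refl
      go (as ∷ s) h = cong₂ _∷_ (at-beyond as (≤-trans (h zero) le)) (go s (λ r → h (suc r)))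

    -- At position `L` every stack has ended, so the sweep stops there at the latest.
    copy-run : ∀ {L} d i {ℓ ℓ' n x b σ f} → Bounded L σ → Copied σ ℓ ℓ' i f → i + d ≡ L →
      MustHome n x (σ [ ℓ' ]≔ lookup σ ℓ) →
      Must (d + (2 + L + n)) (sweep (copyᴬ ℓ ℓ') x b) i f
    copy-run {L} d i {ℓ} {ℓ'} {n} {x} {b} {σ} {f} bd cp eq must
      with lookup (f i) ℓ ≟V blanks | lookup (f i) ℓ' ≟V blanks
    ... | yes p | yes q = Must-mono (≤-trans (+-monoˡ-≤ n (+-monoʳ-≤ 2 (≤-trans (m≤m+n i d) (≤-reflexive eq)))) (m≤n+m _ d))
        (land mem (λ j → sym (copied-end cp p q j)) must)
      where
      mem : (nothing , f i) ∈ scan (copyᴬ ℓ ℓ') b (f i)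
      mem with lookup (f i) ℓ ≟V blanks | lookup (f i) ℓ' ≟V blanks
      ... | yes _ | yes _ = here refl
      ... | no ¬p | _ = contradiction p ¬p
      ... | yes _ | no ¬q = contradiction q ¬q
    copy-run {L} zero i {ℓ} {ℓ'} {σ = σ} bd cp eq must | no ¬p | _ = contradiction
      (trans (cong (λ v → lookup v ℓ) (cp .todo i ≤-refl)) (bounded-blank {σ = σ} bd (≤-reflexive (trans (sym eq) (+-identityʳ i))) ℓ)) ¬p
    copy-run {L} zero i {ℓ} {ℓ'} {σ = σ} bd cp eq must | yes _ | no ¬p = contradiction
      (trans (cong (λ v → lookup v ℓ') (cp .todo i ≤-refl)) (bounded-blank {σ = σ} bd (≤-reflexive (trans (sym eq) (+-identityʳ i))) ℓ')) ¬p
    copy-run {L} (suc d) i {ℓ} {ℓ'} {b = b} {f = f} bd cp eq must | no ¬p | _ =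
      sweep-on mem (copy-run d (suc i) bd (copied-next cp) (trans (sym (+-suc i d)) eq) must)
      where
      mem : (just false , f i [ ℓ' ]≔ lookup (f i) ℓ) ∈ scan (copyᴬ ℓ ℓ') b (f i)
      mem with lookup (f i) ℓ ≟V blanks | lookup (f i) ℓ' ≟V blanks
      ... | yes p | _ = contradiction p ¬p
      ... | no _ | yes _ = here refl
      ... | no _ | no _ = here refl
    copy-run {L} (suc d) i {ℓ} {ℓ'} {b = b} {f = f} bd cp eq must | yes _ | no ¬q =
      sweep-on mem (copy-run d (suc i) bd (copied-next cp) (trans (sym (+-suc i d)) eq) must)
      where
      mem : (just false , f i [ ℓ' ]≔ lookup (f i) ℓ) ∈ scan (copyᴬ ℓ ℓ') b (f i)
      mem with lookup (f i) ℓ ≟V blanks | lookup (f i) ℓ' ≟V blanks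
      ... | _ | yes q = contradiction q ¬q
      ... | yes _ | no _ = here refl
      ... | no _ | no _ = here refl

    private
      there-and-back : ∀ {l L} n → l ≤ L → l + (2 + l + n) ≤ 2 + 2 * L + n
      there-and-back {l} {L} n le = begin
        l + (2 + l + n)    ≡⟨ ring l n ⟩
        2 + 2 * l + n      ≤⟨ +-monoˡ-≤ n (+-monoʳ-≤ 2 (*-monoʳ-≤ 2 le)) ⟩
        2 + 2 * L + n ∎
        where
        open ≤-Reasoning
        ring : ∀ l n → l + (2 + l + n) ≡ 2 + 2 * l + n
        ring = RingSolver.solve-∀

    atom-run : ∀ α {n x σ σ' L} → Bounded L σ → Does α σ σ' → MustHome n x σ' →
      Must (2 + 2 * L + n) (sweep α x false) 0 (slice σ)
    atom-run nop {n} {σ = σ} {L = L} bd refl must =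
      Must-mono (+-monoˡ-≤ n (m≤m+n 2 (2 * L))) (land (here refl) (λ j → sym (unchanged (slice σ) 0 j)) must)
    atom-run (popᴬ ℓ r a) {n} {σ = σ} {L = L} bd (as , eq , refl) must =
      Must-mono (≤-trans (≤-reflexive (ring (length as) n)) (there-and-back n (subst (λ bs → length bs ≤ L) eq (bd ℓ r))))
        (pop-run (length as) 0 eq refl must)
      where
      ring : ∀ l n → l + (4 + l + n) ≡ suc l + (2 + suc l + n)
      ring = RingSolver.solve-∀
    atom-run (pushᴬ ℓ r a) {n} {σ = σ} bd refl must =
      Must-mono (there-and-back n (bd ℓ r)) (push-run (length (get σ ℓ r)) 0 refl must)
    atom-run (isNilᴬ ℓ r) {n} {σ = σ} {L = L} bd (eq , refl) must =
      Must-mono (+-monoˡ-≤ n (m≤m+n 2 (2 * L)))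
        (land (mem (trans (slice-get σ 0 ℓ r) (cong (λ bs → at bs 0) eq))) (λ j → sym (unchanged (slice σ) 0 j)) must)
      where
      mem : ∀ {v} → get v ℓ r ≡ nothing → (nothing , v) ∈ scan (isNilᴬ ℓ r) false v
      mem {v} eq with get v ℓ r | eq
      ... | nothing | refl = here refl
    atom-run (copyᴬ ℓ ℓ') {n} {L = L} bd refl must =
      Must-mono (there-and-back n ≤-refl)
        (copy-run L 0 bd (record { done = λ _ () ; todo = λ _ _ → refl }) refl must)

    -- From accepting computations to runs

    -- The frame condition: a command changes only its own level and deeper ones. It is why a test
    -- finds its original stacks again.
    Agree : Fin D → Store → Store → Set
    Agree ℓ σ σ' = ∀ j → j Fin.< ℓ → lookup σ' j ≡ lookup σ j

    agree-at : ∀ {ℓ} σ s → Agree ℓ σ (σ [ ℓ ]≔ s)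
    agree-at {ℓ} σ s j lt = Vec.lookup∘update′ (Fin.<⇒≢ lt) σ s

    agree-trans : ∀ {ℓ σ σ' σ''} → Agree ℓ σ σ' → Agree ℓ σ' σ'' → Agree ℓ σ σ''
    agree-trans p q j lt = trans (q j lt) (p j lt)

    agree-inner : ∀ {ℓ ℓ' : Fin D} {σ σ' s} → ℓ Fin.< ℓ' → Agree ℓ' (σ [ ℓ' ]≔ s) σ' → ∀ j → j Fin.≤ ℓ → lookup σ' j ≡ lookup σ j
    agree-inner {σ = σ} {s = s} lt ag j le = trans (ag j (≤-trans (s≤s le) lt)) (agree-at σ s j (≤-trans (s≤s le) lt))

    Run : ∀ {ℓ} → Cmd ℓ → (Stacks → Set) → Stacks → Set
    Run = wp (λ _ → ⊤)

    node-inv : ∀ {n m σ is} → next (just m) ≡ is → Home n (just m) σ →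
      ∃ λ ((α , x) : Atom × Target) → (α , x) ∈ is × AtomDone n α x σ
    node-inv refl can with home-inv can
    ... | n' , refl , (α , x) , mem , can' = (α , x) , mem , later (atom-inv α can')

    -- Stated in continuation style: `k` is asked for only where the given computation arrives at
    -- `x`, with no more steps left than at the start. The hypothesis on `next` says that the code
    -- of `c` is placed at the points `ι n`.
    home→run : ∀ {ℓ} (c : Cmd ℓ) ι x → (∀ n → next (just (ι n)) ≡ instr c ι x n) → ∀ {n σ k} →
      (∀ n' σ' → n' ≤ n → Agree ℓ σ σ' → Home n' x σ' → k (lookup σ' ℓ)) →
      Home n (entry c ι x) σ → Run c k (lookup σ ℓ)
    home→run {ℓ} (pop r a) ι x h {σ = σ} {k} K can with node-inv (h tt) can
    ... | _ , here refl , atomDone lt (as , eq , refl) can' =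
      as , eq , subst k (Vec.lookup∘update ℓ σ _) (K _ _ (<⇒≤ lt) (agree-at σ _) can')
    home→run {ℓ} (push r a) ι x h {σ = σ} {k} K can with node-inv (h tt) can
    ... | _ , here refl , atomDone lt refl can' =
      subst k (Vec.lookup∘update ℓ σ _) (K _ _ (<⇒≤ lt) (agree-at σ _) can')
    home→run (isNil r) ι x h K can with node-inv (h tt) can
    ... | _ , here refl , atomDone lt (eq , refl) can' = eq , K _ _ (<⇒≤ lt) (λ _ _ → refl) can'
    home→run (guard true) ι x h K can with node-inv (h tt) can
    ... | _ , here refl , atomDone lt refl can' = refl , K _ _ (<⇒≤ lt) (λ _ _ → refl) can'
    home→run (guard false) ι x h K can with node-inv (h tt) can
    ... | _ , () , _
    home→run {ℓ} (c ⨾ d) ι x h {σ = σ} K can =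
      home→run c (ι ∘ inj₁) (entry d (ι ∘ inj₂) x) (h ∘ inj₁)
        (λ n' σ' le ag can' → home→run d (ι ∘ inj₂) x (h ∘ inj₂)
          (λ n'' σ'' le' ag' → K n'' σ'' (≤-trans le' le) (agree-trans {ℓ} {σ} {σ'} {σ''} ag ag')) can') can
    home→run (pick I f) ι x h K can with node-inv (h nothing) can
    ... | _ , mem , done with ∈-map⁻ (λ i → nop , entry (f i) (λ n → ι (just (i , n))) x) mem
    home→run (pick I f) ι x h K can | _ , mem , atomDone lt refl can' | i , _ , refl =
      i , home→run (f i) (λ n → ι (just (i , n))) x (λ n → h (just (i , n)))
            (λ n' σ' le → K n' σ' (≤-trans le (<⇒≤ lt))) can'
    home→run {ℓ} (loop c) ι x h {n} {σ} {k} K can = go n σ ≤-refl ≤-refl (λ _ _ → refl) can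
      where
      -- `m` bounds the steps that are left; each round spends at least one, so `m` falls although
      -- the number of rounds is unknown.
      go : ∀ m {n'} σ' → n' ≤ m → n' ≤ n → Agree ℓ σ σ' → Home n' (just (ι nothing)) σ' → Run (loop c) k (lookup σ' ℓ)
      go m σ' le le₀ ag can with node-inv (h nothing) can
      go m σ' le le₀ ag can | _ , here refl , atomDone lt refl can' =
        0 , tt , K _ σ' (≤-trans (<⇒≤ lt) le₀) ag can'
      -- How many rounds follow is known only at the end of this round; `wp-∃` moves that number `j`
      -- to the front.
      go (suc m) σ' le le₀ ag can | _ , there (here refl) , atomDone lt refl can'
        with wp-∃ c (home→run c (ι ∘ just) (just (ι nothing)) (h ∘ just)
               (λ n'' σ'' le' ag' → go m σ'' (≤-trans le' (s≤s⁻¹ (≤-trans lt le))) (≤-trans le' (≤-trans (<⇒≤ lt) le₀))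
                  (agree-trans {ℓ} {σ} {σ'} {σ''} ag ag')) can')
      ... | j , w = suc j , tt , wp-mono c (λ _ → proj₂) w
      go zero σ' le le₀ ag can | _ , there (here refl) , atomDone lt refl can' = contradiction (≤-trans lt le) λ ()
    -- The computation through the body gives two things: a run of the body, and an arrival at `x`
    -- from which `k` follows. `wp-∃` separates them.
    home→run {ℓ} (test ℓ' ℓ<ℓ' c) ι x h {σ = σ} {k} K can with node-inv (h nothing) can
    ... | _ , here refl , atomDone lt refl can'
      with wp-∃ c {J = k (lookup σ ℓ)} {F = λ _ _ → ⊤} (home→run c (ι ∘ just) x (h ∘ just)
             (λ n' σ' le ag can'' →
               subst k (agree-inner {ℓ} {ℓ'} {σ} {σ'} {lookup σ ℓ} ℓ<ℓ' ag ℓ ≤-refl)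
                 (K n' σ' (≤-trans le (<⇒≤ lt))
                   (λ j j<ℓ → agree-inner {ℓ} {ℓ'} {σ} {σ'} {lookup σ ℓ} ℓ<ℓ' ag j (<⇒≤ j<ℓ)) can'') , tt) can')
    ... | p , w = subst (Run c _) (Vec.lookup∘update ℓ' σ _) w , p

    -- From runs to accepting computations in bounded time

    -- Acceptance from x within a budget of a atoms; an atom costs a sweep over stacks of height L + a.
    Reach : ℕ → Target → Store → Set
    Reach a x σ = ∀ L → Bounded L σ → MustHome (a * (3 + 2 * (L + a))) x σ

    reach-mono : ∀ {a b x σ} → a ≤ b → Reach a x σ → Reach b x σ
    reach-mono le R L bd = Must-mono (*-mono-≤ le (+-monoʳ-≤ 3 (*-monoʳ-≤ 2 (+-monoʳ-≤ L le)))) (R L bd)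

    get-update : ∀ (σ : Store) ℓ s ℓ₁ r₁ → get (σ [ ℓ ]≔ s) ℓ₁ r₁ ≡ lookup s r₁ ⊎ get (σ [ ℓ ]≔ s) ℓ₁ r₁ ≡ get σ ℓ₁ r₁
    get-update σ ℓ s ℓ₁ r₁ with ℓ₁ Fin.≟ ℓ
    ... | yes refl = inj₁ (cong (λ u → lookup u r₁) (Vec.lookup∘update ℓ σ s))
    ... | no ≠     = inj₂ (cong (λ u → lookup u r₁) (Vec.lookup∘update′ ≠ σ s))

    bounded-update : ∀ {L σ} ℓ s → Bounded L σ → (∀ r → length (lookup s r) ≤ L) → Bounded L (σ [ ℓ ]≔ s)
    bounded-update {σ = σ} ℓ s bd h ℓ₁ r₁ with get-update σ ℓ s ℓ₁ r₁
    ... | inj₁ eq = subst (λ as → length as ≤ _) (sym eq) (h r₁)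
    ... | inj₂ eq = subst (λ as → length as ≤ _) (sym eq) (bd ℓ₁ r₁)

    bounded-put : ∀ {L σ} ℓ r as → Bounded L σ → length as ≤ L → Bounded L (put σ ℓ r as)
    bounded-put {σ = σ} ℓ r as bd le = bounded-update {σ = σ} ℓ _ bd h
      where
      h : ∀ r₁ → length (lookup (lookup σ ℓ [ r ]≔ as) r₁) ≤ _
      h r₁ with r₁ Fin.≟ r
      ... | yes refl = subst (λ as → length as ≤ _) (sym (Vec.lookup∘update r (lookup σ ℓ) as)) le
      ... | no ≠     = subst (λ as → length as ≤ _) (sym (Vec.lookup∘update′ ≠ (lookup σ ℓ) as)) (bd ℓ r₁)

    bounded-after : ∀ α {L σ σ'} → Bounded L σ → Does α σ σ' → Bounded (suc L) σ'
    bounded-after nop bd refl ℓ r = ≤-trans (bd ℓ r) (n≤1+n _)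
    bounded-after (popᴬ ℓ r a) {L} {σ} bd (as , eq , refl) = bounded-put {σ = σ} ℓ r as
      (λ ℓ r → ≤-trans (bd ℓ r) (n≤1+n _))
      (≤-trans (n≤1+n _) (≤-trans (subst (λ bs → length bs ≤ L) eq (bd ℓ r)) (n≤1+n L)))
    bounded-after (pushᴬ ℓ r a) {L} {σ} bd refl = bounded-put {σ = σ} ℓ r _
      (λ ℓ r → ≤-trans (bd ℓ r) (n≤1+n _)) (s≤s (bd ℓ r))
    bounded-after (isNilᴬ ℓ r) bd (eq , refl) ℓ₁ r₁ = ≤-trans (bd ℓ₁ r₁) (n≤1+n _)
    bounded-after (copyᴬ ℓ ℓ') {L} {σ} bd refl = bounded-update {σ = σ} ℓ' _
      (λ ℓ r → ≤-trans (bd ℓ r) (n≤1+n _)) (λ r → ≤-trans (bd ℓ r) (n≤1+n L))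

    -- An atom takes one unit of the budget and raises the stacks by at most one, so `L + a` is
    -- preserved and bounds all later heights. The `3 + 2 * L` steps of an atom are its choice at
    -- `home` and its sweep there and back.
    reach-step : ∀ {a m is α x σ σ'} → next (just m) ≡ is → (α , x) ∈ is → Does α σ σ' → Reach a x σ' →
      Reach (suc a) (just m) σ
    reach-step {a} {m} {α = α} {σ = σ} refl mem does R L bd =
      Must-mono budget (home-run {m = m} mem (atom-run α {σ = σ} bd does (R (suc L) (bounded-after α {σ = σ} bd does))))
      where
      open ≤-Reasoning
      budget : suc (2 + 2 * L + a * (3 + 2 * (suc L + a))) ≤ suc a * (3 + 2 * (L + suc a))
      budget = begin
        3 + 2 * L + a * (3 + 2 * (suc L + a))
          ≤⟨ +-monoˡ-≤ _ (+-monoʳ-≤ 3 (*-monoʳ-≤ 2 (≤-trans (m≤m+n L a) (n≤1+n (L + a))))) ⟩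
        3 + 2 * (suc L + a) + a * (3 + 2 * (suc L + a))
          ≡⟨ cong (λ l → 3 + 2 * l + a * (3 + 2 * l)) (sym (+-suc L a)) ⟩
        suc a * (3 + 2 * (L + suc a)) ∎

    run→reach : ∀ N {ℓ} (c : Cmd ℓ) ι x → (∀ n → next (just (ι n)) ≡ instr c ι x n) → ∀ {a σ k} →
      (∀ σ' → Agree ℓ σ σ' → k (lookup σ' ℓ) → Reach a x σ') →
      wp (_≤ N) c k (lookup σ ℓ) → Reach (cost N c + a) (entry c ι x) σ
    run→reach N {ℓ} (pop r a) ι x h {σ = σ} {k} K (as , eq , p) = reach-step (h tt) (here refl) (as , eq , refl)
      (K _ (agree-at σ _) (subst k (sym (Vec.lookup∘update ℓ σ _)) p))
    run→reach N {ℓ} (push r a) ι x h {σ = σ} {k} K p = reach-step (h tt) (here refl) refl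
      (K _ (agree-at σ _) (subst k (sym (Vec.lookup∘update ℓ σ _)) p))
    run→reach N (isNil r) ι x h {σ = σ} K (eq , p) = reach-step (h tt) (here refl) (eq , refl) (K σ (λ _ _ → refl) p)
    run→reach N (guard true) ι x h {σ = σ} K (refl , p) = reach-step (h tt) (here refl) refl (K σ (λ _ _ → refl) p)
    run→reach N {ℓ} (c ⨾ d) ι x h {a} {σ} K p =
      subst (λ b → Reach b (entry (c ⨾ d) ι x) σ) (sym (+-assoc (cost N c) (cost N d) a))
        (run→reach N c (ι ∘ inj₁) (entry d (ι ∘ inj₂) x) (h ∘ inj₁)
          (λ σ' ag → run→reach N d (ι ∘ inj₂) x (h ∘ inj₂)
            (λ σ'' ag' → K σ'' (agree-trans {ℓ} {σ} {σ'} {σ''} ag ag'))) p)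
    run→reach N (pick I f) ι x h {a} {σ} K (i , p) =
      reach-step (h nothing) (∈-map⁺ (λ i → nop , entry (f i) (λ n → ι (just (i , n))) x) (I .complete i)) refl
        (reach-mono (+-monoˡ-≤ a (summand (I .complete i)))
          (run→reach N (f i) (λ n → ι (just (i , n))) x (λ n → h (just (i , n))) K p))
      where
      summand : ∀ {is} → i ∈ is → cost N (f i) ≤ sum (List.map (λ i → cost N (f i)) is)
      summand (here refl) = m≤m+n _ _
      summand (there mem) = ≤-trans (summand mem) (m≤n+m _ _)
    run→reach N {ℓ} (loop c) ι x h {a} {σ} {k} K (n , le , p) =
      reach-mono (s≤s (+-monoˡ-≤ a (*-monoˡ-≤ (suc (cost N c)) le))) (go n σ (λ _ _ → refl) p)
      where
      go : ∀ n σ' → Agree ℓ σ σ' → iterate (wp (_≤ N) c) n k (lookup σ' ℓ) →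
        Reach (suc (n * suc (cost N c) + a)) (just (ι nothing)) σ'
      go zero σ' ag p = reach-step (h nothing) (here refl) refl (K σ' ag p)
      go (suc n) σ' ag p = reach-step (h nothing) (there (here refl)) refl
        (reach-mono (≤-reflexive (trans (+-suc (cost N c) _) (cong suc (sym (+-assoc (cost N c) _ a)))))
          (run→reach N c (ι ∘ just) (just (ι nothing)) (h ∘ just)
            (λ σ'' ag' → go n σ'' (agree-trans {ℓ} {σ} {σ'} {σ''} ag ag')) p))
    run→reach N {ℓ} (test ℓ' ℓ<ℓ' c) ι x h {a} {σ} {k} K (t , p) =
      reach-step (h nothing) (here refl) refl
        (run→reach N c (ι ∘ just) x (h ∘ just) {k = λ _ → ⊤}
          (λ σ' ag _ → K σ' (λ j j<ℓ → agree-inner {ℓ} {ℓ'} {σ} {σ'} {lookup σ ℓ} ℓ<ℓ' ag j (<⇒≤ j<ℓ))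
            (subst k (sym (agree-inner {ℓ} {ℓ'} {σ} {σ'} {lookup σ ℓ} ℓ<ℓ' ag ℓ ≤-refl)) p))
          (subst (wp (_≤ N) c _) (sym (Vec.lookup∘update ℓ' σ _)) t))

    -- The initial configuration

    empty : Store
    empty = replicate D (replicate K [])

    input : List Bool → List A
    input x = List.reverse (List.map bit x)

    initStore : List Bool → Store
    initStore x = put empty ℓ₀ r₀ (input x)

    slice-empty : ∀ i → slice empty i ≡ noTracks
    slice-empty i = trans (Vec.map-replicate _ _ D) (cong (replicate D) (Vec.map-replicate _ _ K))

    noTracks-get : ∀ ℓ r → get noTracks ℓ r ≡ nothing
    noTracks-get ℓ r = trans (cong (λ u → lookup u r) (Vec.lookup-replicate ℓ blanks)) (Vec.lookup-replicate r nothing)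

    init-slice : ∀ x i → slice (initStore x) i ≡ put noTracks ℓ₀ r₀ (at (input x) i)
    init-slice x i = trans (slice-put empty i ℓ₀ r₀ (input x))
      (cong (λ v → put v ℓ₀ r₀ (at (input x) i)) (slice-empty i))

    init-cell : ∀ x i → decCell (initTape machine x (ℤ.+ i)) ≡ (false , slice (initStore x) i)
    init-cell x i = trans (go x i) (cong (false ,_) (sym (init-slice x i)))
      where
      go : ∀ x i → decCell (inputAt machine x i) ≡ (false , put noTracks ℓ₀ r₀ (at (input x) i))
      go [] i = cong (false ,_) (sym (trans (cong (put noTracks ℓ₀ r₀) (sym (noTracks-get ℓ₀ r₀))) (put-get noTracks ℓ₀ r₀)))
      go (b ∷ x) zero rewrite unfold-reverse (bit b) (List.map bit x) | at-∷ʳ-zero (input x) (bit b) with b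
      ... | true  = refl
      ... | false = refl
      go (b ∷ x) (suc i) rewrite unfold-reverse (bit b) (List.map bit x) | at-∷ʳ-suc (input x) (bit b) i = go x i

    booted : ∀ x → Rep (write machine (initTape machine x) (ℤ.+ 0) (encCell (true , slice (initStore x) 0))) (slice (initStore x))
    booted x .cell zero    = decode-code finite-Cell _
    booted x .cell (suc i) = init-cell x (suc i)

    accepted→run : ∀ {n x} → AcceptsWithin machine n x → Run main (λ _ → ⊤) (lookup (initStore x) ℓ₀)
    accepted→run {n} {x} (c , w , eq) with Accepts-inv {q = boot} (λ ()) (accepts c w eq)
    ... | n' , refl , action , mem , acc rewrite init-cell x 0 with mem
    ... | here refl = home→run main id nothing (λ _ → refl) (λ _ _ _ _ _ → tt) (_ , booted x , acc)

    -- The budget is the cost of the program, the initial height is the length of the input, and the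
    -- additional step is that of `boot`.
    run→accepted : ∀ N {x} → wp (_≤ N) main (λ _ → ⊤) (lookup (initStore x) ℓ₀) →
      let a = cost N main + 0 in AcceptsWithin machine (suc (a * (3 + 2 * (length x + a)))) x
    run→accepted N {x} w = final , run , accepting
      where
      bounded : Bounded (length x) (initStore x)
      bounded = bounded-put {σ = empty} ℓ₀ r₀ (input x)
        (λ ℓ r → subst (λ as → length as ≤ length x)
          (sym (trans (cong (λ u → lookup u r) (Vec.lookup-replicate ℓ _)) (Vec.lookup-replicate r []))) z≤n)
        (≤-reflexive (trans (length-reverse (List.map bit x)) (length-map bit x)))
      reach : Reach (cost N main + 0) (entry main id nothing) (initStore x)
      reach = run→reach N main id nothing (λ _ → refl)
        (λ σ' _ _ L bd t rep → accepts _ here refl) w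
      open Accepts (Accepts-step {q = boot}
        (subst (λ c → (home (entry main id nothing) , (true , slice (initStore x) 0) , mS) ∈ act boot c)
          (sym (init-cell x 0)) (here refl))
        (reach (length x) bounded _ (booted x)))

-- Decidability of bounded acceptance

module _ (M : NTM) where
  open NTM M

  -- The successors of a configuration form a finite list, so a search to depth `n` decides.
  accepts? : ∀ n c → Dec (∃ λ c' → Within M n c c' × Config.state c' ≡ accept)
  accepts? n c with Config.state c Fin.≟ accept
  ... | yes eq = yes (c , here , eq)
  accepts? zero    c | no ≠ = no λ { (_ , here , eq) → ≠ eq }
  accepts? (suc n) (cfg q h t) | no ≠
    with any? (λ (q' , a , m) → accepts? n (cfg q' (moveHead M m h) (write M t h a))) (δ q (t h))
  ... | yes p with find p
  ...   | _ , mem , c , w , eq = yes (c , there (step mem) w , eq)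
  accepts? (suc n) (cfg q h t) | no ≠ | no ¬p = no λ
    { (_ , here , eq) → ≠ eq
    ; (c , there (step mem) w , eq) → ¬p (lose mem (c , w , eq)) }

  acceptsWithin? : ∀ n x → Dec (AcceptsWithin M n x)
  acceptsWithin? n x = accepts? n (initial M x)

-- Satisfiability in terms of types

infixl 1 _>>=_
_>>=_ : ∀ {a b} {X : Set a} {Y : Set b} → ¬ ¬ X → (X → ¬ ¬ Y) → ¬ ¬ Y
(x >>= f) k = x λ v → f v k

return : ∀ {a} {X : Set a} → X → ¬ ¬ X
return x k = k x

-- Double negation passes through a quantifier over a list, one element at a time; for arbitrary
-- types this is not constructive.
¬¬-∀∈ : ∀ {X : Set} {P : X → Set} xs → (∀ x → x ∈ xs → ¬ ¬ P x) → ¬ ¬ (∀ x → x ∈ xs → P x)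
¬¬-∀∈ []       h = return λ _ ()
¬¬-∀∈ (x ∷ xs) h = h x (here refl) >>= λ p → ¬¬-∀∈ xs (λ y → h y ∘ there) >>= λ ps →
  return λ { _ (here refl) → p ; y (there mem) → ps y mem }

-- `P` is not assumed decidable, so the sublist exists only up to double negation, by one case
-- distinction per element.
¬¬-filter : ∀ {X : Set} (P : X → Set) xs → ¬ ¬ ∃ λ ys → length ys ≤ length xs
  × (∀ x → x ∈ ys → P x) × (∀ x → x ∈ xs → P x → x ∈ ys)
¬¬-filter P []       = return ([] , z≤n , (λ _ ()) , λ _ ())
¬¬-filter P (x ∷ xs) = ¬¬-filter P xs >>= λ (ys , le , snd , cmp) → ¬¬-excluded-middle {A = P x} >>= λ
  { (yes p) → return (x ∷ ys , s≤s le , (λ { _ (here refl) → p ; y (there mem) → snd y mem })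
                     , λ { _ (here refl) _ → here refl ; y (there mem) q → there (cmp y mem q) })
  ; (no ¬p) → return (ys , ≤-trans le (n≤1+n _) , snd
                     , λ { _ (here refl) q → contradiction q ¬p ; y (there mem) q → cmp y mem q }) }

-- The type of a world: for every subformula occurrence whether the world is in its team, for every
-- variable occurrence the truth value of the variable.
data Ann : Fml → Set where
  var  : ∀ {p} → Bool → Bool → Ann (var p)
  nvar : ∀ {p} → Bool → Bool → Ann (nvar p)
  and  : ∀ {φ ψ} → Bool → Ann φ → Ann ψ → Ann (φ ∧ᵐ ψ)
  or   : ∀ {φ ψ} → Bool → Ann φ → Ann ψ → Ann (φ ∨ᵐ ψ)
  incl : ∀ {k ps qs} → Bool → Vec Bool (suc k) → Vec Bool (suc k) → Ann (incl k ps qs)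
  box  : ∀ {φ} → Bool → Ann φ → Ann (□ᵐ φ)
  dia  : ∀ {φ} → Bool → Ann φ → Ann (◇ᵐ φ)

root : ∀ {φ} → Ann φ → Bool
root (var b _)    = b
root (nvar b _)   = b
root (and b _ _)  = b
root (or b _ _)   = b
root (incl b _ _) = b
root (box b _)    = b
root (dia b _)    = b

and₁ : ∀ {φ ψ} → Ann (φ ∧ᵐ ψ) → Ann φ
and₁ (and _ α β) = α

and₂ : ∀ {φ ψ} → Ann (φ ∧ᵐ ψ) → Ann ψ
and₂ (and _ α β) = β

or₁ : ∀ {φ ψ} → Ann (φ ∨ᵐ ψ) → Ann φ
or₁ (or _ α β) = α

or₂ : ∀ {φ ψ} → Ann (φ ∨ᵐ ψ) → Ann ψ
or₂ (or _ α β) = β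

unbox : ∀ {φ} → Ann (□ᵐ φ) → Ann φ
unbox (box _ α) = α

undia : ∀ {φ} → Ann (◇ᵐ φ) → Ann φ
undia (dia _ α) = α

lhs rhs : ∀ {k ps qs} → Ann (incl k ps qs) → Vec Bool (suc k)
lhs (incl _ us _) = us
rhs (incl _ _ vs) = vs

split : Bool → Bool → Bool → Bool
split true  true  b     = not b
split true  false b     = b
split false b     c     = not b ∧ not c

Local : ∀ {φ} → Ann φ → Set
Local (var b v)    = b ≡ true → v ≡ true
Local (nvar b v)   = b ≡ true → v ≡ false
Local (and b α β)  = root α ≡ b × root β ≡ b × Local α × Local β
Local (or b α β)   = split b (root α) (root β) ≡ true × Local α × Local β
Local (incl _ _ _) = ⊤
Local (box _ α)    = Local α
Local (dia _ α)    = Local α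

zipVals : ∀ {n} → Vec ℕ n → Vec Bool n → List (ℕ × Bool)
zipVals []       []       = []
zipVals (p ∷ ps) (v ∷ vs) = (p , v) ∷ zipVals ps vs

values : ∀ {φ} → Ann φ → List (ℕ × Bool)
values (var {p} _ v)  = (p , v) ∷ []
values (nvar {p} _ v) = (p , v) ∷ []
values (and _ α β)    = values α ++ values β
values (or _ α β)     = values α ++ values β
values (incl {ps = ps} {qs} _ us vs) = zipVals ps us ++ zipVals qs vs
values (box _ α)      = values α
values (dia _ α)      = values α

-- A variable may occur several times, and every occurrence has a bit of its own.
Consistent : ∀ {φ} → Ann φ → Set
Consistent α = ∀ {p} → (p , true) ∈ values α → ¬ (p , false) ∈ values α

-- A world of type α may see a world of type β as far as the boxes are concerned.
Compat : ∀ {φ} → Ann φ → Ann φ → Set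
Compat (var _ _)    (var _ _)      = ⊤
Compat (nvar _ _)   (nvar _ _)     = ⊤
Compat (and _ α β)  (and _ α' β')  = Compat α α' × Compat β β'
Compat (or _ α β)   (or _ α' β')   = Compat α α' × Compat β β'
Compat (incl _ _ _) (incl _ _ _)   = ⊤
Compat (box b α)    (box _ α')     = (b ≡ true → root α' ≡ true) × Compat α α'
Compat (dia _ α)    (dia _ α')     = Compat α α'

compat? : ∀ {φ} (α β : Ann φ) → Dec (Compat α β)
compat? (var _ _)    (var _ _)     = yes tt
compat? (nvar _ _)   (nvar _ _)    = yes tt
compat? (and _ α β)  (and _ α' β') = compat? α α' ×-dec compat? β β'
compat? (or _ α β)   (or _ α' β')  = compat? α α' ×-dec compat? β β'
compat? (incl _ _ _) (incl _ _ _)  = yes tt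
compat? (box b α)    (box _ α')    = ((b Bool.≟ true) →-dec (root α' Bool.≟ true)) ×-dec compat? α α'
compat? (dia _ α)    (dia _ α')    = compat? α α'

module _ {φ} (Θ : List (Ann φ)) where

  -- `f` and `g` stand for membership in the team of a modal operator and in that of its argument.
  -- `Forth` is a demand of diamonds, which choose a successor; for boxes `Compat` keeps every
  -- successor in the team of the argument.
  Forth : (Ann φ → Bool) → (Ann φ → Bool) → Set
  Forth f g = ∀ α → α ∈ Θ → f α ≡ true → ∃ λ β → β ∈ Θ × Compat α β × g β ≡ true

  Back : (Ann φ → Bool) → (Ann φ → Bool) → Set
  Back f g = ∀ β → β ∈ Θ → g β ≡ true → ∃ λ α → α ∈ Θ × Compat α β × f α ≡ true

  Included : ∀ {k ps qs} → (Ann φ → Ann (incl k ps qs)) → Set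
  Included π = ∀ α → α ∈ Θ → root (π α) ≡ true →
    ∃ λ β → β ∈ Θ × root (π β) ≡ true × lhs (π α) ≡ rhs (π β)

  -- The witnesses demanded by the subformula occurrence that π projects to.
  Witnessed : ∀ ψ → (Ann φ → Ann ψ) → Set
  Witnessed (var _)      π = ⊤
  Witnessed (nvar _)     π = ⊤
  Witnessed (φ ∧ᵐ ψ)     π = Witnessed φ (and₁ ∘ π) × Witnessed ψ (and₂ ∘ π)
  Witnessed (φ ∨ᵐ ψ)     π = Witnessed φ (or₁ ∘ π) × Witnessed ψ (or₂ ∘ π)
  Witnessed (incl _ _ _) π = Included π
  Witnessed (□ᵐ ψ)       π = Back (root ∘ π) (root ∘ unbox ∘ π) × Witnessed ψ (unbox ∘ π)
  Witnessed (◇ᵐ ψ)       π = Forth (root ∘ π) (root ∘ undia ∘ π) × Back (root ∘ π) (root ∘ undia ∘ π)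
                             × Witnessed ψ (undia ∘ π)

  record Good : Set where
    field
      local      : ∀ {α} → α ∈ Θ → Local α
      consistent : ∀ {α} → α ∈ Θ → Consistent α
      witnessed  : Witnessed φ id
      rooted     : ∃ λ α → α ∈ Θ × root α ≡ true

-- Teams are predicates, so equality of their extensions is transported by induction; the parts of a
-- disjunction and the function of a diamond are kept.
⊨-resp : ∀ {W} (M : Kripke W) φ {T T' : Team W} → (∀ w → T w → T' w) → (∀ w → T' w → T w) → M , T ⊨ φ → M , T' ⊨ φ
⊨-resp M (var p)  f g (lift s) = lift λ w t → s w (g w t)
⊨-resp M (nvar p) f g (lift s) = lift λ w t → s w (g w t)
⊨-resp M (φ ∧ᵐ ψ) f g (s , s') = ⊨-resp M φ f g s , ⊨-resp M ψ f g s'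
⊨-resp M (φ ∨ᵐ ψ) f g (S , S' , (⊆ , ⊆' , cover , disjoint) , s , s') =
  S , S' , ((λ w → f w ∘ ⊆ w) , (λ w → f w ∘ ⊆' w) , (λ w → cover w ∘ g w) , disjoint) , s , s'
⊨-resp M (incl k ps qs) f g (lift s) = lift λ u t → let (v , t' , h) = s u (g u t) in v , f v t' , h
⊨-resp M (□ᵐ φ) f g s =
  ⊨-resp M φ (λ { w (u , t , r) → u , f u t , r }) (λ { w (u , t , r) → u , g u t , r }) s
⊨-resp M (◇ᵐ φ) f g (h , r , s) = h , (λ u → r u ∘ g u) ,
  ⊨-resp M φ (λ { w (u , t , e) → u , f u t , e }) (λ { w (u , t , e) → u , g u t , e }) s

-- The finite model of a good list of types

depth : Fml → ℕ
depth (var p)       = 0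
depth (nvar p)      = 0
depth (φ ∧ᵐ ψ)      = depth φ ⊔ depth ψ
depth (φ ∨ᵐ ψ)      = depth φ ⊔ depth ψ
depth (incl k ps qs) = 0
depth (□ᵐ φ)        = suc (depth φ)
depth (◇ᵐ φ)        = suc (depth φ)

-- A world of the model at remaining modal depth e is a sequence of e + 1 types: its own type, and
-- then a world of the next level, which all diamonds try first.  Every world of the next level is
-- therefore the diamond successor of some world of a prescribed type.
module Model {φ} {Θ : List (Ann φ)} (good : Good Θ) where
  open Good good

  d : ℕ
  d = depth φ

  World : ℕ → Set
  World e = Vec (Fin (length Θ)) (suc e)

  type : ∀ {e} → World e → Ann φ
  type w = List.lookup Θ (Vec.head w)

  type∈ : ∀ {e} (w : World e) → type w ∈ Θ
  type∈ w = ∈-lookup (Vec.head w)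

  abstract
    finite-World : Finite (Σ (Fin (suc d)) (λ e → World (toℕ e)))
    finite-World = finite-Σ (finite-Fin (suc d)) (λ e → finite-Vec (finite-Fin (length Θ)) (suc (toℕ e)))

  Point : Set
  Point = Fin (card finite-World)

  point : ∀ {e} → e ≤ d → World e → Point
  point le w = code finite-World (Fin.fromℕ< (s≤s le) , subst World (sym (Fin.toℕ-fromℕ< (s≤s le))) w)

  world : Point → Σ ℕ World
  world i = let (e , w) = decode finite-World i in toℕ e , w

  world-point : ∀ {e} (le : e ≤ d) (w : World e) → world (point le w) ≡ (e , w)
  world-point le w = trans (cong (λ (e , w) → toℕ e , w) (decode-code finite-World _)) (go (Fin.toℕ-fromℕ< (s≤s le)) w)
    where
    go : ∀ {m e} (eq : m ≡ e) (w : World e) → (m , subst World (sym eq) w) ≡ (e , w)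
    go refl w = refl

  -- This is what carries the disjointness of the two parts of a disjunction over from types to
  -- points.
  point-injective : ∀ {e le le'} {w w' : World e} → point le w ≡ point le' w' → w ≡ w'
  point-injective {le = le} {le'} {w} {w'} eq with trans (sym (world-point le w)) (trans (cong world eq) (world-point le' w'))
  ... | refl = refl

  M : Kripke Point
  -- The target has to be the chosen code of its world, not just an index that decodes to it, so
  -- that images of teams consist of chosen codes again.
  M .Kripke.R i j = ∃ λ e → ∃ λ (le : e ≤ d) → ∃ λ w' → ∃ λ w →
    point le w' ≡ j × world i ≡ (suc e , w) × Compat (type w) (type w')
  M .Kripke.V p i = (p , true) ∈ values (type (proj₂ (world i)))

  team : ∀ {e} → e ≤ d → (Ann φ → Bool) → Team Point
  team le f i = ∃ λ w → point le w ≡ i × f (type w) ≡ true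

  -- A diamond function is total on the points; off level `suc e`, where its team has no members,
  -- the identity fills in.
  lift-map : ∀ {e} (le : e ≤ d) (h : World (suc e) → World e) →
    ∃ λ (f : Point → Point) → ∀ le' w → f (point le' w) ≡ point le (h w)
  lift-map {e} le h = (λ i → f i (world i)) , λ le' w → trans (cong (f (point le' w)) (world-point le' w)) (f-suc _ w)
    where
    f : Point → Σ ℕ World → Point
    f i (e' , w) with e' ≟ suc e
    ... | yes refl = point le (h w)
    ... | no  _    = i
    f-suc : ∀ i w → f i (suc e , w) ≡ point le (h w)
    f-suc i w with suc e ≟ suc e
    ... | yes refl = refl
    ... | no ≠     = contradiction refl ≠

  world-of : ∀ {e α} → α ∈ Θ → Vec (Fin (length Θ)) e → World e
  world-of mem v = index mem ∷ v

  type-world-of : ∀ {e α} (mem : α ∈ Θ) (v : Vec (Fin (length Θ)) e) → type (world-of mem v) ≡ α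
  type-world-of mem v = sym (lookup-index mem)

  module Successor (f g : Ann φ → Bool) (forth : Forth Θ f g) {e : ℕ} where

    -- The type of the successor comes from `Forth`, the rest of its sequence from the suggestion
    -- that has been rejected.
    default : World (suc e) → World e
    default (a ∷ w) with f (List.lookup Θ a) Bool.≟ true
    ... | yes t = world-of (proj₁ (proj₂ (forth _ (∈-lookup a) t))) (Vec.tail w)
    ... | no  _ = w

    next : World (suc e) → World e
    next (a ∷ w) with compat? (List.lookup Θ a) (type w) ×-dec (g (type w) Bool.≟ true)
    ... | yes _ = w
    ... | no  _ = default (a ∷ w)

    next-ok : ∀ w → f (type w) ≡ true → Compat (type w) (type (next w)) × g (type (next w)) ≡ true
    next-ok (a ∷ w) t with compat? (List.lookup Θ a) (type w) ×-dec (g (type w) Bool.≟ true)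
    ... | yes ok = ok
    ... | no  _ with f (List.lookup Θ a) Bool.≟ true
    ...   | no ≠ = contradiction t ≠
    ...   | yes t' with forth _ (∈-lookup a) t'
    ...     | β , mem , c , s = subst (λ γ → Compat (List.lookup Θ a) γ × g γ ≡ true)
                                  (sym (type-world-of mem (Vec.tail w))) (c , s)

    -- The source of surjectivity: `Back` provides a type `a` for every `w` in the team of the
    -- argument, and then `a ∷ w` is mapped to `w`.
    next-hit : ∀ a (w : World e) → Compat (List.lookup Θ a) (type w) → g (type w) ≡ true → next (a ∷ w) ≡ w
    next-hit a w c s with compat? (List.lookup Θ a) (type w) ×-dec (g (type w) Bool.≟ true)
    ... | yes _ = refl
    ... | no ¬p = contradiction (c , s) ¬p

  -- The valuation looks for any true occurrence of the variable in the type; `consistent` makes it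
  -- agree with the given one.
  value : ∀ {e} (le : e ≤ d) (w : World e) {p b} → (p , b) ∈ values (type w) →
    (b ≡ true → Kripke.V M p (point le w)) × (Kripke.V M p (point le w) → b ≡ true)
  value {e} le w {p} {b} mem =
    (λ { refl → subst True (sym (world-point le w)) mem }) ,
    (λ t → back b mem (subst True (world-point le w) t))
    where
    True : Σ ℕ World → Set
    True (_ , w) = (p , true) ∈ values (type w)
    back : ∀ b → (p , b) ∈ values (type w) → (p , true) ∈ values (type w) → b ≡ true
    back true  _ _ = refl
    back false f t = contradiction f (consistent (type∈ w) t)

  team-resp : ∀ ψ {e} {le : e ≤ d} {f g : Ann φ → Bool} → (∀ {α} → α ∈ Θ → f α ≡ g α) →
    M , team le f ⊨ ψ → M , team le g ⊨ ψ
  team-resp ψ h = ⊨-resp M ψ (λ { _ (w , eq , t) → w , eq , trans (sym (h (type∈ w))) t })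
                             (λ { _ (w , eq , t) → w , eq , trans (h (type∈ w)) t })

  var-holds : ∀ {e} (le : e ≤ d) w {p} (α : Ann (var p)) → (∀ {x} → x ∈ values α → x ∈ values (type w)) →
    Local α → root α ≡ true → Kripke.V M p (point le w)
  var-holds le w (var b v) val loc t = proj₁ (value le w (val (here refl))) (loc t)

  nvar-fails : ∀ {e} (le : e ≤ d) w {p} (α : Ann (nvar p)) → (∀ {x} → x ∈ values α → x ∈ values (type w)) →
    Local α → root α ≡ true → ¬ Kripke.V M p (point le w)
  nvar-fails le w (nvar b v) val loc t holds with trans (sym (loc t)) (proj₂ (value le w (val (here refl))) holds)
  ... | ()

  and-local : ∀ {φ ψ} (α : Ann (φ ∧ᵐ ψ)) → Local α →
    root (and₁ α) ≡ root α × root (and₂ α) ≡ root α × Local (and₁ α) × Local (and₂ α)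
  and-local (and _ _ _) l = l

  or-local : ∀ {φ ψ} (α : Ann (φ ∨ᵐ ψ)) → Local α →
    split (root α) (root (or₁ α)) (root (or₂ α)) ≡ true × Local (or₁ α) × Local (or₂ α)
  or-local (or _ _ _) l = l

  split⊆₁ : ∀ b c c' → split b c c' ≡ true → c ≡ true → b ≡ true
  split⊆₁ true  c    c' _ _ = refl
  split⊆₁ false true c' () _

  split⊆₂ : ∀ b c c' → split b c c' ≡ true → c' ≡ true → b ≡ true
  split⊆₂ true  c     c'   _ _ = refl
  split⊆₂ false true  true () _
  split⊆₂ false false true () _

  split-cover : ∀ b c c' → split b c c' ≡ true → b ≡ true → c ≡ true ⊎ c' ≡ true
  split-cover true true  c' s t = inj₁ refl
  split-cover true false c' s t = inj₂ s

  split-disjoint : ∀ b c c' → split b c c' ≡ true → c ≡ true → ¬ c' ≡ true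
  split-disjoint true  true true () _ _
  split-disjoint false true true () _ _

  and-values₁ : ∀ {φ ψ} (α : Ann (φ ∧ᵐ ψ)) {x} → x ∈ values (and₁ α) → x ∈ values α
  and-values₁ (and _ _ _) = ∈-++⁺ˡ

  and-values₂ : ∀ {φ ψ} (α : Ann (φ ∧ᵐ ψ)) {x} → x ∈ values (and₂ α) → x ∈ values α
  and-values₂ (and _ α _) = ∈-++⁺ʳ (values α)

  or-values₁ : ∀ {φ ψ} (α : Ann (φ ∨ᵐ ψ)) {x} → x ∈ values (or₁ α) → x ∈ values α
  or-values₁ (or _ _ _) = ∈-++⁺ˡ

  or-values₂ : ∀ {φ ψ} (α : Ann (φ ∨ᵐ ψ)) {x} → x ∈ values (or₂ α) → x ∈ values α
  or-values₂ (or _ α _) = ∈-++⁺ʳ (values α)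

  and-compat : ∀ {φ ψ} (α β : Ann (φ ∧ᵐ ψ)) → Compat α β → Compat (and₁ α) (and₁ β) × Compat (and₂ α) (and₂ β)
  and-compat (and _ _ _) (and _ _ _) c = c

  or-compat : ∀ {φ ψ} (α β : Ann (φ ∨ᵐ ψ)) → Compat α β → Compat (or₁ α) (or₁ β) × Compat (or₂ α) (or₂ β)
  or-compat (or _ _ _) (or _ _ _) c = c

  box-local : ∀ {ψ} (α : Ann (□ᵐ ψ)) → Local α → Local (unbox α)
  box-local (box _ _) l = l

  dia-local : ∀ {ψ} (α : Ann (◇ᵐ ψ)) → Local α → Local (undia α)
  dia-local (dia _ _) l = l

  box-values : ∀ {ψ} (α : Ann (□ᵐ ψ)) {x} → x ∈ values (unbox α) → x ∈ values α
  box-values (box _ _) mem = mem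

  dia-values : ∀ {ψ} (α : Ann (◇ᵐ ψ)) {x} → x ∈ values (undia α) → x ∈ values α
  dia-values (dia _ _) mem = mem

  box-compat : ∀ {ψ} (α β : Ann (□ᵐ ψ)) → Compat α β →
    (root α ≡ true → root (unbox β) ≡ true) × Compat (unbox α) (unbox β)
  box-compat (box _ _) (box _ _) c = c

  dia-compat : ∀ {ψ} (α β : Ann (◇ᵐ ψ)) → Compat α β → Compat (undia α) (undia β)
  dia-compat (dia _ _) (dia _ _) c = c

  zip-lookup : ∀ {n} (ps : Vec ℕ n) (vs : Vec Bool n) i → (lookup ps i , lookup vs i) ∈ zipVals ps vs
  zip-lookup (p ∷ ps) (v ∷ vs) zero    = here refl
  zip-lookup (p ∷ ps) (v ∷ vs) (suc i) = there (zip-lookup ps vs i)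

  lhs-values : ∀ {k ps qs} (α : Ann (incl k ps qs)) i → (lookup ps i , lookup (lhs α) i) ∈ values α
  lhs-values (incl {ps = ps} _ us vs) i = ∈-++⁺ˡ (zip-lookup ps us i)

  rhs-values : ∀ {k ps qs} (α : Ann (incl k ps qs)) i → (lookup qs i , lookup (rhs α) i) ∈ values α
  rhs-values (incl {ps = ps} {qs} _ us vs) i = ∈-++⁺ʳ (zipVals ps us) (zip-lookup qs vs i)

  sees : ∀ {e} (le : suc e ≤ d) (le' : e ≤ d) (w : World (suc e)) (w' : World e) →
    Compat (type w) (type w') → Kripke.R M (point le w) (point le' w')
  sees le le' w w' c = _ , le' , w' , w , refl , world-point le w , c

  back-point : ∀ {e} (le : suc e ≤ d) (le' : e ≤ d) {f g} → Back Θ f g → (w : World e) → g (type w) ≡ true →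
    ∃ λ a → f (List.lookup Θ a) ≡ true × Compat (List.lookup Θ a) (type w)
  back-point le le' {f} back w t with back _ (type∈ w) t
  ... | α , mem , c , s = index mem , subst (λ γ → f γ ≡ true × Compat γ (type w)) (lookup-index mem) (s , c)

  -- `π` selects the occurrence of `ψ`, and the hypotheses list what it inherits from the whole
  -- formula. The level `e` may be anything from the depth of `ψ` on, because the same types
  -- populate every level.
  models : ∀ ψ (π : Ann φ → Ann ψ) → (∀ {α} → α ∈ Θ → Local (π α)) →
    (∀ α {x} → x ∈ values (π α) → x ∈ values α) → (∀ {α β} → Compat α β → Compat (π α) (π β)) →
    Witnessed Θ ψ π → ∀ {e} (le : e ≤ d) → depth ψ ≤ e → M , team le (root ∘ π) ⊨ ψ
  models (var p) π loc val com wit le _ =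
    lift λ { _ (w , refl , t) → var-holds le w (π (type w)) (val (type w)) (loc (type∈ w)) t }
  models (nvar p) π loc val com wit le _ =
    lift λ { _ (w , refl , t) → nvar-fails le w (π (type w)) (val (type w)) (loc (type∈ w)) t }
  models (ψ ∧ᵐ χ) π loc val com (wit₁ , wit₂) le dep =
    team-resp ψ {le = le} {root ∘ and₁ ∘ π} {root ∘ π} (λ mem → proj₁ (and-local (π _) (loc mem)))
      (models ψ (and₁ ∘ π) (λ mem → proj₁ (proj₂ (proj₂ (and-local (π _) (loc mem)))))
        (λ α mem → val α (and-values₁ (π α) mem)) (λ c → proj₁ (and-compat (π _) (π _) (com c))) wit₁ le
        (≤-trans (m≤m⊔n (depth ψ) (depth χ)) dep))
    , team-resp χ {le = le} {root ∘ and₂ ∘ π} {root ∘ π} (λ mem → proj₁ (proj₂ (and-local (π _) (loc mem))))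
      (models χ (and₂ ∘ π) (λ mem → proj₂ (proj₂ (proj₂ (and-local (π _) (loc mem)))))
        (λ α mem → val α (and-values₂ (π α) mem)) (λ c → proj₂ (and-compat (π _) (π _) (com c))) wit₂ le
        (≤-trans (m≤n⊔m (depth ψ) (depth χ)) dep))
  models (ψ ∨ᵐ χ) π loc val com (wit₁ , wit₂) le dep =
    team le (root ∘ or₁ ∘ π) , team le (root ∘ or₂ ∘ π) ,
    ( (λ { _ (w , eq , t) → w , eq , split⊆₁ (root (π (type w))) _ _ (splits w) t })
    , (λ { _ (w , eq , t) → w , eq , split⊆₂ (root (π (type w))) _ _ (splits w) t })
    , (λ { _ (w , eq , t) → case w eq (split-cover (root (π (type w))) _ _ (splits w) t) })
    , (λ { i (w , eq , t) (w' , eq' , t') → apart w w' (point-injective {le = le} {le} (trans eq (sym eq'))) t t' })) ,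
    models ψ (or₁ ∘ π) (λ mem → proj₁ (proj₂ (or-local (π _) (loc mem))))
      (λ α mem → val α (or-values₁ (π α) mem)) (λ c → proj₁ (or-compat (π _) (π _) (com c))) wit₁ le
      (≤-trans (m≤m⊔n (depth ψ) (depth χ)) dep) ,
    models χ (or₂ ∘ π) (λ mem → proj₂ (proj₂ (or-local (π _) (loc mem))))
      (λ α mem → val α (or-values₂ (π α) mem)) (λ c → proj₂ (or-compat (π _) (π _) (com c))) wit₂ le
      (≤-trans (m≤n⊔m (depth ψ) (depth χ)) dep)
    where
    splits : ∀ w → split (root (π (type w))) (root (or₁ (π (type w)))) (root (or₂ (π (type w)))) ≡ true
    splits w = proj₁ (or-local (π (type w)) (loc (type∈ w)))
    case : ∀ {i} w → point le w ≡ i → root (or₁ (π (type w))) ≡ true ⊎ root (or₂ (π (type w))) ≡ true →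
      team le (root ∘ or₁ ∘ π) i ⊎ team le (root ∘ or₂ ∘ π) i
    case w eq (inj₁ t) = inj₁ (w , eq , t)
    case w eq (inj₂ t) = inj₂ (w , eq , t)
    apart : ∀ w w' → w ≡ w' → root (or₁ (π (type w))) ≡ true → root (or₂ (π (type w'))) ≡ true → ⊥
    apart w _ refl = split-disjoint (root (π (type w))) _ _ (splits w)
  models (incl k ps qs) π loc val com wit le dep = lift λ { _ (w , refl , t) → witness w t }
    where
    witness : ∀ w → root (π (type w)) ≡ true → ∃ λ j → team le (root ∘ π) j × ∀ i →
      (Kripke.V M (lookup ps i) (point le w) → Kripke.V M (lookup qs i) j)
      × (Kripke.V M (lookup qs i) j → Kripke.V M (lookup ps i) (point le w))
    witness w t with wit _ (type∈ w) t
    ... | β , mem , t' , eq = point le v , (v , refl , trans (cong (root ∘ π) type-v) t') , λ i →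
      (λ h → proj₁ (right i) (trans (sym (agree i)) (proj₂ (left i) h))) ,
      (λ h → proj₁ (left i) (trans (agree i) (proj₂ (right i) h)))
      where
      -- Any world of type `β` on the same level will do, so the tail is borrowed from `w`.
      v = world-of mem (Vec.tail w)
      type-v = type-world-of mem (Vec.tail w)
      agree : ∀ i → lookup (lhs (π (type w))) i ≡ lookup (rhs (π (type v))) i
      agree i = cong (λ us → lookup us i) (trans eq (cong (rhs ∘ π) (sym type-v)))
      left = λ i → value le w (val (type w) (lhs-values (π (type w)) i))
      right = λ i → value le v (val (type v) (rhs-values (π (type v)) i))
  -- The image of the team on level `suc e` is the team of the argument on level `e`: every `w`
  -- there is seen from some `a ∷ w` by `Back`, and `Compat` keeps successors inside.
  models (□ᵐ ψ) π loc val com (back , wit) {suc e} le (s≤s dep) = ⊨-resp M ψ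
    (λ { _ (w , refl , t) → let (a , s , c) = back-point le le' back w t in
         point le (a ∷ w) , (a ∷ w , refl , s) , sees le le' (a ∷ w) w c })
    (λ { _ (_ , (w , refl , t) , r) → successor w t r })
    (models ψ (unbox ∘ π) (λ mem → box-local (π _) (loc mem)) (λ α mem → val α (box-values (π α) mem))
      (λ c → proj₂ (box-compat (π _) (π _) (com c))) wit le' dep)
    where
    le' = ≤-trans (n≤1+n e) le
    successor : ∀ {j} w → root (π (type w)) ≡ true → Kripke.R M (point le w) j → team le' (root ∘ unbox ∘ π) j
    successor w t (e₁ , le₁ , w' , w₁ , eq , at-w , c) with trans (sym (world-point le w)) at-w
    ... | refl = w' , trans (cong (λ l → point l w') (≤-irrelevant le' le₁)) eq , proj₁ (box-compat (π _) (π _) (com c)) t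
  models (◇ᵐ ψ) π loc val com (forth , back , wit) {suc e} le (s≤s dep) =
    proj₁ f ,
    (λ { _ (w , refl , t) → subst (Kripke.R M (point le w)) (sym (proj₂ f le w))
          (sees le le' w (next w) (proj₁ (next-ok w t))) }) ,
    ⊨-resp M ψ
      (λ { _ (w , refl , t) → let (a , s , c) = back-point le le' back w t in
           point le (a ∷ w) , (a ∷ w , refl , s) , trans (proj₂ f le (a ∷ w)) (cong (point le') (next-hit a w c t)) })
      (λ { _ (_ , (w , refl , t) , eq) → next w , trans (sym (proj₂ f le w)) eq , proj₂ (next-ok w t) })
      (models ψ (undia ∘ π) (λ mem → dia-local (π _) (loc mem)) (λ α mem → val α (dia-values (π α) mem))
        (λ c → dia-compat (π _) (π _) (com c)) wit le' dep)
    where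
    open Successor (root ∘ π) (root ∘ undia ∘ π) forth
    le' = ≤-trans (n≤1+n e) le
    f = lift-map le' next

good→finSatisfiable : ∀ {φ Θ} → Good {φ} Θ → FinSatisfiable φ
good→finSatisfiable {φ} good with Good.rooted good
... | α , mem , t = card finite-World , M , team ≤-refl root ,
  (point ≤-refl w , w , refl , trans (cong root (type-world-of mem (replicate (depth φ) (index mem)))) t) ,
  models φ id (Good.local good) (λ _ m → m) id (Good.witnessed good) ≤-refl ≤-refl
  where
  open Model good
  w = world-of mem (replicate (depth φ) (index mem))

-- The number of types

finite-Ann : ∀ φ → Finite (Ann φ)
finite-Ann (var p)  = finite-image (λ (b , v) → var b v) (λ { (var b v) → b , v }) (λ { (var b v) → refl })
  (finite-× finite-Bool finite-Bool)
finite-Ann (nvar p) = finite-image (λ (b , v) → nvar b v) (λ { (nvar b v) → b , v }) (λ { (nvar b v) → refl })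
  (finite-× finite-Bool finite-Bool)
finite-Ann (φ ∧ᵐ ψ) = finite-image (λ (b , α , β) → and b α β) (λ { (and b α β) → b , α , β })
  (λ { (and b α β) → refl }) (finite-× finite-Bool (finite-× (finite-Ann φ) (finite-Ann ψ)))
finite-Ann (φ ∨ᵐ ψ) = finite-image (λ (b , α , β) → or b α β) (λ { (or b α β) → b , α , β })
  (λ { (or b α β) → refl }) (finite-× finite-Bool (finite-× (finite-Ann φ) (finite-Ann ψ)))
finite-Ann (incl k ps qs) = finite-image (λ (b , us , vs) → incl b us vs) (λ { (incl b us vs) → b , us , vs })
  (λ { (incl b us vs) → refl })
  (finite-× finite-Bool (finite-× (finite-Vec finite-Bool (suc k)) (finite-Vec finite-Bool (suc k))))
finite-Ann (□ᵐ φ) = finite-image (λ (b , α) → box b α) (λ { (box b α) → b , α }) (λ { (box b α) → refl })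
  (finite-× finite-Bool (finite-Ann φ))
finite-Ann (◇ᵐ φ) = finite-image (λ (b , α) → dia b α) (λ { (dia b α) → b , α }) (λ { (dia b α) → refl })
  (finite-× finite-Bool (finite-Ann φ))

card-× : ∀ {A B : Set} (X : Finite A) (Y : Finite B) → card (finite-× X Y) ≡ card X * card Y
card-× X Y = go (X .enum)
  where
  go : ∀ xs → length (concatMap (λ x → List.map (x ,_) (Y .enum)) xs) ≡ length xs * card Y
  go []       = refl
  go (x ∷ xs) = trans (length-++ (List.map (x ,_) (Y .enum))) (cong₂ _+_ (length-map _ (Y .enum)) (go xs))

annBits : Fml → ℕ
annBits (var _)      = 2
annBits (nvar _)     = 2
annBits (φ ∧ᵐ ψ)     = suc (annBits φ + annBits ψ)
annBits (φ ∨ᵐ ψ)     = suc (annBits φ + annBits ψ)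
annBits (incl k _ _) = suc (suc k + suc k)
annBits (□ᵐ φ)       = suc (annBits φ)
annBits (◇ᵐ φ)       = suc (annBits φ)

card-Vec : ∀ n → card (finite-Vec finite-Bool n) ≡ 2 ^ n
card-Vec zero    = refl
card-Vec (suc n) = trans (length-map _ (finite-× finite-Bool (finite-Vec finite-Bool n) .enum))
  (trans (card-× finite-Bool (finite-Vec finite-Bool n)) (cong (2 *_) (card-Vec n)))

card-pair : ∀ {A B : Set} {X : Finite A} {Y : Finite B} {m n} → card X ≡ 2 ^ m → card Y ≡ 2 ^ n →
  card (finite-× finite-Bool (finite-× X Y)) ≡ 2 ^ suc (m + n)
card-pair {X = X} {Y} {m} {n} p q = trans (card-× finite-Bool (finite-× X Y))
  (cong (2 *_) (trans (card-× X Y) (trans (cong₂ _*_ p q) (sym (^-distribˡ-+-* 2 m n)))))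

card-Ann : ∀ φ → card (finite-Ann φ) ≡ 2 ^ annBits φ
card-Ann (var p)  = refl
card-Ann (nvar p) = refl
card-Ann (φ ∧ᵐ ψ) = trans (length-map _ ((finite-× finite-Bool (finite-× (finite-Ann φ) (finite-Ann ψ))) .enum))
  (card-pair {X = finite-Ann φ} {finite-Ann ψ} {annBits φ} {annBits ψ} (card-Ann φ) (card-Ann ψ))
card-Ann (φ ∨ᵐ ψ) = trans (length-map _ ((finite-× finite-Bool (finite-× (finite-Ann φ) (finite-Ann ψ))) .enum))
  (card-pair {X = finite-Ann φ} {finite-Ann ψ} {annBits φ} {annBits ψ} (card-Ann φ) (card-Ann ψ))
card-Ann (incl k ps qs) = trans (length-map _ ((finite-× finite-Bool (finite-× V V)) .enum))
  (card-pair {X = V} {V} {suc k} {suc k} (card-Vec (suc k)) (card-Vec (suc k)))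
  where V = finite-Vec finite-Bool (suc k)
card-Ann (□ᵐ φ) = trans (length-map _ ((finite-× finite-Bool (finite-Ann φ)) .enum))
  (trans (card-× finite-Bool (finite-Ann φ)) (cong (2 *_) (card-Ann φ)))
card-Ann (◇ᵐ φ) = trans (length-map _ ((finite-× finite-Bool (finite-Ann φ)) .enum))
  (trans (card-× finite-Bool (finite-Ann φ)) (cong (2 *_) (card-Ann φ)))

-- The types realized in a given model

infix 3 _⇔ᵇ_
_⇔ᵇ_ : Bool → Set → Set
b ⇔ᵇ P = (b ≡ true → P) × (P → b ≡ true)

¬¬-truth : (P : Set) → ¬ ¬ ∃ λ b → b ⇔ᵇ P
¬¬-truth P = ¬¬-excluded-middle {A = P} >>= λ
  { (yes p) → return (true , (λ _ → p) , λ _ → refl)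
  ; (no ¬p) → return (false , (λ ()) , λ p → contradiction p ¬p) }

⇔ᵇ-unique : ∀ {P Q : Set} b c → b ⇔ᵇ P → c ⇔ᵇ Q → (P → Q) → (Q → P) → b ≡ c
⇔ᵇ-unique true  c     p q f g = sym (proj₂ q (f (proj₁ p refl)))
⇔ᵇ-unique false true  p q f g = proj₂ p (g (proj₁ q refl))
⇔ᵇ-unique false false p q f g = refl

⇔ᵇ-false : ∀ {P : Set} b → b ⇔ᵇ P → ¬ P → b ≡ false
⇔ᵇ-false true  p ¬P = contradiction (proj₁ p refl) ¬P
⇔ᵇ-false false p ¬P = refl

module Types {W : Set} (M : Kripke W) where
  open Kripke M

  -- The recursion follows the proof of satisfaction, because it is this proof that fixes the teams
  -- of the subformulas: the parts of disjunctions and the ranges of diamond functions.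
  Realized : ∀ {φ} T → M , T ⊨ φ → W → Ann φ → Set
  Realized T s w (var {p} b v)  = (b ⇔ᵇ T w) × (v ⇔ᵇ V p w)
  Realized T s w (nvar {p} b v) = (b ⇔ᵇ T w) × (v ⇔ᵇ V p w)
  Realized T (s₁ , s₂) w (and b α β) = (b ⇔ᵇ T w) × Realized T s₁ w α × Realized T s₂ w β
  Realized T (S , S' , _ , s₁ , s₂) w (or b α β) = (b ⇔ᵇ T w) × Realized S s₁ w α × Realized S' s₂ w β
  Realized T s w (incl {ps = ps} {qs} b us vs) = (b ⇔ᵇ T w)
    × (∀ i → lookup us i ⇔ᵇ V (lookup ps i) w) × (∀ i → lookup vs i ⇔ᵇ V (lookup qs i) w)
  Realized T s w (box b α) = (b ⇔ᵇ T w) × Realized (image M T) s w α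
  Realized T (f , _ , s) w (dia b α) = (b ⇔ᵇ T w) × Realized (λ w → ∃ λ u → T u × f u ≡ w) s w α

  realized-root : ∀ {φ} T (s : M , T ⊨ φ) {w} (α : Ann φ) → Realized T s w α → root α ⇔ᵇ T w
  realized-root T s (var _ _)    r = proj₁ r
  realized-root T s (nvar _ _)   r = proj₁ r
  realized-root T s (and _ _ _)  r = proj₁ r
  realized-root T s (or _ _ _)   r = proj₁ r
  realized-root T s (incl _ _ _) r = proj₁ r
  realized-root T s (box _ _)    r = proj₁ r
  realized-root T s (dia _ _)    r = proj₁ r

  ¬¬-bits : ∀ {n} (ps : Vec ℕ n) w → ¬ ¬ ∃ λ vs → ∀ i → lookup vs i ⇔ᵇ V (lookup ps i) w
  ¬¬-bits []       w = return ([] , λ ())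
  ¬¬-bits (p ∷ ps) w = ¬¬-truth (V p w) >>= λ (v , h) → ¬¬-bits ps w >>= λ (vs , hs) →
    return (v ∷ vs , λ { zero → h ; (suc i) → hs i })

  ¬¬-realized : ∀ φ T (s : M , T ⊨ φ) w → ¬ ¬ ∃ λ (α : Ann φ) → Realized T s w α
  ¬¬-realized (var p) T s w = ¬¬-truth (T w) >>= λ (b , h) → ¬¬-truth (V p w) >>= λ (v , h') →
    return (var b v , h , h')
  ¬¬-realized (nvar p) T s w = ¬¬-truth (T w) >>= λ (b , h) → ¬¬-truth (V p w) >>= λ (v , h') →
    return (nvar b v , h , h')
  ¬¬-realized (φ ∧ᵐ ψ) T (s₁ , s₂) w = ¬¬-truth (T w) >>= λ (b , h) →
    ¬¬-realized φ T s₁ w >>= λ (α , r) → ¬¬-realized ψ T s₂ w >>= λ (β , r') → return (and b α β , h , r , r')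
  ¬¬-realized (φ ∨ᵐ ψ) T (S , S' , _ , s₁ , s₂) w = ¬¬-truth (T w) >>= λ (b , h) →
    ¬¬-realized φ S s₁ w >>= λ (α , r) → ¬¬-realized ψ S' s₂ w >>= λ (β , r') → return (or b α β , h , r , r')
  ¬¬-realized (incl k ps qs) T s w = ¬¬-truth (T w) >>= λ (b , h) → ¬¬-bits ps w >>= λ (us , hu) →
    ¬¬-bits qs w >>= λ (vs , hv) → return (incl b us vs , h , hu , hv)
  ¬¬-realized (□ᵐ φ) T s w = ¬¬-truth (T w) >>= λ (b , h) → ¬¬-realized φ _ s w >>= λ (α , r) →
    return (box b α , h , r)
  ¬¬-realized (◇ᵐ φ) T (_ , _ , s) w = ¬¬-truth (T w) >>= λ (b , h) → ¬¬-realized φ _ s w >>= λ (α , r) →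
    return (dia b α , h , r)

  realized-local : ∀ {φ} T (s : M , T ⊨ φ) {w} (α : Ann φ) → Realized T s w α → Local α
  realized-local T s (var b v)  (h , h') t = proj₂ h' (lower s _ (proj₁ h t))
  realized-local T s (nvar b v) (h , h') t = ⇔ᵇ-false v h' (lower s _ (proj₁ h t))
  realized-local T (s₁ , s₂) (and b α β) (h , r , r') =
    ⇔ᵇ-unique _ _ (realized-root _ s₁ α r) h id id , ⇔ᵇ-unique _ _ (realized-root _ s₂ β r') h id id ,
    realized-local _ s₁ α r , realized-local _ s₂ β r'
  realized-local T (S , S' , (⊆ , ⊆' , cover , disjoint) , s₁ , s₂) {w} (or b α β) (h , r , r') =
    splits b (root α) (root β) h (realized-root _ s₁ α r) (realized-root _ s₂ β r') ,
    realized-local _ s₁ α r , realized-local _ s₂ β r'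
    where
    splits : ∀ b c c' → (b ⇔ᵇ T w) → (c ⇔ᵇ S w) → (c' ⇔ᵇ S' w) → split b c c' ≡ true
    splits true true c' p q q' = cong not (⇔ᵇ-false c' q' (disjoint w (proj₁ q refl)))
    splits true false c' p q q' with cover w (proj₁ p refl)
    ... | inj₁ t = contradiction (proj₂ q t) λ ()
    ... | inj₂ t = proj₂ q' t
    splits false c c' p q q'
      rewrite ⇔ᵇ-false c q (λ t → contradiction (proj₂ p (⊆ w t)) λ ())
            | ⇔ᵇ-false c' q' (λ t → contradiction (proj₂ p (⊆' w t)) λ ()) = refl
  realized-local T s (incl _ _ _) r = tt
  realized-local T s (box _ α) (_ , r) = realized-local _ s α r
  realized-local T (_ , _ , s) (dia _ α) (_ , r) = realized-local _ s α r

  zip-value : ∀ {n} (ps : Vec ℕ n) vs {w} → (∀ i → lookup vs i ⇔ᵇ V (lookup ps i) w) →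
    ∀ {p b} → (p , b) ∈ zipVals ps vs → b ⇔ᵇ V p w
  zip-value []       []       h ()
  zip-value (p ∷ ps) (v ∷ vs) h (here refl) = h zero
  zip-value (p ∷ ps) (v ∷ vs) h (there mem) = zip-value ps vs (h ∘ suc) mem

  realized-value : ∀ {φ} T (s : M , T ⊨ φ) {w} (α : Ann φ) → Realized T s w α → ∀ {p b} → (p , b) ∈ values α → b ⇔ᵇ V p w
  realized-value T s (var _ _)  (_ , h) (here refl) = h
  realized-value T s (nvar _ _) (_ , h) (here refl) = h
  realized-value T (s₁ , s₂) (and _ α β) (_ , r , r') mem with ∈-++⁻ (values α) mem
  ... | inj₁ m = realized-value _ s₁ α r m
  ... | inj₂ m = realized-value _ s₂ β r' m
  realized-value T (_ , _ , _ , s₁ , s₂) (or _ α β) (_ , r , r') mem with ∈-++⁻ (values α) mem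
  ... | inj₁ m = realized-value _ s₁ α r m
  ... | inj₂ m = realized-value _ s₂ β r' m
  realized-value T s (incl {ps = ps} {qs} _ us vs) (_ , h , h') mem with ∈-++⁻ (zipVals ps us) mem
  ... | inj₁ m = zip-value ps us h m
  ... | inj₂ m = zip-value qs vs h' m
  realized-value T s (box _ α) (_ , r) = realized-value _ s α r
  realized-value T (_ , _ , s) (dia _ α) (_ , r) = realized-value _ s α r

  -- For a box, the edge itself puts `v` into the image of the team; all other cases are inherited.
  realized-compat : ∀ {φ} T (s : M , T ⊨ φ) {u v} → R u v → ∀ (α β : Ann φ) → Realized T s u α → Realized T s v β → Compat α β
  realized-compat T s rel (var _ _) (var _ _) r r' = tt
  realized-compat T s rel (nvar _ _) (nvar _ _) r r' = tt
  realized-compat T (s₁ , s₂) rel (and _ α β) (and _ α' β') (_ , a , b) (_ , a' , b') =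
    realized-compat _ s₁ rel α α' a a' , realized-compat _ s₂ rel β β' b b'
  realized-compat T (_ , _ , _ , s₁ , s₂) rel (or _ α β) (or _ α' β') (_ , a , b) (_ , a' , b') =
    realized-compat _ s₁ rel α α' a a' , realized-compat _ s₂ rel β β' b b'
  realized-compat T s rel (incl _ _ _) (incl _ _ _) r r' = tt
  realized-compat T s {u} rel (box b α) (box _ α') (h , r) (_ , r') =
    (λ t → proj₂ (realized-root (image M T) s α' r') (u , proj₁ h t , rel)) , realized-compat _ s rel α α' r r'
  realized-compat T (_ , _ , s) rel (dia _ α) (dia _ α') (_ , r) (_ , r') = realized-compat _ s rel α α' r r'

  module _ {φ T} (s : M , T ⊨ φ) (Θ : List (Ann φ)) (sound : ∀ α → α ∈ Θ → ∃ λ w → Realized T s w α)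
    (full : ∀ {w} α → Realized T s w α → α ∈ Θ) where

    module _ {f g : Ann φ → Bool} {F G : W → Set}
      (hf : ∀ α {w} → Realized T s w α → f α ⇔ᵇ F w) (hg : ∀ α {w} → Realized T s w α → g α ⇔ᵇ G w) where

      -- The model supplies a witness world; it has a type up to double negation, and `full` puts
      -- that type into `Θ`.
      ¬¬-forth : (∀ u → F u → ∃ λ v → R u v × G v) → ¬ ¬ Forth Θ f g
      ¬¬-forth h = ¬¬-∀∈ Θ wit
        where
        wit : ∀ α → α ∈ Θ → ¬ ¬ (f α ≡ true → ∃ λ β → β ∈ Θ × Compat α β × g β ≡ true)
        wit α mem with sound α mem
        ... | u , r = ¬¬-excluded-middle {A = f α ≡ true} >>= λ
          { (no ≠) → return λ t → contradiction t ≠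
          ; (yes t) → let (v , rel , gv) = h u (proj₁ (hf α r) t) in
              ¬¬-realized φ T s v >>= λ (β , r') →
              return λ _ → β , full β r' , realized-compat T s rel α β r r' , proj₂ (hg β r') gv }

      ¬¬-back : (∀ v → G v → ∃ λ u → R u v × F u) → ¬ ¬ Back Θ f g
      ¬¬-back h = ¬¬-∀∈ Θ wit
        where
        wit : ∀ β → β ∈ Θ → ¬ ¬ (g β ≡ true → ∃ λ α → α ∈ Θ × Compat α β × f α ≡ true)
        wit β mem with sound β mem
        ... | v , r' = ¬¬-excluded-middle {A = g β ≡ true} >>= λ
          { (no ≠) → return λ t → contradiction t ≠
          ; (yes t) → let (u , rel , fu) = h v (proj₁ (hg β r') t) in
              ¬¬-realized φ T s u >>= λ (α , r) →
              return λ _ → α , full α r , realized-compat T s rel α β r r' , proj₂ (hf α r) fu }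

    ¬¬-witnessed : ∀ ψ T' (s' : M , T' ⊨ ψ) (π : Ann φ → Ann ψ) →
      (∀ α {w} → Realized T s w α → Realized T' s' w (π α)) → ¬ ¬ Witnessed Θ ψ π
    ¬¬-witnessed (var p)  T' s' π h = return tt
    ¬¬-witnessed (nvar p) T' s' π h = return tt
    ¬¬-witnessed (ψ ∧ᵐ χ) T' (s₁ , s₂) π h =
      ¬¬-witnessed ψ T' s₁ (and₁ ∘ π) (λ α r → first (π α) (h α r)) >>= λ w₁ →
      ¬¬-witnessed χ T' s₂ (and₂ ∘ π) (λ α r → second (π α) (h α r)) >>= λ w₂ → return (w₁ , w₂)
      where
      first : ∀ {w} (α : Ann (ψ ∧ᵐ χ)) → Realized T' (s₁ , s₂) w α → Realized T' s₁ w (and₁ α)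
      first (and _ _ _) r = proj₁ (proj₂ r)
      second : ∀ {w} (α : Ann (ψ ∧ᵐ χ)) → Realized T' (s₁ , s₂) w α → Realized T' s₂ w (and₂ α)
      second (and _ _ _) r = proj₂ (proj₂ r)
    ¬¬-witnessed (ψ ∨ᵐ χ) T' s'@(S , S' , _ , s₁ , s₂) π h =
      ¬¬-witnessed ψ S s₁ (or₁ ∘ π) (λ α r → first (π α) (h α r)) >>= λ w₁ →
      ¬¬-witnessed χ S' s₂ (or₂ ∘ π) (λ α r → second (π α) (h α r)) >>= λ w₂ → return (w₁ , w₂)
      where
      first : ∀ {w} (α : Ann (ψ ∨ᵐ χ)) → Realized T' s' w α → Realized S s₁ w (or₁ α)
      first (or _ _ _) r = proj₁ (proj₂ r)
      second : ∀ {w} (α : Ann (ψ ∨ᵐ χ)) → Realized T' s' w α → Realized S' s₂ w (or₂ α)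
      second (or _ _ _) r = proj₂ (proj₂ r)
    ¬¬-witnessed (incl k ps qs) T' s'@(lift inc) π h = ¬¬-∀∈ Θ wit
      where
      equal : ∀ {u v} (α β : Ann (incl k ps qs)) → Realized T' s' u α → Realized T' s' v β →
        (∀ i → (V (lookup ps i) u → V (lookup qs i) v) × (V (lookup qs i) v → V (lookup ps i) u)) → lhs α ≡ rhs β
      equal (incl _ us _) (incl _ _ vs) (_ , hu , _) (_ , _ , hv) e =
        trans (sym (Vec.tabulate∘lookup us)) (trans
          (Vec.tabulate-cong λ i → ⇔ᵇ-unique _ _ (hu i) (hv i) (proj₁ (e i)) (proj₂ (e i))) (Vec.tabulate∘lookup vs))
      wit : ∀ α → α ∈ Θ → ¬ ¬ (root (π α) ≡ true → ∃ λ β → β ∈ Θ × root (π β) ≡ true × lhs (π α) ≡ rhs (π β))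
      wit α mem with sound α mem
      ... | u , r = ¬¬-excluded-middle {A = root (π α) ≡ true} >>= λ
        { (no ≠) → return λ t → contradiction t ≠
        ; (yes t) → let (v , tv , e) = inc u (proj₁ (realized-root T' s' (π α) (h α r)) t) in
            ¬¬-realized φ T s v >>= λ (β , r') → return λ _ →
            β , full β r' , proj₂ (realized-root T' s' (π β) (h β r')) tv , equal (π α) (π β) (h α r) (h β r') e }
    ¬¬-witnessed (□ᵐ ψ) T' s' π h =
      ¬¬-back (λ α r → realized-root T' s' (π α) (h α r)) (λ α r → realized-root _ s' (unbox (π α)) (inner (π α) (h α r)))
        (λ { v (u , t , rel) → u , rel , t }) >>= λ bk →
      ¬¬-witnessed ψ _ s' (unbox ∘ π) (λ α r → inner (π α) (h α r)) >>= λ w → return (bk , w)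
      where
      inner : ∀ {w} (α : Ann (□ᵐ ψ)) → Realized T' s' w α → Realized (image M T') s' w (unbox α)
      inner (box _ _) r = proj₂ r
    ¬¬-witnessed (◇ᵐ ψ) T' s'@(f , rel , s'') π h =
      ¬¬-forth (λ α r → realized-root T' s' (π α) (h α r)) (λ α r → realized-root _ s'' (undia (π α)) (inner (π α) (h α r)))
        (λ u t → f u , rel u t , u , t , refl) >>= λ fo →
      ¬¬-back (λ α r → realized-root T' s' (π α) (h α r)) (λ α r → realized-root _ s'' (undia (π α)) (inner (π α) (h α r)))
        (λ { v (u , t , refl) → u , rel u t , t }) >>= λ bk →
      ¬¬-witnessed ψ _ s'' (undia ∘ π) (λ α r → inner (π α) (h α r)) >>= λ w → return (fo , bk , w)
      where
      inner : ∀ {w} (α : Ann (◇ᵐ ψ)) → Realized T' s' w α → Realized (λ w → ∃ λ u → T' u × f u ≡ w) s'' w (undia α)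
      inner (dia _ _) r = proj₂ r

-- The bound on the length is inherited from the enumeration of all annotations, out of which the
-- realized types are filtered.
satisfiable→good : ∀ {φ} → Satisfiable φ → ¬ ¬ ∃ λ Θ → length Θ ≤ 2 ^ annBits φ × Good {φ} Θ
satisfiable→good {φ} (W , M , T , (w₀ , t₀) , s) =
  ¬¬-filter (λ α → ∃ λ w → Realized T s w α) (finite-Ann φ .enum) >>= λ (Θ , le , sound , full) →
  let full' = λ {w} α (r : Realized T s w α) → full α (finite-Ann φ .complete α) (w , r) in
  ¬¬-witnessed s Θ sound full' φ T s id (λ _ r → r) >>= λ wit →
  ¬¬-realized φ T s w₀ >>= λ (α₀ , r₀) →
  return (Θ , ≤-trans le (≤-reflexive (card-Ann φ)) , record
    { local      = λ {α} mem → realized-local T s α (proj₂ (sound α mem))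
    ; consistent = λ {α} mem m m' → contradiction
        (proj₂ (realized-value T s α (proj₂ (sound α mem)) m') (proj₁ (realized-value T s α (proj₂ (sound α mem)) m) refl)) λ ()
    ; witnessed  = wit
    ; rooted     = α₀ , full' α₀ r₀ , proj₂ (realized-root T s α₀ r₀) t₀ })
  where open Types M

-- Annotated formulas as words

-- The letter of a subformula carries its membership bit, `Nb` a truth value, `Bit` an input bit and
-- `Dig` a digit. `End` closes a numeral, `Mid` a vector of an inclusion atom and `Sep` a block;
-- `Tick` counts in unary.
data Letter : Set where
  Var Nvar And Or Incl Nb Bit Dig : Bool → Letter
  Box Dia                         : Bool → Bool → Letter
  End Mid Sep Tick                : Letter

private
  LetterCode : Set
  LetterCode = (Fin 8 × Bool) ⊎ (Bool × Bool × Bool) ⊎ Fin 4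

  toLetter : LetterCode → Letter
  toLetter (inj₁ (k , b)) = lookup (Var ∷ Nvar ∷ And ∷ Or ∷ Incl ∷ Nb ∷ Bit ∷ Dig ∷ []) k b
  toLetter (inj₂ (inj₁ (k , b , c))) = if k then Box b c else Dia b c
  toLetter (inj₂ (inj₂ k)) = lookup (End ∷ Mid ∷ Sep ∷ Tick ∷ []) k

  fromLetter : Letter → LetterCode
  fromLetter (Var b)   = inj₁ (0F , b)
  fromLetter (Nvar b)  = inj₁ (1F , b)
  fromLetter (And b)   = inj₁ (2F , b)
  fromLetter (Or b)    = inj₁ (3F , b)
  fromLetter (Incl b)  = inj₁ (4F , b)
  fromLetter (Nb b)    = inj₁ (5F , b)
  fromLetter (Bit b)   = inj₁ (6F , b)
  fromLetter (Dig b)   = inj₁ (7F , b)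
  fromLetter (Box b c) = inj₂ (inj₁ (true , b , c))
  fromLetter (Dia b c) = inj₂ (inj₁ (false , b , c))
  fromLetter End       = inj₂ (inj₂ 0F)
  fromLetter Mid       = inj₂ (inj₂ 1F)
  fromLetter Sep       = inj₂ (inj₂ 2F)
  fromLetter Tick      = inj₂ (inj₂ 3F)

  to∘fromLetter : ∀ a → toLetter (fromLetter a) ≡ a
  to∘fromLetter (Var b)   = refl
  to∘fromLetter (Nvar b)  = refl
  to∘fromLetter (And b)   = refl
  to∘fromLetter (Or b)    = refl
  to∘fromLetter (Incl b)  = refl
  to∘fromLetter (Nb b)    = refl
  to∘fromLetter (Bit b)   = refl
  to∘fromLetter (Dig b)   = refl
  to∘fromLetter (Box b c) = refl
  to∘fromLetter (Dia b c) = refl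
  to∘fromLetter End       = refl
  to∘fromLetter Mid       = refl
  to∘fromLetter Sep       = refl
  to∘fromLetter Tick      = refl

abstract
  finite-Letter : Finite Letter
  finite-Letter = finite-image toLetter fromLetter to∘fromLetter
    (finite-⊎ (finite-× (finite-Fin 8) finite-Bool)
      (finite-⊎ (finite-× finite-Bool (finite-× finite-Bool finite-Bool)) (finite-Fin 4)))

  _≟L_ : DecidableEquality Letter
  a ≟L b = map′ (λ eq → trans (sym (to∘fromLetter a)) (trans (cong toLetter eq) (to∘fromLetter b))) (cong fromLetter)
    (Sum.≡-dec (Product.≡-dec Fin._≟_ Bool._≟_)
      (Sum.≡-dec (Product.≡-dec Bool._≟_ (Product.≡-dec Bool._≟_ Bool._≟_)) Fin._≟_) (fromLetter a) (fromLetter b))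

digs : ℕᵇ → List Bool
digs ℕᵇ.zero     = []
digs 2[1+ n ]    = true ∷ digs n
digs 1+[2 n ]    = false ∷ digs n

undigs : List Bool → ℕᵇ
undigs []           = ℕᵇ.zero
undigs (true ∷ ds)  = 2[1+ undigs ds ]
undigs (false ∷ ds) = 1+[2 undigs ds ]

digs-undigs : ∀ ds → digs (undigs ds) ≡ ds
digs-undigs []           = refl
digs-undigs (true ∷ ds)  = cong (true ∷_) (digs-undigs ds)
digs-undigs (false ∷ ds) = cong (false ∷_) (digs-undigs ds)

undigs-digs : ∀ n → undigs (digs n) ≡ n
undigs-digs ℕᵇ.zero  = refl
undigs-digs 2[1+ n ] = cong 2[1+_] (undigs-digs n)
undigs-digs 1+[2 n ] = cong 1+[2_] (undigs-digs n)

digits : ℕ → List Bool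
digits n = digs (ℕᵇ.fromℕ n)

-- Bijective base two knows no leading zeros, so every digit string is a numeral and guessed digits
-- are always well formed.
digits-surjective : ∀ ds → ∃ λ n → digits n ≡ ds
digits-surjective ds = ℕᵇ.toℕ (undigs ds) , trans (cong digs (ℕᵇ.fromℕ-toℕ (undigs ds))) (digs-undigs ds)

digits-injective : ∀ {m n} → digits m ≡ digits n → m ≡ n
digits-injective {m} {n} eq = trans (sym (ℕᵇ.toℕ-fromℕ m)) (trans (cong ℕᵇ.toℕ
  (trans (sym (undigs-digs _)) (trans (cong undigs eq) (undigs-digs _)))) (ℕᵇ.toℕ-fromℕ n))

-- The successor in bijective base two, low digit first: `true` is the digit two, which becomes one
-- with a carry.
inc : List Bool → List Bool
inc []           = false ∷ []
inc (true ∷ ds)  = false ∷ inc ds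
inc (false ∷ ds) = true ∷ ds

digits-suc : ∀ n → digits (suc n) ≡ inc (digits n)
digits-suc n = trans (cong digs (ℕᵇ.fromℕ≡fromℕ' (suc n)))
  (trans (go (ℕᵇ.fromℕ' n)) (cong (inc ∘ digs) (sym (ℕᵇ.fromℕ≡fromℕ' n))))
  where
  go : ∀ b → digs (ℕᵇ.suc b) ≡ inc (digs b)
  go ℕᵇ.zero  = refl
  go 2[1+ b ] = cong (false ∷_) (go b)
  go 1+[2 b ] = refl

digitTok : Bool → Tok
digitTok true  = tD0
digitTok false = tD1

digitsᵇ-digs : ∀ n → digitsᵇ n ≡ List.map digitTok (digs n)
digitsᵇ-digs ℕᵇ.zero  = refl
digitsᵇ-digs 2[1+ n ] = cong (tD0 ∷_) (digitsᵇ-digs n)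
digitsᵇ-digs 1+[2 n ] = cong (tD1 ∷_) (digitsᵇ-digs n)

toBits : List Tok → List Letter
toBits ts = List.map Bit (concatMap tokBits ts)

toBits-++ : ∀ ts us → toBits (ts ++ us) ≡ toBits ts ++ toBits us
toBits-++ ts us = trans (cong (List.map Bit) (concatMap-++ tokBits ts us)) (map-++ Bit (concatMap tokBits ts) (concatMap tokBits us))

numeral : ℕ → List Letter
numeral n = List.map Dig (digits n) ++ End ∷ []

nums : ∀ {n} → Vec ℕ n → Vec Bool n → List Letter
nums []       []       = []
nums (p ∷ ps) (v ∷ vs) = Nb v ∷ numeral p ++ nums ps vs

-- The machine's notation for an annotated formula.  A modal operator also carries the bit of its
-- argument, so that the conditions on modal successors compare single letters.
flat : ∀ {φ} → Ann φ → List Letter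
flat (var {p} b v)  = Var b ∷ Nb v ∷ numeral p
flat (nvar {p} b v) = Nvar b ∷ Nb v ∷ numeral p
flat (and b α β)    = And b ∷ flat α ++ flat β
flat (or b α β)     = Or b ∷ flat α ++ flat β
flat (incl {ps = ps} {qs} b us vs) = Incl b ∷ nums ps us ++ Mid ∷ nums qs vs ++ Mid ∷ []
flat (box b α)      = Box b (root α) ∷ flat α
flat (dia b α)      = Dia b (root α) ∷ flat α

notSep : Letter → Bool
notSep Sep = false
notSep _   = true

NoSep : List Letter → Set
NoSep = All (λ a → notSep a ≡ true)

noSep-numeral : ∀ n → NoSep (numeral n)
noSep-numeral n = go (digits n)
  where
  go : ∀ ds → NoSep (List.map Dig ds ++ End ∷ [])
  go []       = refl ∷ []
  go (_ ∷ ds) = refl ∷ go ds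

noSep-nums : ∀ {n} (ps : Vec ℕ n) vs → NoSep (nums ps vs)
noSep-nums []       []       = []
noSep-nums (p ∷ ps) (v ∷ vs) = refl ∷ All.++⁺ (noSep-numeral p) (noSep-nums ps vs)

noSep-flat : ∀ {φ} (α : Ann φ) → NoSep (flat α)
noSep-flat (var {p} b v)  = refl ∷ refl ∷ noSep-numeral p
noSep-flat (nvar {p} b v) = refl ∷ refl ∷ noSep-numeral p
noSep-flat (and b α β)    = refl ∷ All.++⁺ (noSep-flat α) (noSep-flat β)
noSep-flat (or b α β)     = refl ∷ All.++⁺ (noSep-flat α) (noSep-flat β)
noSep-flat (incl {ps = ps} {qs} b us vs) =
  refl ∷ All.++⁺ (noSep-nums ps us) (refl ∷ All.++⁺ (noSep-nums qs vs) (refl ∷ []))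
noSep-flat (box b α)      = refl ∷ noSep-flat α
noSep-flat (dia b α)      = refl ∷ noSep-flat α

-- The first letter that fails `P` fixes the decomposition. This determines where a nondeterministic
-- scan must have stopped.
break-unique : ∀ (P : Letter → Bool) {u u' a a' v v'} → All (λ a → P a ≡ true) u → All (λ a → P a ≡ true) u' →
  P a ≡ false → P a' ≡ false → u ++ a ∷ v ≡ u' ++ a' ∷ v' → u ≡ u' × a ≡ a' × v ≡ v'
break-unique P []      []       f f' refl = refl , refl , refl
break-unique P []      (t ∷ _)  f f' refl = contradiction (trans (sym t) f) λ ()
break-unique P (t ∷ _) []       f f' refl = contradiction (trans (sym t) f') λ ()
break-unique P {x ∷ u} {y ∷ u'} (_ ∷ us) (_ ∷ us') f f' eq with ∷-injective eq
... | refl , eq' with break-unique P us us' f f' eq'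
... | refl , rest = refl , rest

++-cancel-length : ∀ {A : Set} (u : List A) {u' v v'} → length u ≡ length u' → u ++ v ≡ u' ++ v' → u ≡ u' × v ≡ v'
++-cancel-length []      {[]}     len eq = refl , eq
++-cancel-length (x ∷ u) {y ∷ u'} len eq with ∷-injective eq
... | refl , eq' with ++-cancel-length u {u'} (suc-injective len) eq'
... | refl , rest = refl , rest

length-nums : ∀ {n} (ps : Vec ℕ n) us vs → length (nums ps us) ≡ length (nums ps vs)
length-nums []       []       []       = refl
length-nums (p ∷ ps) (u ∷ us) (v ∷ vs) = cong suc (trans (length-++ (numeral p))
  (trans (cong (length (numeral p) +_) (length-nums ps us vs)) (sym (length-++ (numeral p)))))

length-++-cong : ∀ {A : Set} (u u' : List A) {v v'} → length u ≡ length u' → length v ≡ length v' →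
  length (u ++ v) ≡ length (u' ++ v')
length-++-cong u u' p q = trans (length-++ u) (trans (cong₂ _+_ p q) (sym (length-++ u')))

-- Every bit is part of a single letter, so the length depends on the formula alone. Comparing
-- blocks by position rests on this.
length-flat : ∀ {φ} (α β : Ann φ) → length (flat α) ≡ length (flat β)
length-flat (var _ _)    (var _ _)      = refl
length-flat (nvar _ _)   (nvar _ _)     = refl
length-flat (and _ α β)  (and _ α' β')  = cong suc (length-++-cong (flat α) (flat α') (length-flat α α') (length-flat β β'))
length-flat (or _ α β)   (or _ α' β')   = cong suc (length-++-cong (flat α) (flat α') (length-flat α α') (length-flat β β'))
length-flat (incl {ps = ps} {qs} _ us vs) (incl _ us' vs') =
  cong suc (length-++-cong (nums ps us) (nums ps us') (length-nums ps us us')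
    (cong suc (length-++-cong (nums qs vs) (nums qs vs') (length-nums qs vs vs') refl)))
length-flat (box _ α)    (box _ β)      = cong suc (length-flat α β)
length-flat (dia _ α)    (dia _ β)      = cong suc (length-flat α β)

-- Unique readability of the encoding

module _ where
  private
    Starts : Tok → Fml → Set
    Starts tVAR  φ = ∃ λ p → φ ≡ var p
    Starts tNVAR φ = ∃ λ p → φ ≡ nvar p
    Starts tAND  φ = ∃ λ ψ → ∃ λ χ → φ ≡ ψ ∧ᵐ χ
    Starts tOR   φ = ∃ λ ψ → ∃ λ χ → φ ≡ ψ ∨ᵐ χ
    Starts tINCL φ = ∃ λ k → ∃ λ ps → ∃ λ qs → φ ≡ incl k ps qs
    Starts tBOX  φ = ∃ λ ψ → φ ≡ □ᵐ ψ
    Starts tDIA  φ = ∃ λ ψ → φ ≡ ◇ᵐ ψ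
    Starts _     φ = ⊥

    starts : ∀ φ {t ts r} → t ∷ ts ≡ fmlToks φ ++ r → Starts t φ
    starts (var p)        refl = p , refl
    starts (nvar p)       refl = p , refl
    starts (ψ ∧ᵐ χ)       refl = ψ , χ , refl
    starts (ψ ∨ᵐ χ)       refl = ψ , χ , refl
    starts (incl k ps qs) refl = k , ps , qs , refl
    starts (□ᵐ ψ)         refl = ψ , refl
    starts (◇ᵐ ψ)         refl = ψ , refl

    numToks-unique : ∀ p q {r r'} → numToks p ++ r ≡ numToks q ++ r' → p ≡ q × r ≡ r'
    numToks-unique p q eq with go (ℕᵇ.fromℕ p) (ℕᵇ.fromℕ q) eq
      where
      go : ∀ m n {r r'} → (digitsᵇ m ++ tEND ∷ []) ++ r ≡ (digitsᵇ n ++ tEND ∷ []) ++ r' → m ≡ n × r ≡ r'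
      go ℕᵇ.zero  ℕᵇ.zero  refl = refl , refl
      go ℕᵇ.zero  2[1+ n ] ()
      go ℕᵇ.zero  1+[2 n ] ()
      go 2[1+ m ] ℕᵇ.zero  ()
      go 2[1+ m ] 1+[2 n ] ()
      go 1+[2 m ] ℕᵇ.zero  ()
      go 1+[2 m ] 2[1+ n ] ()
      go 2[1+ m ] 2[1+ n ] eq with go m n (proj₂ (∷-injective eq))
      ... | refl , e = refl , e
      go 1+[2 m ] 1+[2 n ] eq with go m n (proj₂ (∷-injective eq))
      ... | refl , e = refl , e
    ... | e , e' = ℕᵇ.fromℕ-injective e , e'

    vecToks-unique : ∀ {n} (ps qs : Vec ℕ n) {r r'} → vecToks ps ++ r ≡ vecToks qs ++ r' → ps ≡ qs × r ≡ r'
    vecToks-unique []       []       eq = refl , eq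
    vecToks-unique (p ∷ ps) (q ∷ qs) {r} {r'} eq
      with numToks-unique p q (trans (sym (++-assoc (numToks p) (vecToks ps) r)) (trans eq (++-assoc (numToks q) (vecToks qs) r')))
    ... | refl , eq' with vecToks-unique ps qs eq'
    ... | refl , e = refl , e

    -- Polish notation is prefix-free: the first token fixes the constructor, and for inclusion
    -- atoms the arity fixes the lengths of the vectors. The remainders `r` and `r'` let the
    -- arguments be read off one after the other.
    fmlToks-unique : ∀ φ φ' {r r'} → fmlToks φ ++ r ≡ fmlToks φ' ++ r' → φ ≡ φ' × r ≡ r'
    fmlToks-unique (var p) φ' eq with starts φ' eq
    ... | q , refl with numToks-unique p q (proj₂ (∷-injective eq))
    ... | refl , e = refl , e
    fmlToks-unique (nvar p) φ' eq with starts φ' eq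
    ... | q , refl with numToks-unique p q (proj₂ (∷-injective eq))
    ... | refl , e = refl , e
    fmlToks-unique (φ ∧ᵐ ψ) φ' {r} {r'} eq with starts φ' eq
    ... | φ₁ , ψ₁ , refl with fmlToks-unique φ φ₁ (trans (sym (++-assoc (fmlToks φ) (fmlToks ψ) r))
                             (trans (proj₂ (∷-injective eq)) (++-assoc (fmlToks φ₁) (fmlToks ψ₁) r')))
    ... | refl , eq' with fmlToks-unique ψ ψ₁ eq'
    ... | refl , e = refl , e
    fmlToks-unique (φ ∨ᵐ ψ) φ' {r} {r'} eq with starts φ' eq
    ... | φ₁ , ψ₁ , refl with fmlToks-unique φ φ₁ (trans (sym (++-assoc (fmlToks φ) (fmlToks ψ) r))
                             (trans (proj₂ (∷-injective eq)) (++-assoc (fmlToks φ₁) (fmlToks ψ₁) r')))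
    ... | refl , eq' with fmlToks-unique ψ ψ₁ eq'
    ... | refl , e = refl , e
    fmlToks-unique (incl k ps qs) φ' {r} {r'} eq with starts φ' eq
    ... | k₁ , ps₁ , qs₁ , refl
      with numToks-unique k k₁ (trans (sym (++-assoc (numToks k) (vecToks ps ++ vecToks qs) r))
             (trans (proj₂ (∷-injective eq)) (++-assoc (numToks k₁) (vecToks ps₁ ++ vecToks qs₁) r')))
    ... | refl , eq' with vecToks-unique ps ps₁ (trans (sym (++-assoc (vecToks ps) (vecToks qs) r))
                            (trans eq' (++-assoc (vecToks ps₁) (vecToks qs₁) r')))
    ... | refl , eq'' with vecToks-unique qs qs₁ eq''
    ... | refl , e = refl , e
    fmlToks-unique (□ᵐ φ) φ' eq with starts φ' eq
    ... | φ₁ , refl with fmlToks-unique φ φ₁ (proj₂ (∷-injective eq))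
    ... | refl , e = refl , e
    fmlToks-unique (◇ᵐ φ) φ' eq with starts φ' eq
    ... | φ₁ , refl with fmlToks-unique φ φ₁ (proj₂ (∷-injective eq))
    ... | refl , e = refl , e

    -- Only a left inverse of `tokBits` is wanted; codes of no token are sent to arbitrary tokens.
    readTok : Bool → Bool → Bool → Bool → Tok
    readTok false false false false = tVAR
    readTok false false false true  = tNVAR
    readTok false false true  false = tAND
    readTok false false true  true  = tOR
    readTok false true  false false = tINCL
    readTok false true  false true  = tBOX
    readTok false true  true  false = tDIA
    readTok false true  true  true  = tD0
    readTok true  _     _     false = tD1
    readTok true  _     _     true  = tEND

    readToks : List Bool → List Tok
    readToks (a ∷ b ∷ c ∷ d ∷ bs) = readTok a b c d ∷ readToks bs
    readToks _                    = []

    read-bits : ∀ ts → readToks (concatMap tokBits ts) ≡ ts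
    read-bits []           = refl
    read-bits (tVAR ∷ ts)  = cong (tVAR ∷_) (read-bits ts)
    read-bits (tNVAR ∷ ts) = cong (tNVAR ∷_) (read-bits ts)
    read-bits (tAND ∷ ts)  = cong (tAND ∷_) (read-bits ts)
    read-bits (tOR ∷ ts)   = cong (tOR ∷_) (read-bits ts)
    read-bits (tINCL ∷ ts) = cong (tINCL ∷_) (read-bits ts)
    read-bits (tBOX ∷ ts)  = cong (tBOX ∷_) (read-bits ts)
    read-bits (tDIA ∷ ts)  = cong (tDIA ∷_) (read-bits ts)
    read-bits (tD0 ∷ ts)   = cong (tD0 ∷_) (read-bits ts)
    read-bits (tD1 ∷ ts)   = cong (tD1 ∷_) (read-bits ts)
    read-bits (tEND ∷ ts)  = cong (tEND ∷_) (read-bits ts)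

  -- Blocks are parsed separately, each against the whole input; injectivity makes them types of one
  -- and the same formula.
  encode-injective : ∀ φ ψ → encode φ ≡ encode ψ → φ ≡ ψ
  encode-injective φ ψ eq = proj₁ (fmlToks-unique φ ψ (cong (_++ [])
    (trans (sym (read-bits (fmlToks φ))) (trans (cong readToks eq) (read-bits (fmlToks ψ))))))

-- Occurrences inside the notation of a type

-- Each P u t z: P holds of every suffix of u ++ t that starts inside u, together with its position
-- counted from z.
Each : (List Letter → ℕ → Set) → List Letter → List Letter → ℕ → Set
Each P []      t z = ⊤
Each P (a ∷ u) t z = P (a ∷ u ++ t) z × Each P u t (suc z)

each-at : ∀ P {b} u {a v t z} → b ≡ u ++ a ∷ v → Each P b t z → P (a ∷ v ++ t) (length u + z)
each-at P []      refl (p , _) = p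
each-at P (x ∷ u) {a} {v} {t} {z} refl (_ , e) = subst (P (a ∷ v ++ t)) (+-suc (length u) z) (each-at P u refl e)

each-++ : ∀ P u {v t z} → Each P u (v ++ t) z → Each P v t (length u + z) → Each P (u ++ v) t z
each-++ P []      e e' = e'
each-++ P (x ∷ u) {v} {t} {z} (p , e) e' =
  subst (λ s → P (x ∷ s) z) (sym (++-assoc u v t)) p ,
  each-++ P u e (subst (Each P v t) (sym (+-suc (length u) z)) e')

each-all : ∀ P {Q : Letter → Set} → (∀ {a} t z → Q a → P (a ∷ t) z) → ∀ {u} t z → All Q u → Each P u t z
each-all P h t z []       = tt
each-all P h t z (q ∷ qs) = h _ z q , each-all P h t (suc z) qs

isNb : Letter → Bool
isNb (Nb _) = true
isNb _      = false

all-numeral : ∀ {Q : Letter → Set} → (∀ d → Q (Dig d)) → Q End → ∀ n → All Q (numeral n)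
all-numeral {Q} dig end n = go (digits n)
  where
  go : ∀ ds → All Q (List.map Dig ds ++ End ∷ [])
  go []       = end ∷ []
  go (d ∷ ds) = dig d ∷ go ds

all-nums : ∀ {Q : Letter → Set} → (∀ d → Q (Dig d)) → Q End → (∀ v → Q (Nb v)) →
  ∀ {n} (ps : Vec ℕ n) vs → All Q (nums ps vs)
all-nums dig end nb []       []       = []
all-nums dig end nb (p ∷ ps) (v ∷ vs) = nb v ∷ All.++⁺ (all-numeral dig end p) (all-nums dig end nb ps vs)

module _ (P : List Letter → ℕ → Set) (other : ∀ a t z → isNb a ≡ false → P (a ∷ t) z) where

  private
    Number : ℕ × Bool → Set
    Number (p , b) = ∀ t z → P (Nb b ∷ numeral p ++ t) z

    each-number : ∀ p b t z → Number (p , b) → Each P (Nb b ∷ numeral p) t z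
    each-number p b t z num = num t z ,
      each-all P {λ a → isNb a ≡ false} (λ t z q → other _ t z q) t (suc z) (all-numeral (λ _ → refl) refl p)

    each-nums : ∀ {n} (ps : Vec ℕ n) vs t z → (∀ {x} → x ∈ zipVals ps vs → Number x) → Each P (nums ps vs) t z
    each-nums []       []       t z h = tt
    each-nums (p ∷ ps) (v ∷ vs) t z h = each-++ P (Nb v ∷ numeral p)
      (each-number p v (nums ps vs ++ t) z (h (here refl))) (each-nums ps vs t _ (h ∘ there))

  -- Since `other` settles all letters except `Nb`, only the variable occurrences remain, and they
  -- are listed by `values`.
  each-values : ∀ {φ} (α : Ann φ) t z → (∀ {x} → x ∈ values α → Number x) → Each P (flat α) t z
  each-values (var {p} b v) t z h = other _ _ z refl , each-number p v t (suc z) (h (here refl))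
  each-values (nvar {p} b v) t z h = other _ _ z refl , each-number p v t (suc z) (h (here refl))
  each-values (and b α β) t z h = other _ _ z refl ,
    each-++ P (flat α) (each-values α (flat β ++ t) (suc z) (h ∘ ∈-++⁺ˡ)) (each-values β t _ (h ∘ ∈-++⁺ʳ (values α)))
  each-values (or b α β) t z h = other _ _ z refl ,
    each-++ P (flat α) (each-values α (flat β ++ t) (suc z) (h ∘ ∈-++⁺ˡ)) (each-values β t _ (h ∘ ∈-++⁺ʳ (values α)))
  each-values (incl {ps = ps} {qs} b us vs) t z h = other _ _ z refl ,
    each-++ P (nums ps us) (each-nums ps us _ (suc z) (h ∘ ∈-++⁺ˡ))
      (other _ _ _ refl , each-++ P (nums qs vs) (each-nums qs vs _ _ (h ∘ ∈-++⁺ʳ (zipVals ps us)))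
        (other _ _ _ refl , tt))
  each-values (box b α) t z h = other _ _ z refl , each-values α t (suc z) h
  each-values (dia b α) t z h = other _ _ z refl , each-values α t (suc z) h

zip-occurs : ∀ {n} (ps : Vec ℕ n) vs {p b} → (p , b) ∈ zipVals ps vs →
  ∃ λ u → ∃ λ v → nums ps vs ≡ u ++ Nb b ∷ numeral p ++ v
zip-occurs [] [] ()
zip-occurs (p ∷ ps) (b ∷ vs) (here refl) = [] , nums ps vs , refl
zip-occurs (p ∷ ps) (b ∷ vs) (there mem) with zip-occurs ps vs mem
... | u , v , eq = Nb b ∷ numeral p ++ u , v ,
  cong (Nb b ∷_) (trans (cong (numeral p ++_) eq) (sym (++-assoc (numeral p) u _)))

occurs-left : ∀ (u w v : List Letter) {x z} a → x ≡ u ++ a ∷ w ++ v → x ++ z ≡ u ++ a ∷ w ++ (v ++ z)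
occurs-left u w v {z = z} a refl = trans (++-assoc u (a ∷ w ++ v) z) (cong (λ s → u ++ a ∷ s) (++-assoc w v z))

value-occurs : ∀ {φ} (α : Ann φ) {p b} → (p , b) ∈ values α → ∃ λ u → ∃ λ v → flat α ≡ u ++ Nb b ∷ numeral p ++ v
value-occurs (var {p} b v)  (here refl) = Var b ∷ [] , [] , cong (λ s → Var b ∷ Nb v ∷ s) (sym (++-identityʳ _))
value-occurs (nvar {p} b v) (here refl) = Nvar b ∷ [] , [] , cong (λ s → Nvar b ∷ Nb v ∷ s) (sym (++-identityʳ _))
value-occurs (and b α β) {p} {c} mem with ∈-++⁻ (values α) mem
... | inj₁ m with value-occurs α m
...   | u , v , eq = And b ∷ u , v ++ flat β , cong (And b ∷_) (occurs-left u (numeral p) v (Nb c) eq)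
value-occurs (and b α β) {p} {c} mem | inj₂ m with value-occurs β m
...   | u , v , eq = And b ∷ flat α ++ u , v , cong (And b ∷_) (trans (cong (flat α ++_) eq) (sym (++-assoc (flat α) u _)))
value-occurs (or b α β) {p} {c} mem with ∈-++⁻ (values α) mem
... | inj₁ m with value-occurs α m
...   | u , v , eq = Or b ∷ u , v ++ flat β , cong (Or b ∷_) (occurs-left u (numeral p) v (Nb c) eq)
value-occurs (or b α β) {p} {c} mem | inj₂ m with value-occurs β m
...   | u , v , eq = Or b ∷ flat α ++ u , v , cong (Or b ∷_) (trans (cong (flat α ++_) eq) (sym (++-assoc (flat α) u _)))
value-occurs (incl {ps = ps} {qs} b us vs) {p} {c} mem with ∈-++⁻ (zipVals ps us) mem
... | inj₁ m with zip-occurs ps us m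
...   | u , v , eq = Incl b ∷ u , v ++ Mid ∷ nums qs vs ++ Mid ∷ [] , cong (Incl b ∷_) (occurs-left u (numeral p) v (Nb c) eq)
value-occurs (incl {ps = ps} {qs} b us vs) {p} {c} mem | inj₂ m with zip-occurs qs vs m
...   | u , v , eq = Incl b ∷ nums ps us ++ Mid ∷ u , v ++ Mid ∷ [] , cong (Incl b ∷_)
        (trans (cong (λ s → nums ps us ++ Mid ∷ s) (occurs-left u (numeral p) v (Nb c) eq)) (sym (++-assoc (nums ps us) (Mid ∷ u) _)))
value-occurs (box b α) mem with value-occurs α mem
... | u , v , eq = Box b (root α) ∷ u , v , cong (Box b (root α) ∷_) eq
value-occurs (dia b α) mem with value-occurs α mem
... | u , v , eq = Dia b (root α) ∷ u , v , cong (Dia b (root α) ∷_) eq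

-- Where a subformula occurrence lies in the notation of the whole formula.
record Context {φ ψ} (π : Ann φ → Ann ψ) : Set where
  field
    before after : Ann φ → List Letter
    decompose    : ∀ α → flat α ≡ before α ++ flat (π α) ++ after α
    aligned      : ∀ α β → length (before α) ≡ length (before β)

context-id : ∀ {φ} → Context {φ} id
context-id = record { before = λ _ → [] ; after = λ _ → [] ; decompose = λ α → sym (++-identityʳ _) ; aligned = λ _ _ → refl }

infixr 9 _∘ᶜ_
_∘ᶜ_ : ∀ {φ ψ χ} {π' : Ann ψ → Ann χ} {π : Ann φ → Ann ψ} → Context π' → Context π → Context (π' ∘ π)
_∘ᶜ_ {π' = π'} {π} c' c = record
  { before    = λ α → C.before α ++ C'.before (π α)
  ; after     = λ α → C'.after (π α) ++ C.after α
  ; decompose = λ α → trans (C.decompose α) (trans (cong (λ s → C.before α ++ s ++ C.after α) (C'.decompose (π α)))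
      (trans (cong (C.before α ++_) (trans (++-assoc (C'.before (π α)) _ (C.after α))
        (cong (C'.before (π α) ++_) (++-assoc (flat (π' (π α))) (C'.after (π α)) (C.after α)))))
      (sym (++-assoc (C.before α) (C'.before (π α)) _))))
  ; aligned   = λ α β → length-++-cong (C.before α) (C.before β) (C.aligned α β) (C'.aligned (π α) (π β))
  }
  where
  module C = Context c
  module C' = Context c'

context-and₁ : ∀ {φ ψ} → Context (and₁ {φ} {ψ})
context-and₁ = record { before = λ α → And (root α) ∷ [] ; after = λ α → flat (and₂ α)
  ; decompose = λ { (and _ _ _) → refl } ; aligned = λ _ _ → refl }

context-and₂ : ∀ {φ ψ} → Context (and₂ {φ} {ψ})
context-and₂ = record { before = λ α → And (root α) ∷ flat (and₁ α) ; after = λ α → []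
  ; decompose = λ { (and b α β) → cong (λ s → And b ∷ flat α ++ s) (sym (++-identityʳ (flat β))) }
  ; aligned = λ α β → cong suc (length-flat (and₁ α) (and₁ β)) }

context-or₁ : ∀ {φ ψ} → Context (or₁ {φ} {ψ})
context-or₁ = record { before = λ α → Or (root α) ∷ [] ; after = λ α → flat (or₂ α)
  ; decompose = λ { (or _ _ _) → refl } ; aligned = λ _ _ → refl }

context-or₂ : ∀ {φ ψ} → Context (or₂ {φ} {ψ})
context-or₂ = record { before = λ α → Or (root α) ∷ flat (or₁ α) ; after = λ α → []
  ; decompose = λ { (or b α β) → cong (λ s → Or b ∷ flat α ++ s) (sym (++-identityʳ (flat β))) }
  ; aligned = λ α β → cong suc (length-flat (or₁ α) (or₁ β)) }

context-box : ∀ {ψ} → Context (unbox {ψ})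
context-box = record { before = λ α → Box (root α) (root (unbox α)) ∷ [] ; after = λ α → []
  ; decompose = λ { (box b α) → cong (Box b (root α) ∷_) (sym (++-identityʳ (flat α))) } ; aligned = λ _ _ → refl }

context-dia : ∀ {ψ} → Context (undia {ψ})
context-dia = record { before = λ α → Dia (root α) (root (undia α)) ∷ [] ; after = λ α → []
  ; decompose = λ { (dia b α) → cong (Dia b (root α) ∷_) (sym (++-identityʳ (flat α))) } ; aligned = λ _ _ → refl }

-- Compatibility letter by letter

-- A box letter also carries the bit of its argument, so the condition that a box imposes on an edge
-- concerns two letters at the same position.
ok : Letter → Letter → Bool
ok (Box true _) (Box _ c) = c
ok _            _         = true

Ok : Letter → Letter → Set
Ok a b = ok a b ≡ true

pointwise-split : ∀ {R : Letter → Letter → Set} u {u' v v'} → length u ≡ length u' → Pointwise R (u ++ v) (u' ++ v') →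
  Pointwise R u u' × Pointwise R v v'
pointwise-split []      {[]}     len pw = [] , pw
pointwise-split (x ∷ u) {y ∷ u'} len (r ∷ pw) with pointwise-split u {u'} (suc-injective len) pw
... | p , q = r ∷ p , q

pointwise-all : ∀ {R : Letter → Letter → Set} {u v} → All (λ a → ∀ b → R a b) u → length u ≡ length v → Pointwise R u v
pointwise-all {v = []}    []       len = []
pointwise-all {v = _ ∷ _} (r ∷ rs) len = r _ ∷ pointwise-all rs (suc-injective len)

ok-nums : ∀ {n} (ps : Vec ℕ n) us vs → Pointwise Ok (nums ps us) (nums ps vs)
ok-nums ps us vs = pointwise-all (all-nums (λ _ _ → refl) (λ _ → refl) (λ _ _ → refl) ps us) (length-nums ps us vs)

compat→ok : ∀ {φ} (α β : Ann φ) → Compat α β → Pointwise Ok (flat α) (flat β)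
compat→ok (var {p} b v) (var _ _) c =
  pointwise-all ((λ _ → refl) ∷ (λ _ → refl) ∷ all-numeral (λ _ _ → refl) (λ _ → refl) p) refl
compat→ok (nvar {p} b v) (nvar _ _) c =
  pointwise-all ((λ _ → refl) ∷ (λ _ → refl) ∷ all-numeral (λ _ _ → refl) (λ _ → refl) p) refl
compat→ok (and _ α β) (and _ α' β') (c , c') = refl ∷ Pointwise.++⁺ (compat→ok α α' c) (compat→ok β β' c')
compat→ok (or _ α β) (or _ α' β') (c , c') = refl ∷ Pointwise.++⁺ (compat→ok α α' c) (compat→ok β β' c')
compat→ok (incl {ps = ps} {qs} _ us vs) (incl _ us' vs') c =
  refl ∷ Pointwise.++⁺ (ok-nums ps us us') (refl ∷ Pointwise.++⁺ (ok-nums qs vs vs') (refl ∷ []))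
compat→ok (box true α) (box _ β) (h , c)  = h refl ∷ compat→ok α β c
compat→ok (box false α) (box _ β) (h , c) = refl ∷ compat→ok α β c
compat→ok (dia _ α) (dia _ β) c = refl ∷ compat→ok α β c

ok→compat : ∀ {φ} (α β : Ann φ) → Pointwise Ok (flat α) (flat β) → Compat α β
ok→compat (var _ _)  (var _ _)  pw = tt
ok→compat (nvar _ _) (nvar _ _) pw = tt
ok→compat (and _ α β) (and _ α' β') (_ ∷ pw) with pointwise-split (flat α) {flat α'} (length-flat α α') pw
... | p , q = ok→compat α α' p , ok→compat β β' q
ok→compat (or _ α β) (or _ α' β') (_ ∷ pw) with pointwise-split (flat α) {flat α'} (length-flat α α') pw
... | p , q = ok→compat α α' p , ok→compat β β' q
ok→compat (incl _ _ _) (incl _ _ _) pw = tt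
ok→compat (box true α) (box _ β) (r ∷ pw)  = (λ _ → r) , ok→compat α β pw
ok→compat (box false α) (box _ β) (r ∷ pw) = (λ ()) , ok→compat α β pw
ok→compat (dia _ α) (dia _ β) (_ ∷ pw) = ok→compat α β pw

-- Lengths of formulas and of their types

length-numToks : ∀ p → length (numToks p) ≡ length (numeral p)
length-numToks p = trans (length-++ (digitsᵇ (ℕᵇ.fromℕ p))) (trans (cong (_+ 1)
  (trans (cong length (digitsᵇ-digs (ℕᵇ.fromℕ p))) (trans (length-map digitTok (digits p)) (sym (length-map Dig (digits p))))))
  (sym (length-++ (List.map Dig (digits p)))))

length-nums-toks : ∀ {n} (ps : Vec ℕ n) vs → length (nums ps vs) ≡ n + length (vecToks ps)
length-nums-toks []       []       = refl
length-nums-toks {suc n} (p ∷ ps) (v ∷ vs) = cong suc (trans (length-++ (numeral p))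
  (trans (cong₂ _+_ (sym (length-numToks p)) (length-nums-toks ps vs))
  (trans (swap (length (numToks p)) n (length (vecToks ps))) (cong (n +_) (sym (length-++ (numToks p)))))))
  where
  swap : ∀ a b c → a + (b + c) ≡ b + (a + c)
  swap = RingSolver.solve-∀

numToks-≥1 : ∀ p → 1 ≤ length (numToks p)
numToks-≥1 p = ≤-trans (m≤n+m 1 _) (≤-reflexive (sym (length-++ (digitsᵇ (ℕᵇ.fromℕ p)))))

vecToks-≥ : ∀ {n} (ps : Vec ℕ n) → n ≤ length (vecToks ps)
vecToks-≥ []       = z≤n
vecToks-≥ (p ∷ ps) = ≤-trans (+-mono-≤ (numToks-≥1 p) (vecToks-≥ ps)) (≤-reflexive (sym (length-++ (numToks p))))

private
  tokens : Fml → ℕ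
  tokens φ = length (fmlToks φ)

  tokens-incl : ∀ k (ps qs : Vec ℕ (suc k)) →
    2 + (length (vecToks ps) + length (vecToks qs)) ≤ tokens (incl k ps qs)
  tokens-incl k ps qs = s≤s (≤-trans (+-mono-≤ (numToks-≥1 k) (≤-reflexive (sym (length-++ (vecToks ps)))))
    (≤-reflexive (sym (length-++ (numToks k)))))

annBits-tokens : ∀ φ → annBits φ ≤ tokens φ
annBits-tokens (var p)  = s≤s (numToks-≥1 p)
annBits-tokens (nvar p) = s≤s (numToks-≥1 p)
annBits-tokens (φ ∧ᵐ ψ) = s≤s (≤-trans (+-mono-≤ (annBits-tokens φ) (annBits-tokens ψ)) (≤-reflexive (sym (length-++ (fmlToks φ)))))
annBits-tokens (φ ∨ᵐ ψ) = s≤s (≤-trans (+-mono-≤ (annBits-tokens φ) (annBits-tokens ψ)) (≤-reflexive (sym (length-++ (fmlToks φ)))))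
annBits-tokens (incl k ps qs) = ≤-trans (s≤s (≤-trans (+-mono-≤ (vecToks-≥ ps) (vecToks-≥ qs)) (n≤1+n _))) (tokens-incl k ps qs)
annBits-tokens (□ᵐ φ) = s≤s (annBits-tokens φ)
annBits-tokens (◇ᵐ φ) = s≤s (annBits-tokens φ)

private
  atom-tokens : ∀ p → 2 + length (numeral p) ≤ 2 * suc (length (numToks p))
  atom-tokens p rewrite length-numToks p =
    ≤-trans (+-monoʳ-≤ 2 (m≤m+n _ (length (numeral p) + 0))) (≤-reflexive (ring (length (numeral p))))
    where
    ring : ∀ n → 2 + (n + (n + 0)) ≡ 2 * suc n
    ring = RingSolver.solve-∀

  unary-tokens : ∀ {m n} → m ≤ 2 * n → suc m ≤ 2 * suc n
  unary-tokens {m} {n} le = ≤-trans (s≤s (≤-trans le (n≤1+n _))) (≤-reflexive (ring n))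
    where
    ring : ∀ n → 2 + 2 * n ≡ 2 * suc n
    ring = RingSolver.solve-∀

  binary-tokens : ∀ (u v : List Letter) φ ψ → length u ≤ 2 * tokens φ → length v ≤ 2 * tokens ψ →
    suc (length (u ++ v)) ≤ 2 * suc (length (fmlToks φ ++ fmlToks ψ))
  binary-tokens u v φ ψ p q rewrite length-++ u {v} | length-++ (fmlToks φ) {fmlToks ψ} =
    unary-tokens (≤-trans (+-mono-≤ p q) (≤-reflexive (sym (*-distribˡ-+ 2 (tokens φ) (tokens ψ)))))

-- Numbers are preceded by a truth value and vectors are closed by `Mid`. Every number has at least
-- one token, so a factor of two covers these letters.
flat-tokens : ∀ {φ} (α : Ann φ) → length (flat α) ≤ 2 * tokens φ
flat-tokens (var {p} b v)       = atom-tokens p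
flat-tokens (nvar {p} b v)      = atom-tokens p
flat-tokens (and {φ} {ψ} b α β) = binary-tokens (flat α) (flat β) φ ψ (flat-tokens α) (flat-tokens β)
flat-tokens (or {φ} {ψ} b α β)  = binary-tokens (flat α) (flat β) φ ψ (flat-tokens α) (flat-tokens β)
flat-tokens (box b α)           = unary-tokens (flat-tokens α)
flat-tokens (dia b α)           = unary-tokens (flat-tokens α)
flat-tokens (incl {k} {ps} {qs} b us vs) = begin
  suc (length (nums ps us ++ Mid ∷ nums qs vs ++ Mid ∷ []))
    ≡⟨ cong suc (trans (length-++ (nums ps us)) (cong₂ (λ m n → m + suc n) (length-nums-toks ps us)
         (trans (length-++ (nums qs vs)) (cong (_+ 1) (length-nums-toks qs vs))))) ⟩
  suc (suc k + m + suc (suc k + n + 1))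
    ≤⟨ s≤s (+-mono-≤ (+-monoˡ-≤ m (vecToks-≥ ps)) (s≤s (+-monoˡ-≤ 1 (+-monoˡ-≤ n (vecToks-≥ qs))))) ⟩
  suc (m + m + suc (n + n + 1))       ≤⟨ n≤1+n _ ⟩
  2 + (m + m + suc (n + n + 1))       ≡⟨ ring m n ⟩
  2 * (2 + (m + n))                   ≤⟨ *-monoʳ-≤ 2 (tokens-incl k ps qs) ⟩
  2 * tokens (incl k ps qs) ∎
  where
  open ≤-Reasoning
  m = length (vecToks ps)
  n = length (vecToks qs)
  ring : ∀ m n → 2 + (m + m + suc (n + n + 1)) ≡ 2 * (2 + (m + n))
  ring = RingSolver.solve-∀

length-encode : ∀ φ → length (encode φ) ≡ 4 * tokens φ
length-encode φ = go (fmlToks φ)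
  where
  four : ∀ t → length (tokBits t) ≡ 4
  four tVAR  = refl
  four tNVAR = refl
  four tAND  = refl
  four tOR   = refl
  four tINCL = refl
  four tBOX  = refl
  four tDIA  = refl
  four tD0   = refl
  four tD1   = refl
  four tEND  = refl
  go : ∀ ts → length (concatMap tokBits ts) ≡ 4 * length ts
  go []       = refl
  go (t ∷ ts) = trans (length-++ (tokBits t)) (trans (cong₂ _+_ (four t) (go ts)) (sym (*-suc 4 (length ts))))

annBits-encode : ∀ φ → annBits φ ≤ length (encode φ)
annBits-encode φ = ≤-trans (annBits-tokens φ) (≤-trans (m≤n*m (tokens φ) 4) (≤-reflexive (sym (length-encode φ))))

flat-encode : ∀ {φ} (α : Ann φ) → length (flat α) ≤ length (encode φ)
flat-encode {φ} α = ≤-trans (flat-tokens α) (≤-trans (*-monoˡ-≤ (tokens φ) (m≤m+n 2 2)) (≤-reflexive (sym (length-encode φ))))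

-- The program: reading a type

-- Tests nest three deep: block tests on level 1, what they run at each position (`value`,
-- `queries`) on level 2, and the comparisons with a second position or block on level 3.
open Language Letter 10 4

-- Stack names: X and W hold the blocks not yet checked, Y all blocks, J the input word, I its
-- reversal, S the membership bits of the subformulas to be read, C, D and U binary counters, and Z
-- a position or a number in unary.
pattern X = 0F
pattern W = 1F
pattern Y = 2F
pattern I = 3F
pattern J = 4F
pattern S = 5F
pattern C = 6F
pattern D = 7F
pattern U = 8F
pattern Z = 9F

pattern st x w y i j s c d u z =
  x Vec.∷ w Vec.∷ y Vec.∷ i Vec.∷ j Vec.∷ s Vec.∷ c Vec.∷ d Vec.∷ u Vec.∷ z Vec.∷ Vec.[]

run : ∀ {ℓ} → Cmd ℓ → (Stacks → Set) → Stacks → Set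
run = wp (λ _ → ⊤)

variable
  ℓ : Fin 4
  N : ℕ
  k : Stacks → Set
  x w y i j s c d u z : List Letter

pickBit : (Bool → Cmd ℓ) → Cmd ℓ
pickBit = pick finite-Bool

opaque
  readTok : Tok → Cmd ℓ
  readTok t = go (tokBits t)
    where
    go : List Bool → Cmd ℓ
    go []       = guard true
    go (b ∷ bs) = pop J (Bit b) ⨾ go bs

readDigit : Fin 10 → Cmd ℓ
readDigit r = pickBit λ e → pop r (Dig e) ⨾ readTok (digitTok e)

opaque
  numeralᶜ : Cmd ℓ
  numeralᶜ = loop (readDigit X) ⨾ pop X End ⨾ readTok tEND

opaque
  number : (Bool → Bool) → Cmd ℓ
  number P = pickBit λ v → guard (P v) ⨾ pop X (Nb v) ⨾ numeralᶜ

-- Decrementing in bijective base two turns low ones into twos, kept on `U`, until a two becomes a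
-- one or the one in the highest place vanishes; then the twos are put back.
borrow restore : Cmd ℓ
borrow  = pop D (Dig false) ⨾ push U (Dig true)
restore = pop U (Dig true) ⨾ push D (Dig true)

subtract : Bool → Cmd ℓ
subtract true  = pop D (Dig true) ⨾ push D (Dig false)
subtract false = pop D (Dig false) ⨾ isNil D

opaque
  decrement : Cmd ℓ
  decrement = loop borrow ⨾ pickBit subtract ⨾ loop restore ⨾ isNil U

guessDigit : Cmd ℓ
guessDigit = pickBit λ e → push C (Dig e) ⨾ push D (Dig e)

opaque
  -- The input gives the low digit first, so pushing digits as they are read would leave the high
  -- digit on top, the wrong end for `decrement`. The number is therefore guessed twice over and the
  -- copy in `C` compared with the input.
  arity : Cmd ℓ
  arity = loop guessDigit ⨾ loop (readDigit C) ⨾ isNil C ⨾ readTok tEND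

opaque
  anyNumber : Cmd ℓ
  anyNumber = number (λ _ → true)

-- For arity `k` there are `k + 1` numbers on each side; the first is read before the loop. The
-- ticks preserve `k` for the right-hand side, as the left-hand side uses up the counter.
lhsStep rhsStep : Cmd ℓ
lhsStep = decrement ⨾ push Z Tick ⨾ anyNumber
rhsStep = pop Z Tick ⨾ anyNumber

opaque
  lhsNumbers : Cmd ℓ
  lhsNumbers = anyNumber ⨾ loop lhsStep ⨾ isNil D ⨾ pop X Mid

opaque
  rhsNumbers : Cmd ℓ
  rhsNumbers = anyNumber ⨾ loop rhsStep ⨾ isNil Z ⨾ pop X Mid

opaque
  -- A case consumes the letters of one node from the block and its tokens from the input, and
  -- leaves on `S` the bits that the arguments must carry.
  nodeCase : Fin 7 → Bool → Cmd ℓ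
  nodeCase 0F b = pop X (Var b) ⨾ readTok tVAR ⨾ number (λ v → not b ∨ v)
  nodeCase 1F b = pop X (Nvar b) ⨾ readTok tNVAR ⨾ number (λ v → not (b ∧ v))
  nodeCase 2F b = pop X (And b) ⨾ readTok tAND ⨾ push S (Bit b) ⨾ push S (Bit b)
  nodeCase 3F b = pop X (Or b) ⨾ readTok tOR ⨾
    -- The bit of the left argument is pushed last because that argument is read first.
    pickBit λ c → pickBit λ c' → guard (split b c c') ⨾ push S (Bit c') ⨾ push S (Bit c)
  nodeCase 4F b = pop X (Incl b) ⨾ readTok tINCL ⨾ arity ⨾ lhsNumbers ⨾ rhsNumbers
  nodeCase 5F b = pickBit λ c → pop X (Box b c) ⨾ readTok tBOX ⨾ push S (Bit c)
  nodeCase 6F b = pickBit λ c → pop X (Dia b c) ⨾ readTok tDIA ⨾ push S (Bit c)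

opaque
  node : Cmd ℓ
  node = pickBit λ b → pop S (Bit b) ⨾ pick (finite-Fin 7) (λ κ → nodeCase κ b)

opaque
  -- Block and input are read together, so one pass checks that the block annotates the encoded
  -- formula and that it is locally correct.
  parse : Cmd ℓ
  parse = pickBit (λ b → push S (Bit b)) ⨾ loop node ⨾ pop X Sep ⨾ isNil J ⨾ isNil S

-- Correctness of reading

prefix≤ : ∀ {A : Set} (u : List A) {v} → length (u ++ v) ≤ N → length u ≤ N
prefix≤ u le = ≤-trans (≤-trans (m≤m+n _ _) (≤-reflexive (sym (length-++ u)))) le

suffix≤ : ∀ {A : Set} (u : List A) {v} → length (u ++ v) ≤ N → length v ≤ N
suffix≤ u le = ≤-trans (≤-trans (m≤n+m _ (length u)) (≤-reflexive (sym (length-++ u)))) le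

opaque
  unfolding readTok

  readTok-sound : ∀ t → run (readTok {ℓ} t) k (st x w y i j s c d u z) →
    ∃ λ j' → j ≡ toBits (t ∷ []) ++ j' × k (st x w y i j' s c d u z)
  readTok-sound tVAR  (j' , refl , _ , refl , _ , refl , _ , refl , _ , p) = _ , refl , p
  readTok-sound tNVAR (j' , refl , _ , refl , _ , refl , _ , refl , _ , p) = _ , refl , p
  readTok-sound tAND  (j' , refl , _ , refl , _ , refl , _ , refl , _ , p) = _ , refl , p
  readTok-sound tOR   (j' , refl , _ , refl , _ , refl , _ , refl , _ , p) = _ , refl , p
  readTok-sound tINCL (j' , refl , _ , refl , _ , refl , _ , refl , _ , p) = _ , refl , p
  readTok-sound tBOX  (j' , refl , _ , refl , _ , refl , _ , refl , _ , p) = _ , refl , p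
  readTok-sound tDIA  (j' , refl , _ , refl , _ , refl , _ , refl , _ , p) = _ , refl , p
  readTok-sound tD0   (j' , refl , _ , refl , _ , refl , _ , refl , _ , p) = _ , refl , p
  readTok-sound tD1   (j' , refl , _ , refl , _ , refl , _ , refl , _ , p) = _ , refl , p
  readTok-sound tEND  (j' , refl , _ , refl , _ , refl , _ , refl , _ , p) = _ , refl , p

  readTok-complete : ∀ t {j'} → j ≡ toBits (t ∷ []) ++ j' → k (st x w y i j' s c d u z) →
    wp (_≤ N) (readTok {ℓ} t) k (st x w y i j s c d u z)
  readTok-complete tVAR  refl p = _ , refl , _ , refl , _ , refl , _ , refl , refl , p
  readTok-complete tNVAR refl p = _ , refl , _ , refl , _ , refl , _ , refl , refl , p
  readTok-complete tAND  refl p = _ , refl , _ , refl , _ , refl , _ , refl , refl , p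
  readTok-complete tOR   refl p = _ , refl , _ , refl , _ , refl , _ , refl , refl , p
  readTok-complete tINCL refl p = _ , refl , _ , refl , _ , refl , _ , refl , refl , p
  readTok-complete tBOX  refl p = _ , refl , _ , refl , _ , refl , _ , refl , refl , p
  readTok-complete tDIA  refl p = _ , refl , _ , refl , _ , refl , _ , refl , refl , p
  readTok-complete tD0   refl p = _ , refl , _ , refl , _ , refl , _ , refl , refl , p
  readTok-complete tD1   refl p = _ , refl , _ , refl , _ , refl , _ , refl , refl , p
  readTok-complete tEND  refl p = _ , refl , _ , refl , _ , refl , _ , refl , refl , p

toBits-step : ∀ ts us {j'} → toBits ts ++ (toBits us ++ j') ≡ toBits (ts ++ us) ++ j'
toBits-step ts us = trans (sym (++-assoc (toBits ts) (toBits us) _)) (cong (_++ _) (sym (toBits-++ ts us)))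

numToks-digits : ∀ p → numToks p ≡ List.map digitTok (digits p) ++ tEND ∷ []
numToks-digits p = cong (_++ tEND ∷ []) (digitsᵇ-digs (ℕᵇ.fromℕ p))

opaque
  unfolding numeralᶜ number anyNumber

  numeral-sound : run (numeralᶜ {ℓ}) k (st x w y i j s c d u z) →
    ∃ λ p → ∃ λ x' → ∃ λ j' → x ≡ numeral p ++ x' × j ≡ toBits (numToks p) ++ j' × k (st x' w y i j' s c d u z)
  numeral-sound {ℓ} {k} {x} {w} {y} {i} {j} {s} {c} {d} {u} {z} (n , _ , p) with go n x j p
    where
    go : ∀ n x j → iterate (run (readDigit {ℓ} X)) n (run (pop {ℓ} X End ⨾ readTok {ℓ} tEND) k) (st x w y i j s c d u z) →
      ∃ λ ds → ∃ λ x' → ∃ λ j' → x ≡ List.map Dig ds ++ End ∷ x' × j ≡ toBits (List.map digitTok ds) ++ toBits (tEND ∷ []) ++ j'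
        × k (st x' w y i j' s c d u z)
    go zero    x j (x' , refl , p) with readTok-sound tEND p
    ... | j' , refl , q = [] , x' , j' , refl , refl , q
    go (suc n) x j (e , x₁ , refl , p) with readTok-sound (digitTok e) p
    ... | j₁ , refl , q with go n x₁ j₁ q
    ... | ds , x' , j' , refl , refl , r = e ∷ ds , x' , j' , refl , toBits-step (digitTok e ∷ []) (List.map digitTok ds) , r
  ... | ds , x' , j' , refl , refl , q with digits-surjective ds
  ... | p , refl = p , x' , j' , sym (++-assoc (List.map Dig (digits p)) (End ∷ []) x') ,
    trans (toBits-step (List.map digitTok (digits p)) (tEND ∷ [])) (cong (λ ts → toBits ts ++ j') (sym (numToks-digits p))) , q

  numeral-complete : ∀ p {x' j'} → length (digits p) ≤ N → x ≡ numeral p ++ x' → j ≡ toBits (numToks p) ++ j' →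
    k (st x' w y i j' s c d u z) → wp (_≤ N) (numeralᶜ {ℓ}) k (st x w y i j s c d u z)
  numeral-complete {N} {x} {j} {k} {w} {y} {i} {s} {c} {d} {u} {z} {ℓ} p {x'} {j'} le eq eq' q =
    length (digits p) , le , go (digits p) x j (trans eq (++-assoc (List.map Dig (digits p)) (End ∷ []) x'))
      (trans eq' (trans (cong (λ ts → toBits ts ++ j') (numToks-digits p)) (sym (toBits-step (List.map digitTok (digits p)) (tEND ∷ [])))))
    where
    go : ∀ ds x j → x ≡ List.map Dig ds ++ End ∷ x' → j ≡ toBits (List.map digitTok ds) ++ toBits (tEND ∷ []) ++ j' →
      iterate (wp (_≤ N) (readDigit {ℓ} X)) (length ds) (wp (_≤ N) (pop {ℓ} X End ⨾ readTok {ℓ} tEND) k) (st x w y i j s c d u z)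
    go []       x j refl eq = x' , refl , readTok-complete tEND eq q
    go (e ∷ ds) x j refl eq = e , _ , refl , readTok-complete (digitTok e)
      (trans eq (sym (toBits-step (digitTok e ∷ []) (List.map digitTok ds)))) (go ds _ _ refl refl)

  number-sound : ∀ P → run (number {ℓ} P) k (st x w y i j s c d u z) →
    ∃ λ v → ∃ λ p → ∃ λ x' → ∃ λ j' → P v ≡ true × x ≡ Nb v ∷ numeral p ++ x' × j ≡ toBits (numToks p) ++ j'
      × k (st x' w y i j' s c d u z)
  number-sound P (v , t , _ , refl , q) with numeral-sound q
  ... | p , x' , j' , refl , refl , r = v , p , x' , j' , t , refl , refl , r

  number-complete : ∀ P v p {x' j'} → P v ≡ true → length (digits p) ≤ N → x ≡ Nb v ∷ numeral p ++ x' →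
    j ≡ toBits (numToks p) ++ j' → k (st x' w y i j' s c d u z) → wp (_≤ N) (number {ℓ} P) k (st x w y i j s c d u z)
  number-complete P v p t le refl eq q = v , t , _ , refl , numeral-complete p le refl eq q

  anyNumber-sound : run (anyNumber {ℓ}) k (st x w y i j s c d u z) →
    ∃ λ v → ∃ λ p → ∃ λ x' → ∃ λ j' → x ≡ Nb v ∷ numeral p ++ x' × j ≡ toBits (numToks p) ++ j'
      × k (st x' w y i j' s c d u z)
  anyNumber-sound q with number-sound (λ _ → true) q
  ... | v , p , x' , j' , _ , rest = v , p , x' , j' , rest

  anyNumber-complete : ∀ v p {x' j'} → length (digits p) ≤ N → x ≡ Nb v ∷ numeral p ++ x' →
    j ≡ toBits (numToks p) ++ j' → k (st x' w y i j' s c d u z) → wp (_≤ N) (anyNumber {ℓ}) k (st x w y i j s c d u z)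
  anyNumber-complete v p = number-complete (λ _ → true) v p refl

replicate-shift : ∀ {A : Set} n (a : A) {as} → List.replicate n a ++ a ∷ as ≡ a ∷ List.replicate n a ++ as
replicate-shift zero    a = refl
replicate-shift (suc n) a = cong (a ∷_) (replicate-shift n a)

inc-carry : ∀ n ds → inc (List.replicate n true ++ ds) ≡ List.replicate n false ++ inc ds
inc-carry zero    ds = refl
inc-carry (suc n) ds = cong (false ∷_) (inc-carry n ds)

-- The low twos of `ds` are what an increment turns into ones; their number tells how often
-- `decrement` borrows.
carry : ∀ ds → ∃ λ n → ds ≡ List.replicate n true ⊎ ∃ λ es → ds ≡ List.replicate n true ++ false ∷ es
carry []           = 0 , inj₁ refl
carry (false ∷ ds) = 0 , inj₂ (ds , refl)
carry (true ∷ ds) with carry ds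
... | n , inj₁ eq        = suc n , inj₁ (cong (true ∷_) eq)
... | n , inj₂ (es , eq) = suc n , inj₂ (es , cong (true ∷_) eq)

opaque
  unfolding decrement

  private
    ones : ℕ → List Letter
    ones n = List.replicate n (Dig true)

  decrement-sound : ∀ ds → run (decrement {ℓ}) k (st x w y i j s c (List.map Dig ds) [] z) →
    ∃ λ ds' → ds ≡ inc ds' × k (st x w y i j s c (List.map Dig ds') [] z)
  decrement-sound {ℓ} {k} {x} {w} {y} {i} {j} {s} {c} {z} ds (n , _ , p) with borrowed n ds 0 p
    where
    borrowed : ∀ n ds q {k'} → iterate (run (borrow {ℓ})) n k' (st x w y i j s c (List.map Dig ds) (ones q) z) →
      ∃ λ m → ∃ λ es → ds ≡ List.replicate m false ++ es × k' (st x w y i j s c (List.map Dig es) (ones (m + q)) z)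
    borrowed zero    ds q p = 0 , ds , refl , p
    borrowed (suc n) (e ∷ ds) q {k'} (_ , refl , p) with borrowed n ds (suc q) {k'} p
    ... | m , es , eq , r = suc m , es , cong (false ∷_) eq , subst (λ l → k' (st x w y i j s c (List.map Dig es) (ones l) z)) (+-suc m q) r
  ... | m , es , eq , r = finish es (m + 0) (+-identityʳ m) eq r
    where
    restored : ∀ n q es → iterate (run (restore {ℓ})) n (run (isNil {ℓ} U) k) (st x w y i j s c (List.map Dig es) (ones q) z) →
      k (st x w y i j s c (List.map Dig (List.replicate q true ++ es)) [] z)
    restored zero    zero    es (_ , p) = p
    restored (suc n) (suc q) es (_ , refl , p) =
      subst (λ es → k (st x w y i j s c (List.map Dig es) [] z)) (replicate-shift q true) (restored n q (true ∷ es) p)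
    finish : ∀ es q → q ≡ m → ds ≡ List.replicate m false ++ es →
      run (pickBit {ℓ} subtract ⨾ loop restore ⨾ isNil U) k
        (st x w y i j s c (List.map Dig es) (ones q) z) →
      ∃ λ ds' → ds ≡ inc ds' × k (st x w y i j s c (List.map Dig ds') [] z)
    finish (true ∷ es) q refl eq (true , _ , refl , n , _ , p) =
      List.replicate m true ++ false ∷ es , trans eq (sym (inc-carry m (false ∷ es))) , restored n m (false ∷ es) p
    finish (false ∷ []) q refl eq (false , _ , refl , refl , n , _ , p) =
      List.replicate m true ++ [] , trans eq (sym (inc-carry m [])) , restored n m [] p

  decrement-complete : ∀ ds → length ds ≤ N → d ≡ List.map Dig (inc ds) → k (st x w y i j s c (List.map Dig ds) [] z) →
    wp (_≤ N) (decrement {ℓ}) k (st x w y i j s c d [] z)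
  decrement-complete {N} {d} {k} {x} {w} {y} {i} {j} {s} {c} {z} {ℓ} ds le refl p with carry ds
  ... | n , form = n , bound form , borrowed n 0 (λ q eq → subtracted form q (trans eq (+-identityʳ n))) (inc-form form)
    where
    Form : Set
    Form = ds ≡ List.replicate n true ⊎ (∃ λ es → ds ≡ List.replicate n true ++ false ∷ es)
    bound : Form → n ≤ N
    bound (inj₁ refl) = ≤-trans (≤-reflexive (sym (length-replicate n))) le
    bound (inj₂ (es , refl)) = ≤-trans (≤-trans (≤-reflexive (sym (length-replicate n)))
      (≤-trans (m≤m+n _ _) (≤-reflexive (sym (length-++ (List.replicate n true)))))) le
    high : Form → List Bool
    high (inj₁ _)        = false ∷ []
    high (inj₂ (es , _)) = true ∷ es
    inc-form : (f : Form) → inc ds ≡ List.replicate n false ++ high f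
    inc-form (inj₁ refl)        = trans (cong inc (sym (++-identityʳ _))) (inc-carry n [])
    inc-form (inj₂ (es , refl)) = inc-carry n (false ∷ es)
    restored : ∀ q es → List.replicate q true ++ es ≡ ds →
      iterate (wp (_≤ N) (restore {ℓ})) q (wp (_≤ N) (isNil {ℓ} U) k) (st x w y i j s c (List.map Dig es) (ones q) z)
    restored zero    es refl = refl , p
    restored (suc q) es eq   = _ , refl , restored q (true ∷ es) (trans (replicate-shift q true) eq)
    subtracted : (f : Form) → ∀ q → q ≡ n → wp (_≤ N) (pickBit {ℓ} subtract ⨾ loop restore ⨾ isNil U) k
      (st x w y i j s c (List.map Dig (high f)) (ones q) z)
    subtracted f@(inj₁ eq) q refl = false , _ , refl , refl , q , bound f , restored q [] (trans (++-identityʳ _) (sym eq))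
    subtracted f@(inj₂ (es , eq)) q refl = true , _ , refl , q , bound f , restored q (false ∷ es) (sym eq)
    borrowed : ∀ m q {es ds} {k'} → (∀ q' → q' ≡ m + q → k' (st x w y i j s c (List.map Dig es) (ones q') z)) →
      ds ≡ List.replicate m false ++ es →
      iterate (wp (_≤ N) (borrow {ℓ})) m k' (st x w y i j s c (List.map Dig ds) (ones q) z)
    borrowed zero    q h refl = h q refl
    borrowed (suc m) q h refl = _ , refl , borrowed m (suc q) (λ q' eq → h q' (trans eq (+-suc m q))) refl

-- A stack is filled from the bottom, so the first letter of a guessed word is pushed by the last
-- iteration, whereas induction on the word handles it first.
iterate-snoc : ∀ {F k} n → iterate F n (F k) ≡ iterate F (suc n) k
iterate-snoc zero            = refl
iterate-snoc {F} (suc n) = cong F (iterate-snoc n)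

ticks : ℕ → List Letter
ticks n = List.replicate n Tick

opaque
  unfolding arity

  arity-sound : run (arity {ℓ}) k (st x w y i j s [] [] u z) →
    ∃ λ κ → ∃ λ j' → j ≡ toBits (numToks κ) ++ j' × k (st x w y i j' s [] (List.map Dig (digits κ)) u z)
  arity-sound {ℓ} {k} {x} {w} {y} {i} {j} {s} {u} {z} (n , _ , p) with guessed n [] p
    where
    guessed : ∀ n ds {k'} → iterate (run (guessDigit {ℓ})) n k' (st x w y i j s (List.map Dig ds) (List.map Dig ds) u z) →
      ∃ λ ds' → k' (st x w y i j s (List.map Dig ds') (List.map Dig ds') u z)
    guessed zero    ds p       = ds , p
    guessed (suc n) ds (e , p) = guessed n (e ∷ ds) p
  ... | ds , n' , _ , p' with digits-surjective ds
  ... | κ , refl with reads n' (digits κ) j p'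
    where
    reads : ∀ n ds j {d} → iterate (run (readDigit {ℓ} C)) n (run (isNil {ℓ} C ⨾ readTok {ℓ} tEND) k) (st x w y i j s (List.map Dig ds) d u z) →
      ∃ λ j' → j ≡ toBits (List.map digitTok ds) ++ toBits (tEND ∷ []) ++ j' × k (st x w y i j' s [] d u z)
    reads zero [] j (_ , p) = readTok-sound tEND p
    reads (suc n) (e ∷ ds) j (_ , _ , refl , p) with readTok-sound (digitTok e) p
    ... | j₁ , refl , q with reads n ds j₁ q
    ... | j' , refl , r = j' , toBits-step (digitTok e ∷ []) (List.map digitTok ds) , r
  ... | j' , refl , q = κ , j' , trans (toBits-step (List.map digitTok (digits κ)) (tEND ∷ []))
    (cong (λ ts → toBits ts ++ j') (sym (numToks-digits κ))) , q

  arity-complete : ∀ κ {j'} → length (digits κ) ≤ N → j ≡ toBits (numToks κ) ++ j' →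
    k (st x w y i j' s [] (List.map Dig (digits κ)) u z) → wp (_≤ N) (arity {ℓ}) k (st x w y i j s [] [] u z)
  arity-complete {N} {j} {k} {x} {w} {y} {i} {s} {u} {z} {ℓ} κ {j'} le eq p =
    length (digits κ) , le , guesses (digits κ) (length (digits κ) , le , reads (digits κ) j
      (trans eq (trans (cong (λ ts → toBits ts ++ j') (numToks-digits κ)) (sym (toBits-step (List.map digitTok (digits κ)) (tEND ∷ []))))))
    where
    guesses : ∀ ds {k'} → k' (st x w y i j s (List.map Dig ds) (List.map Dig ds) u z) →
      iterate (wp (_≤ N) (guessDigit {ℓ})) (length ds) k' (st x w y i j s [] [] u z)
    guesses []       p = p
    guesses (e ∷ ds) {k'} p = subst (λ h → h (st x w y i j s [] [] u z)) (iterate-snoc (length ds))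
      (guesses ds {wp (_≤ N) (guessDigit {ℓ}) k'} (e , p))
    reads : ∀ ds j → j ≡ toBits (List.map digitTok ds) ++ toBits (tEND ∷ []) ++ j' →
      iterate (wp (_≤ N) (readDigit {ℓ} C)) (length ds) (wp (_≤ N) (isNil {ℓ} C ⨾ readTok {ℓ} tEND) k)
        (st x w y i j s (List.map Dig ds) (List.map Dig (digits κ)) u z)
    reads []       j eq = refl , readTok-complete tEND eq p
    reads (e ∷ ds) j eq = e , _ , refl , readTok-complete (digitTok e)
      (trans eq (sym (toBits-step (digitTok e ∷ []) (List.map digitTok ds)))) (reads ds _ refl)

incs : ℕ → List Bool → List Bool
incs zero    ds = ds
incs (suc n) ds = inc (incs n ds)

incs-digits : ∀ n → incs n [] ≡ digits n
incs-digits zero    = refl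
incs-digits (suc n) = trans (cong inc (incs-digits n)) (sym (digits-suc n))

length-digits : ∀ n → length (digits n) ≤ n
length-digits zero    = z≤n
length-digits (suc n) rewrite digits-suc n = ≤-trans (grow (digits n)) (s≤s (length-digits n))
  where
  grow : ∀ ds → length (inc ds) ≤ suc (length ds)
  grow []           = ≤-refl
  grow (true ∷ ds)  = s≤s (grow ds)
  grow (false ∷ ds) = n≤1+n _

digits-numToks : ∀ p → suc (length (digits p)) ≤ length (numToks p)
digits-numToks p = ≤-reflexive (sym (trans (cong length (numToks-digits p))
  (trans (length-++ (List.map digitTok (digits p))) (trans (+-comm _ 1) (cong suc (length-map digitTok (digits p)))))))

opaque
  unfolding lhsNumbers rhsNumbers

  lhsNumbers-sound : ∀ κ → run (lhsNumbers {ℓ}) k (st x w y i j s c (List.map Dig (digits κ)) [] []) →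
    ∃ λ (ps : Vec ℕ (suc κ)) → ∃ λ vs → ∃ λ x' → ∃ λ j' → x ≡ nums ps vs ++ Mid ∷ x' × j ≡ toBits (vecToks ps) ++ j'
      × k (st x' w y i j' s c [] [] (ticks κ))
  lhsNumbers-sound {ℓ} {k} {x} {w} {y} {i} {j} {s} {c} κ p with anyNumber-sound p
  ... | v , p₀ , x₁ , j₁ , refl , refl , n , _ , q with go n (digits κ) 0 x₁ j₁ q
    where
    go : ∀ n ds t x j {k'} → iterate (run (lhsStep {ℓ})) n k' (st x w y i j s c (List.map Dig ds) [] (ticks t)) →
      ∃ λ m → ∃ λ (ps : Vec ℕ m) → ∃ λ vs → ∃ λ ds' → ∃ λ x' → ∃ λ j' → x ≡ nums ps vs ++ x'
        × j ≡ toBits (vecToks ps) ++ j' × ds ≡ incs m ds' × k' (st x' w y i j' s c (List.map Dig ds') [] (ticks (m + t)))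
    go zero    ds t x j p = 0 , [] , [] , ds , x , j , refl , refl , refl , p
    go (suc n) ds t x j {k'} p with decrement-sound ds p
    ... | ds₁ , refl , p₁ with anyNumber-sound p₁
    ... | v , a , x₁ , j₁ , refl , refl , p₂ with go n ds₁ (suc t) x₁ j₁ {k'} p₂
    ... | m , ps , vs , ds' , x' , j' , refl , refl , refl , r =
      suc m , a ∷ ps , v ∷ vs , ds' , x' , j' , cong (Nb v ∷_) (sym (++-assoc (numeral a) (nums ps vs) x')) ,
      toBits-step (numToks a) (vecToks ps) , refl ,
      subst (λ t → k' (st x' w y i j' s c (List.map Dig ds') [] (ticks t))) (+-suc m t) r
  -- The counter is empty after `m` decrements, so it started at `m`, which must be `κ`.
  ... | m , ps , vs , [] , x' , j' , refl , refl , eq , _ , x'' , refl , r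
    with digits-injective {κ} {m} (trans eq (incs-digits m))
  ... | refl = p₀ ∷ ps , v ∷ vs , x'' , j' , cong (Nb v ∷_) (sym (++-assoc (numeral p₀) (nums ps vs) _)) ,
    toBits-step (numToks p₀) (vecToks ps) , subst (λ t → k (st x'' w y i j' s c [] [] (ticks t))) (+-identityʳ κ) r

  lhsNumbers-complete : ∀ {κ} (ps : Vec ℕ (suc κ)) vs {x' j'} → length (vecToks ps) ≤ N →
    x ≡ nums ps vs ++ Mid ∷ x' → j ≡ toBits (vecToks ps) ++ j' → k (st x' w y i j' s c [] [] (ticks κ)) →
    wp (_≤ N) (lhsNumbers {ℓ}) k (st x w y i j s c (List.map Dig (digits κ)) [] [])
  lhsNumbers-complete {N} {k = k} {w} {y} {i} {s} {c} {ℓ} {κ} (p ∷ ps) (v ∷ vs) {x'} {j'} le eq eq' q =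
    anyNumber-complete v p (≤-trans (<⇒≤ (digits-numToks p)) (prefix≤ (numToks p) le))
      (trans eq (cong (Nb v ∷_) (++-assoc (numeral p) (nums ps vs) _)))
      (trans eq' (sym (toBits-step (numToks p) (vecToks ps))))
      (κ , ≤-trans (vecToks-≥ ps) (suffix≤ (numToks p) le) ,
       go 0 ps vs (suffix≤ (numToks p) le) refl refl (sym (incs-digits κ)) (sym (+-identityʳ κ)) (refl , x' , refl , q))
    where
    go : ∀ t {m} (ps : Vec ℕ m) vs {ds t' x x' j j' k'} → length (vecToks ps) ≤ N → x ≡ nums ps vs ++ x' →
      j ≡ toBits (vecToks ps) ++ j' → ds ≡ incs m [] → t' ≡ m + t → k' (st x' w y i j' s c [] [] (ticks t')) →
      iterate (wp (_≤ N) (lhsStep {ℓ})) m k' (st x w y i j s c (List.map Dig ds) [] (ticks t))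
    go t [] [] le refl refl refl refl q = q
    go t {suc m} (p ∷ ps) (v ∷ vs) {x' = x'} le eq eq' refl refl q =
      decrement-complete (incs m [])
        (≤-trans (≤-trans (≤-reflexive (cong length (incs-digits m))) (length-digits m))
          (≤-trans (vecToks-≥ ps) (suffix≤ (numToks p) le)))
        refl (anyNumber-complete v p (≤-trans (<⇒≤ (digits-numToks p)) (prefix≤ (numToks p) le))
          (trans eq (cong (Nb v ∷_) (++-assoc (numeral p) (nums ps vs) _)))
          (trans eq' (sym (toBits-step (numToks p) (vecToks ps))))
          (go (suc t) ps vs (suffix≤ (numToks p) le) refl refl refl (sym (+-suc m t)) q))

  rhsNumbers-sound : ∀ κ → run (rhsNumbers {ℓ}) k (st x w y i j s c d u (ticks κ)) →
    ∃ λ (qs : Vec ℕ (suc κ)) → ∃ λ vs → ∃ λ x' → ∃ λ j' → x ≡ nums qs vs ++ Mid ∷ x' × j ≡ toBits (vecToks qs) ++ j'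
      × k (st x' w y i j' s c d u [])
  rhsNumbers-sound {ℓ} {k} {x} {w} {y} {i} {j} {s} {c} {d} {u} κ p with anyNumber-sound p
  ... | v , p₀ , x₁ , j₁ , refl , refl , n , _ , q with go n κ x₁ j₁ q
    where
    go : ∀ n t x j {k'} → iterate (run (rhsStep {ℓ})) n (run (isNil {ℓ} Z) k') (st x w y i j s c d u (ticks t)) →
      ∃ λ (qs : Vec ℕ t) → ∃ λ vs → ∃ λ x' → ∃ λ j' → x ≡ nums qs vs ++ x'
        × j ≡ toBits (vecToks qs) ++ j' × k' (st x' w y i j' s c d u [])
    go zero    zero x j (_ , p) = [] , [] , x , j , refl , refl , p
    go (suc n) (suc t) x j {k'} (_ , refl , p) with anyNumber-sound p
    ... | v , a , x₁ , j₁ , refl , refl , p₁ with go n t x₁ j₁ {k'} p₁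
    ... | qs , vs , x' , j' , refl , refl , r =
      a ∷ qs , v ∷ vs , x' , j' , cong (Nb v ∷_) (sym (++-assoc (numeral a) (nums qs vs) x')) ,
      toBits-step (numToks a) (vecToks qs) , r
  ... | qs , vs , x' , j' , refl , refl , x'' , refl , r =
    p₀ ∷ qs , v ∷ vs , x'' , j' , cong (Nb v ∷_) (sym (++-assoc (numeral p₀) (nums qs vs) _)) ,
    toBits-step (numToks p₀) (vecToks qs) , r

  rhsNumbers-complete : ∀ {κ} (qs : Vec ℕ (suc κ)) vs {x' j'} → length (vecToks qs) ≤ N →
    x ≡ nums qs vs ++ Mid ∷ x' → j ≡ toBits (vecToks qs) ++ j' → k (st x' w y i j' s c d u []) →
    wp (_≤ N) (rhsNumbers {ℓ}) k (st x w y i j s c d u (ticks κ))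
  rhsNumbers-complete {N} {k = k} {w} {y} {i} {s} {c} {d} {u} {ℓ} {κ} (p ∷ ps) (v ∷ vs) {x'} {j'} le eq eq' q =
    anyNumber-complete v p (≤-trans (<⇒≤ (digits-numToks p)) (prefix≤ (numToks p) le))
      (trans eq (cong (Nb v ∷_) (++-assoc (numeral p) (nums ps vs) _)))
      (trans eq' (sym (toBits-step (numToks p) (vecToks ps))))
      (κ , ≤-trans (vecToks-≥ ps) (suffix≤ (numToks p) le) ,
       go ps vs (suffix≤ (numToks p) le) refl refl (refl , x' , refl , q))
    where
    go : ∀ {m} (ps : Vec ℕ m) vs {x x' j j' k'} → length (vecToks ps) ≤ N → x ≡ nums ps vs ++ x' →
      j ≡ toBits (vecToks ps) ++ j' → k' (st x' w y i j' s c d u []) →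
      iterate (wp (_≤ N) (rhsStep {ℓ})) m k' (st x w y i j s c d u (ticks m))
    go [] [] le refl refl q = q
    go {suc m} (p ∷ ps) (v ∷ vs) le eq eq' q =
      _ , refl , anyNumber-complete v p (≤-trans (<⇒≤ (digits-numToks p)) (prefix≤ (numToks p) le))
          (trans eq (cong (Nb v ∷_) (++-assoc (numeral p) (nums ps vs) _)))
          (trans eq' (sym (toBits-step (numToks p) (vecToks ps))))
          (go ps vs (suffix≤ (numToks p) le) refl refl q)

-- What is left to be read: an annotated formula for every membership bit on the stack, and the end
-- of the block.
Forest : List Bool → List Letter → List Letter → Set
Forest []       x j = (∃ λ x' → x ≡ Sep ∷ x') × j ≡ []
Forest (b ∷ bs) x j = ∃ λ φ → ∃ λ (α : Ann φ) → ∃ λ x' → ∃ λ j' →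
  root α ≡ b × Local α × x ≡ flat α ++ x' × j ≡ toBits (fmlToks φ) ++ j' × Forest bs x' j'

steps : Fml → ℕ → ℕ
steps (φ ∧ᵐ ψ) n = suc (steps φ (steps ψ n))
steps (φ ∨ᵐ ψ) n = suc (steps φ (steps ψ n))
steps (□ᵐ φ)   n = suc (steps φ n)
steps (◇ᵐ φ)   n = suc (steps φ n)
steps _        n = suc n

steps≤ : ∀ φ n → steps φ n ≤ length (fmlToks φ) + n
steps≤-++ : ∀ φ ψ n → steps φ (steps ψ n) ≤ length (fmlToks φ ++ fmlToks ψ) + n
steps≤-++ φ ψ n = begin
  steps φ (steps ψ n)                                ≤⟨ steps≤ φ (steps ψ n) ⟩
  length (fmlToks φ) + steps ψ n                     ≤⟨ +-monoʳ-≤ _ (steps≤ ψ n) ⟩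
  length (fmlToks φ) + (length (fmlToks ψ) + n)      ≡⟨ sym (+-assoc (length (fmlToks φ)) _ n) ⟩
  length (fmlToks φ) + length (fmlToks ψ) + n        ≡⟨ cong (_+ n) (sym (length-++ (fmlToks φ))) ⟩
  length (fmlToks φ ++ fmlToks ψ) + n ∎
  where open ≤-Reasoning
steps≤ (var p) n      = s≤s (m≤n+m n _)
steps≤ (nvar p) n     = s≤s (m≤n+m n _)
steps≤ (φ ∧ᵐ ψ) n     = s≤s (steps≤-++ φ ψ n)
steps≤ (φ ∨ᵐ ψ) n     = s≤s (steps≤-++ φ ψ n)
steps≤ (incl k ps qs) n = s≤s (m≤n+m n _)
steps≤ (□ᵐ φ) n       = s≤s (steps≤ φ n)
steps≤ (◇ᵐ φ) n       = s≤s (steps≤ φ n)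

opaque
  unfolding node nodeCase

  -- The induction is on the iterations, as the formula is not known yet: it is assembled from the
  -- forest that the remaining iterations read.
  nodes-sound : ∀ n bs x j → iterate (run (node {ℓ})) n (run (pop {ℓ} X Sep ⨾ isNil J ⨾ isNil S) k)
    (st x w y i j (List.map Bit bs) [] [] [] []) → Forest bs x j
  nodes-sound zero [] x j (x' , refl , refl , _) = (x' , refl) , refl
  nodes-sound {k = k} (suc n) (b ∷ bs) x j (_ , _ , refl , 0F , _ , refl , p) with readTok-sound tVAR p
  ... | j₁ , refl , p₁ with number-sound (λ v → not b ∨ v) p₁
  ... | v , a , x' , j' , t , refl , refl , p₂ =
    var a , var b v , x' , j' , refl , (λ { refl → t }) , refl , refl , nodes-sound {k = k} n bs x' j' p₂
  nodes-sound {k = k} (suc n) (b ∷ bs) x j (_ , _ , refl , 1F , _ , refl , p) with readTok-sound tNVAR p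
  ... | j₁ , refl , p₁ with number-sound (λ v → not (b ∧ v)) p₁
  ... | v , a , x' , j' , t , refl , refl , p₂ =
    nvar a , nvar b v , x' , j' , refl , local b v t , refl , refl , nodes-sound {k = k} n bs x' j' p₂
    where
    local : ∀ b v → not (b ∧ v) ≡ true → b ≡ true → v ≡ false
    local true false t refl = refl
  nodes-sound {k = k} (suc n) (b ∷ bs) x j (_ , _ , refl , 2F , x₁ , refl , p) with readTok-sound tAND p
  ... | j₁ , refl , p₁ with nodes-sound {k = k} n (b ∷ b ∷ bs) x₁ j₁ p₁
  ... | φ , α , x₂ , j₂ , r , l , refl , refl , ψ , β , x₃ , j₃ , r' , l' , refl , refl , forest =
    φ ∧ᵐ ψ , and b α β , x₃ , j₃ , refl , (r , r' , l , l') , cong (And b ∷_) (sym (++-assoc (flat α) (flat β) x₃)) ,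
    cong (toBits (tAND ∷ []) ++_) (toBits-step (fmlToks φ) (fmlToks ψ)) , forest
  nodes-sound {k = k} (suc n) (b ∷ bs) x j (_ , _ , refl , 3F , x₁ , refl , p) with readTok-sound tOR p
  ... | j₁ , refl , c , c' , t , p₁ with nodes-sound {k = k} n (c ∷ c' ∷ bs) x₁ j₁ p₁
  ... | φ , α , x₂ , j₂ , refl , l , refl , refl , ψ , β , x₃ , j₃ , refl , l' , refl , refl , forest =
    φ ∨ᵐ ψ , or b α β , x₃ , j₃ , refl , (t , l , l') , cong (Or b ∷_) (sym (++-assoc (flat α) (flat β) x₃)) ,
    cong (toBits (tOR ∷ []) ++_) (toBits-step (fmlToks φ) (fmlToks ψ)) , forest
  nodes-sound {k = k} (suc n) (b ∷ bs) x j (_ , _ , refl , 4F , x₁ , refl , p) with readTok-sound tINCL p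
  ... | j₁ , refl , p₁ with arity-sound p₁
  ... | κ , j₂ , refl , p₂ with lhsNumbers-sound κ p₂
  ... | ps , us , x₃ , j₃ , refl , refl , p₃ with rhsNumbers-sound κ p₃
  ... | qs , vs , x₄ , j₄ , refl , refl , p₄ =
    incl κ ps qs , incl b us vs , x₄ , j₄ , refl , tt ,
    cong (Incl b ∷_) (trans (cong (λ s → nums ps us ++ Mid ∷ s) (sym (++-assoc (nums qs vs) (Mid ∷ []) x₄)))
      (sym (++-assoc (nums ps us) _ x₄))) ,
    cong (toBits (tINCL ∷ []) ++_) (trans (cong (toBits (numToks κ) ++_) (toBits-step (vecToks ps) (vecToks qs)))
      (toBits-step (numToks κ) (vecToks ps ++ vecToks qs))) ,
    nodes-sound {k = k} n bs x₄ j₄ p₄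
  nodes-sound {k = k} (suc n) (b ∷ bs) x j (_ , _ , refl , 5F , c , x₁ , refl , p) with readTok-sound tBOX p
  ... | j₁ , refl , p₁ with nodes-sound {k = k} n (c ∷ bs) x₁ j₁ p₁
  ... | φ , α , x₂ , j₂ , refl , l , refl , refl , forest = □ᵐ φ , box b α , x₂ , j₂ , refl , l , refl , refl , forest
  nodes-sound {k = k} (suc n) (b ∷ bs) x j (_ , _ , refl , 6F , c , x₁ , refl , p) with readTok-sound tDIA p
  ... | j₁ , refl , p₁ with nodes-sound {k = k} n (c ∷ bs) x₁ j₁ p₁
  ... | φ , α , x₂ , j₂ , refl , l , refl , refl , forest = ◇ᵐ φ , dia b α , x₂ , j₂ , refl , l , refl , refl , forest

  nodes-complete : ∀ {φ} (α : Ann φ) n bs {b x' j'} → root α ≡ b → Local α → length (fmlToks φ) ≤ N → x ≡ flat α ++ x' →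
    j ≡ toBits (fmlToks φ) ++ j' → iterate (wp (_≤ N) (node {ℓ})) n k (st x' w y i j' (List.map Bit bs) [] [] [] []) →
    iterate (wp (_≤ N) (node {ℓ})) (steps φ n) k (st x w y i j (List.map Bit (b ∷ bs)) [] [] [] [])
  nodes-complete (var {a} b v) n bs refl l le refl refl p = b , _ , refl , 0F , _ , refl ,
    readTok-complete tVAR refl (number-complete (λ v → not b ∨ v) v a (implied b v l)
      (≤-trans (<⇒≤ (digits-numToks a)) (<⇒≤ le)) refl refl p)
    where
    implied : ∀ b v → (b ≡ true → v ≡ true) → not b ∨ v ≡ true
    implied true  v h = h refl
    implied false v h = refl
  nodes-complete (nvar {a} b v) n bs refl l le refl refl p = b , _ , refl , 1F , _ , refl ,
    readTok-complete tNVAR refl (number-complete (λ v → not (b ∧ v)) v a (excluded b v l)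
      (≤-trans (<⇒≤ (digits-numToks a)) (<⇒≤ le)) refl refl p)
    where
    excluded : ∀ b v → (b ≡ true → v ≡ false) → not (b ∧ v) ≡ true
    excluded true  v h = cong not (h refl)
    excluded false v h = refl
  nodes-complete (and {φ} {ψ} b α β) n bs refl (r , r' , l , l') le refl refl p = b , _ , refl , 2F , _ , refl ,
    readTok-complete tAND refl (nodes-complete α (steps ψ n) (b ∷ bs) r l
      (prefix≤ (fmlToks φ) (<⇒≤ le)) (++-assoc (flat α) (flat β) _) (sym (toBits-step (fmlToks φ) (fmlToks ψ)))
      (nodes-complete β n bs r' l' (suffix≤ (fmlToks φ) (<⇒≤ le)) refl refl p))
  nodes-complete (or {φ} {ψ} b α β) n bs refl (t , l , l') le refl refl p = b , _ , refl , 3F , _ , refl ,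
    readTok-complete tOR refl (root α , root β , t ,
      nodes-complete α (steps ψ n) (root β ∷ bs) refl l
        (prefix≤ (fmlToks φ) (<⇒≤ le)) (++-assoc (flat α) (flat β) _) (sym (toBits-step (fmlToks φ) (fmlToks ψ)))
        (nodes-complete β n bs refl l' (suffix≤ (fmlToks φ) (<⇒≤ le)) refl refl p))
  nodes-complete (incl {κ} {ps} {qs} b us vs) n bs {x' = x'} refl l le refl refl p = b , _ , refl , 4F , _ , refl ,
    readTok-complete tINCL refl
      (arity-complete κ (≤-trans (<⇒≤ (digits-numToks κ)) (prefix≤ (numToks κ) (<⇒≤ le)))
        (sym (toBits-step (numToks κ) (vecToks ps ++ vecToks qs)))
        (lhsNumbers-complete ps us (prefix≤ (vecToks ps) (suffix≤ (numToks κ) (<⇒≤ le)))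
          (trans (++-assoc (nums ps us) _ x') (cong (λ s → nums ps us ++ Mid ∷ s) (++-assoc (nums qs vs) (Mid ∷ []) x')))
          (sym (toBits-step (vecToks ps) (vecToks qs)))
          (rhsNumbers-complete qs vs (suffix≤ (vecToks ps) (suffix≤ (numToks κ) (<⇒≤ le))) refl refl p)))
  nodes-complete (box b α) n bs refl l le refl refl p = b , _ , refl , 5F , root α , _ , refl ,
    readTok-complete tBOX refl (nodes-complete α n bs refl l (<⇒≤ le) refl refl p)
  nodes-complete (dia b α) n bs refl l le refl refl p = b , _ , refl , 6F , root α , _ , refl ,
    readTok-complete tDIA refl (nodes-complete α n bs refl l (<⇒≤ le) refl refl p)

opaque
  unfolding parse

  parse-sound : run (parse {ℓ}) k (st x w y i j [] [] [] [] []) →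
    ∃ λ φ → ∃ λ (α : Ann φ) → ∃ λ x' → Local α × x ≡ flat α ++ Sep ∷ x' × j ≡ toBits (fmlToks φ)
  parse-sound {ℓ} {k} {x} {w} {y} {i} {j} (b , n , _ , p) with nodes-sound {k = k} n (b ∷ []) x j p
  ... | φ , α , _ , _ , _ , l , refl , refl , (x' , refl) , refl = φ , α , x' , l , refl , ++-identityʳ _

  parse-complete : ∀ {φ} (α : Ann φ) {x'} → Local α → length (fmlToks φ) ≤ N → x ≡ flat α ++ Sep ∷ x' →
    j ≡ toBits (fmlToks φ) → (∀ s → k s) → wp (_≤ N) (parse {ℓ}) k (st x w y i j [] [] [] [] [])
  parse-complete {φ = φ} α l le eq refl p = root α , steps φ 0 ,
    ≤-trans (steps≤ φ 0) (≤-trans (≤-reflexive (+-identityʳ _)) le) ,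
    nodes-complete α 0 [] refl l le eq (sym (++-identityʳ _)) (_ , refl , refl , refl , p _)

-- The program: consistency and witnesses

popIf : Fin 10 → (Letter → Bool) → Cmd ℓ
popIf r P = pick finite-Letter λ a → guard (P a) ⨾ pop r a

opaque
  popWhile : Fin 10 → (Letter → Bool) → Cmd ℓ
  popWhile r P = loop (popIf r P)

  popWhile-sound : ∀ r P {s} → run (popWhile {ℓ} r P) k s →
    ∃ λ u → ∃ λ v → All (λ a → P a ≡ true) u × lookup s r ≡ u ++ v × k (s [ r ]≔ v)
  popWhile-sound {ℓ} {k} r P (n , _ , p) = go n p
    where
    go : ∀ n {s} → iterate (run (popIf {ℓ} r P)) n k s →
      ∃ λ u → ∃ λ v → All (λ a → P a ≡ true) u × lookup s r ≡ u ++ v × k (s [ r ]≔ v)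
    go zero    {s} p = [] , lookup s r , [] , refl , subst k (sym (Vec.[]≔-lookup s r)) p
    go (suc n) {s} (a , t , as , eq , p) with go n p
    ... | u , v , all , eq' , q = a ∷ u , v , t ∷ all ,
      trans eq (cong (a ∷_) (trans (sym (Vec.lookup∘update r s as)) eq')) , subst k (Vec.[]≔-idempotent s r) q

  popWhile-complete : ∀ r P {s} u {v} → All (λ a → P a ≡ true) u → lookup s r ≡ u ++ v → length u ≤ N → k (s [ r ]≔ v) →
    wp (_≤ N) (popWhile {ℓ} r P) k s
  popWhile-complete {N} {k} {ℓ} r P u {v} all eq le p = length u , le , go u all eq p
    where
    go : ∀ u {s} → All (λ a → P a ≡ true) u → lookup s r ≡ u ++ v → k (s [ r ]≔ v) →
      iterate (wp (_≤ N) (popIf {ℓ} r P)) (length u) k s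
    go []      {s} []        eq p = subst k (trans (cong (s [ r ]≔_) (sym eq)) (Vec.[]≔-lookup s r)) p
    go (a ∷ u) {s} (t ∷ all) eq p = a , t , u ++ v , eq ,
      go u all (Vec.lookup∘update r s (u ++ v)) (subst k (sym (Vec.[]≔-idempotent s r)) p)

opaque
  dropBlock : Fin 10 → Cmd ℓ
  dropBlock r = popWhile r notSep ⨾ pop r Sep

  dropBlock-sound : ∀ r {s} → run (dropBlock {ℓ} r) k s →
    ∃ λ u → ∃ λ v → NoSep u × lookup s r ≡ u ++ Sep ∷ v × k (s [ r ]≔ v)
  dropBlock-sound {k = k} r {s} p with popWhile-sound r notSep p
  ... | u , v , ns , eq , v' , eq' , q = u , v' , ns ,
    trans eq (cong (u ++_) (trans (sym (Vec.lookup∘update r s v)) eq')) , subst k (Vec.[]≔-idempotent s r) q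

  dropBlock-complete : ∀ r {s} u {v} → NoSep u → lookup s r ≡ u ++ Sep ∷ v → length u ≤ N → k (s [ r ]≔ v) →
    wp (_≤ N) (dropBlock {ℓ} r) k s
  dropBlock-complete {k = k} r {s} u {v} ns eq le p = popWhile-complete r notSep u ns eq le
    (v , Vec.lookup∘update r s _ , subst k (sym (Vec.[]≔-idempotent s r)) p)

blocks : List (List Letter) → List Letter
blocks []       = []
blocks (b ∷ bs) = b ++ Sep ∷ blocks bs

sep-unique : ∀ {u u' v v'} → NoSep u → NoSep u' → u ++ Sep ∷ v ≡ u' ++ Sep ∷ v' → u ≡ u' × v ≡ v'
sep-unique ns ns' eq with break-unique notSep ns ns' refl refl eq
... | refl , _ , refl = refl , refl

opaque
  -- This is how a witness is guessed: a run may stop in front of any block.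
  skipBlocks : Fin 10 → Cmd ℓ
  skipBlocks r = loop (dropBlock r)

  skipBlocks-sound : ∀ r {s} bs → All NoSep bs → lookup s r ≡ blocks bs → run (skipBlocks {ℓ} r) k s →
    ∃ λ bs₁ → ∃ λ bs₂ → bs ≡ bs₁ ++ bs₂ × k (s [ r ]≔ blocks bs₂)
  skipBlocks-sound {ℓ} {k} r bs ns eq (n , _ , p) = go n bs ns eq p
    where
    go : ∀ n bs {s} → All NoSep bs → lookup s r ≡ blocks bs → iterate (run (dropBlock {ℓ} r)) n k s →
      ∃ λ bs₁ → ∃ λ bs₂ → bs ≡ bs₁ ++ bs₂ × k (s [ r ]≔ blocks bs₂)
    go zero    bs {s} ns eq p = [] , bs , refl , subst k (sym (trans (cong (s [ r ]≔_) (sym eq)) (Vec.[]≔-lookup s r))) p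
    go (suc n) bs {s} ns eq p with dropBlock-sound r p
    go (suc n) [] {s} ns eq p | [] , v , _ , eq' , q = contradiction (trans (sym eq') eq) λ ()
    go (suc n) [] {s} ns eq p | _ ∷ _ , v , _ , eq' , q = contradiction (trans (sym eq') eq) λ ()
    go (suc n) (b ∷ bs) {s} (nb ∷ ns) eq p | u , v , nu , eq' , q with sep-unique nu nb (trans (sym eq') eq)
    ... | refl , refl with go n bs ns (Vec.lookup∘update r s _) q
    ... | bs₁ , bs₂ , refl , q' = b ∷ bs₁ , bs₂ , refl , subst k (Vec.[]≔-idempotent s r) q'

  skipBlocks-complete : ∀ r {s} bs₁ bs₂ → All NoSep bs₁ → lookup s r ≡ blocks (bs₁ ++ bs₂) →
    length (blocks (bs₁ ++ bs₂)) ≤ N → k (s [ r ]≔ blocks bs₂) → wp (_≤ N) (skipBlocks {ℓ} r) k s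
  skipBlocks-complete {N} {k} {ℓ} r bs₁ bs₂ ns eq le p = length bs₁ , ≤-trans (count bs₁) le , go bs₁ ns eq le p
    where
    count : ∀ bs → length bs ≤ length (blocks (bs ++ bs₂))
    count []       = z≤n
    count (b ∷ bs) = ≤-trans (s≤s (count bs)) (suffix≤ b ≤-refl)
    go : ∀ bs {s} → All NoSep bs → lookup s r ≡ blocks (bs ++ bs₂) → length (blocks (bs ++ bs₂)) ≤ N →
      k (s [ r ]≔ blocks bs₂) → iterate (wp (_≤ N) (dropBlock {ℓ} r)) (length bs) k s
    go []       {s} ns eq le p = subst k (trans (cong (s [ r ]≔_) (sym eq)) (Vec.[]≔-lookup s r)) p
    go (b ∷ bs) {s} (nb ∷ ns) eq le p = dropBlock-complete r b nb eq (prefix≤ b le)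
      (go bs ns (Vec.lookup∘update r s _) (<⇒≤ (suffix≤ b le)) (subst k (sym (Vec.[]≔-idempotent s r)) p))

-- Runs a test at every suffix of the first block of stack r; Z counts the letters passed.
module Walk {ℓ ℓ' : Fin 4} (ℓ<ℓ' : ℓ Fin.< ℓ') (r : Fin 10) (c : Cmd ℓ') where

  private
    step′ : Cmd ℓ
    step′ = test ℓ' ℓ<ℓ' c ⨾ push Z Tick ⨾ popIf r notSep

    after : (ℕ → Set) → ℕ → (Stacks → Set) → Stacks → Set
    after B m k = iterate (wp B step′) m (wp B (pop {ℓ = ℓ} r Sep) k)

  opaque
    walk : Cmd ℓ
    walk = loop step′ ⨾ pop r Sep

  module _ (mk : List Letter → ℕ → Stacks)
    (get : ∀ x n → lookup (mk x n) r ≡ x)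
    (set : ∀ x n x' → mk x n [ r ]≔ x' ≡ mk x' n)
    (tick : ∀ x n → mk x n [ Z ]≔ (Tick ∷ lookup (mk x n) Z) ≡ mk x (suc n)) where

    opaque
      unfolding walk

      -- No position can be left out: the walk ends only by popping `Sep`, and its steps cannot pop
      -- that letter.
      walk-sound : ∀ b {t} n → NoSep b → run walk k (mk (b ++ Sep ∷ t) n) →
        Each (λ x n → run c (λ _ → ⊤) (mk x n)) b (Sep ∷ t) n
      walk-sound {k} b {t} n ns (m , _ , p) = go m b n ns p
        where
        go : ∀ m b n → NoSep b → after (λ _ → ⊤) m k (mk (b ++ Sep ∷ t) n) →
          Each (λ x n → run c (λ _ → ⊤) (mk x n)) b (Sep ∷ t) n
        go m [] n ns p = tt
        go zero (a ∷ b) n (na ∷ ns) (as , eq , p) with trans (sym (get _ n)) eq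
        go zero (a ∷ b) n (() ∷ ns) (as , eq , p) | refl
        go (suc m) (a ∷ b) n (na ∷ ns) (h , p)
          with subst (run (popIf {ℓ} r notSep) (after (λ _ → ⊤) m k)) (tick (a ∷ b ++ Sep ∷ t) n) p
        ... | a' , t' , as , eq , q with trans (sym (get (a ∷ b ++ Sep ∷ t) (suc n))) eq
        ... | refl = h , go m b (suc n) ns (subst (after (λ _ → ⊤) m k) (set (a ∷ b ++ Sep ∷ t) (suc n) (b ++ Sep ∷ t)) q)

      walk-complete : ∀ b {t} n → NoSep b → length b ≤ N → (∀ s → k s) →
        Each (λ x n → wp (_≤ N) c (λ _ → ⊤) (mk x n)) b (Sep ∷ t) n → wp (_≤ N) walk k (mk (b ++ Sep ∷ t) n)
      walk-complete {N} {k} b {t} n ns le h e = length b , le , go b n ns e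
        where
        go : ∀ b n → NoSep b → Each (λ x n → wp (_≤ N) c (λ _ → ⊤) (mk x n)) b (Sep ∷ t) n →
          after (_≤ N) (length b) k (mk (b ++ Sep ∷ t) n)
        go []      n ns e = t , get (Sep ∷ t) n , h _
        go (a ∷ b) n (na ∷ ns) (p , e) = p ,
          subst (wp (_≤ N) (popIf {ℓ} r notSep) (after (_≤ N) (length b) k)) (sym (tick (a ∷ b ++ Sep ∷ t) n))
            (a , na , b ++ Sep ∷ t , get (a ∷ b ++ Sep ∷ t) (suc n) ,
              subst (after (_≤ N) (length b) k) (sym (set (a ∷ b ++ Sep ∷ t) (suc n) (b ++ Sep ∷ t))) (go b (suc n) ns e))

-- The consistency test

popBoth : Fin 10 → (Letter → Letter → Bool) → Cmd ℓ
popBoth r R = pick finite-Letter λ a → pick finite-Letter λ b → guard (R a b) ⨾ pop X a ⨾ pop r b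

sameDigit distinct : Letter → Letter → Bool
sameDigit (Dig d) (Dig e) = not (d xor e)
sameDigit _       _       = false
distinct (Dig d) (Dig e) = d xor e
distinct (Dig _) End     = true
distinct End     (Dig _) = true
distinct _       _       = false

isTrueNb isFalseNb : Letter → Bool
isTrueNb (Nb b)  = b
isTrueNb _       = false
isFalseNb (Nb b) = not b
isFalseNb _      = false

1<2 : Fin._<_ {4} {4} 1F 2F
1<2 = s≤s (s≤s z≤n)

2<3 : Fin._<_ {4} {4} 2F 3F
2<3 = s≤s (s≤s (s≤s z≤n))

opaque
  -- A program can only find something, so inequality is tested positively: some equal digits, then
  -- a first difference, where the end of the shorter numeral counts as one.
  differ : Cmd ℓ
  differ = loop (popBoth W sameDigit) ⨾ popBoth W distinct

-- Consistency concerns all pairs of occurrences: an outer walk along `X` stops at the true ones,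
-- and for each of them an inner walk along `W`, a copy of the same block, at the false ones.
pairCase : Bool → Cmd 3F
pairCase true  = popIf W (not ∘ isFalseNb)
pairCase false = pop W (Nb false) ⨾ differ

opaque
  pair : Cmd 3F
  pair = pickBit pairCase

module WalkPair = Walk 2<3 W pair

valueCase : Bool → Cmd 2F
valueCase true  = popIf X (not ∘ isTrueNb)
valueCase false = pop X (Nb true) ⨾ WalkPair.walk

opaque
  value : Cmd 2F
  value = pickBit valueCase

module WalkValue = Walk 1<2 X value

consistentᶜ : Cmd 1F
consistentᶜ = WalkValue.walk

numeral-assoc : ∀ p {x} → numeral p ++ x ≡ List.map Dig (digits p) ++ End ∷ x
numeral-assoc p = ++-assoc (List.map Dig (digits p)) (End ∷ []) _

xor-irrefl : ∀ d → d xor d ≡ false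
xor-irrefl true  = refl
xor-irrefl false = refl

opaque
  unfolding differ

  differ-sound : ∀ p {x w} → ¬ run (differ {ℓ}) k (st (numeral p ++ x) (numeral p ++ w) y i j s c d u z)
  differ-sound {ℓ} {k} {y} {i} {j} {s} {c} {d} {u} {z} p {x} {w} r
    rewrite numeral-assoc p {x} | numeral-assoc p {w} = go (proj₁ r) (digits p) (proj₂ (proj₂ r))
    where
    go : ∀ n ds → ¬ iterate (run (popBoth {ℓ} W sameDigit)) n (run (popBoth {ℓ} W distinct) k)
      (st (List.map Dig ds ++ End ∷ x) (List.map Dig ds ++ End ∷ w) y i j s c d u z)
    go zero    []       (_ , _ , () , _ , refl , _ , refl , _)
    go zero    (d ∷ ds) (_ , _ , t , _ , refl , _ , refl , _) = contradiction (trans (sym t) (xor-irrefl d)) λ ()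
    go (suc n) []       (_ , _ , () , _ , refl , _ , refl , _)
    go (suc n) (d ∷ ds) (_ , _ , t , _ , refl , _ , refl , r) = go n ds r

  differ-complete : ∀ p q {x w} → length (digits p) ≤ N → p ≢ q → (∀ s → k s) →
    wp (_≤ N) (differ {ℓ}) k (st (numeral p ++ x) (numeral q ++ w) y i j s c d u z)
  differ-complete {N} {k} {ℓ} {y} {i} {j} {s} {c} {d} {u} {z} p q {x} {w} le p≢q h
    rewrite numeral-assoc p {x} | numeral-assoc q {w} with go (digits p) (digits q) (p≢q ∘ digits-injective)
    where
    go : ∀ ds es → ds ≢ es → ∃ λ n → n ≤ length ds × iterate (wp (_≤ N) (popBoth {ℓ} W sameDigit)) n (wp (_≤ N) (popBoth {ℓ} W distinct) k)
      (st (List.map Dig ds ++ End ∷ x) (List.map Dig es ++ End ∷ w) y i j s c d u z)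
    go []           []           ≠ = contradiction refl ≠
    go []           (e ∷ es)     ≠ = 0 , z≤n , _ , _ , refl , _ , refl , _ , refl , h _
    go (d ∷ ds)     []           ≠ = 0 , z≤n , _ , _ , refl , _ , refl , _ , refl , h _
    go (true ∷ ds)  (false ∷ es) ≠ = 0 , z≤n , _ , _ , refl , _ , refl , _ , refl , h _
    go (false ∷ ds) (true ∷ es)  ≠ = 0 , z≤n , _ , _ , refl , _ , refl , _ , refl , h _
    go (true ∷ ds)  (true ∷ es)  ≠ with go ds es (≠ ∘ cong (true ∷_))
    ... | n , le , r = suc n , s≤s le , _ , _ , refl , _ , refl , _ , refl , r
    go (false ∷ ds) (false ∷ es) ≠ with go ds es (≠ ∘ cong (false ∷_))
    ... | n , le , r = suc n , s≤s le , _ , _ , refl , _ , refl , _ , refl , r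
  ... | n , le' , r = n , ≤-trans le' le , r

opaque
  unfolding pair value

  -- Two conflicting occurrences of a variable would make `differ` succeed on equal numerals.
  consistent-sound : ∀ {φ} (α : Ann φ) {t} → run consistentᶜ k (st (flat α ++ Sep ∷ t) (flat α ++ Sep ∷ t) y i j s c d u []) → Consistent α
  consistent-sound {y = y} {i} {j} {s} {c} {d} {u} α {t} r {p} mem mem'
    with value-occurs α mem | value-occurs α mem'
  ... | u₁ , v₁ , eq₁ | u₂ , v₂ , eq₂
    with each-at (λ x n → run value (λ _ → ⊤) (st x (flat α ++ Sep ∷ t) y i j s c d u (ticks n))) u₁ eq₁
           (WalkValue.walk-sound (λ x n → st x (flat α ++ Sep ∷ t) y i j s c d u (ticks n))
             (λ _ _ → refl) (λ _ _ _ → refl) (λ _ _ → refl) (flat α) 0 (noSep-flat α) r)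
  ... | true , _ , () , _ , refl , _
  ... | false , _ , refl , r'
    with each-at (λ w n → run pair (λ _ → ⊤) (st ((numeral p ++ v₁) ++ Sep ∷ t) w y i j s c d u (ticks n))) u₂ eq₂
           (WalkPair.walk-sound (λ w n → st ((numeral p ++ v₁) ++ Sep ∷ t) w y i j s c d u (ticks n))
             (λ _ _ → refl) (λ _ _ _ → refl) (λ _ _ → refl) (flat α) (length u₁ + 0) (noSep-flat α) r')
  ... | true , _ , () , _ , refl , _
  ... | false , _ , refl , r'' = differ-sound p
    (subst₂ (λ x w → run differ _ (st x w y i j s c d u (ticks (length u₂ + (length u₁ + 0)))))
      (++-assoc (numeral p) v₁ (Sep ∷ t)) (++-assoc (numeral p) v₂ (Sep ∷ t)) r'')

  consistent-complete : ∀ {φ} (α : Ann φ) {t} → Consistent α → length (flat α) ≤ N → (∀ s → k s) →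
    wp (_≤ N) consistentᶜ k (st (flat α ++ Sep ∷ t) (flat α ++ Sep ∷ t) y i j s c d u [])
  consistent-complete {N} {k} {y} {i} {j} {s} {c} {d} {u} α {t} con le h =
    WalkValue.walk-complete (λ x n → st x (flat α ++ Sep ∷ t) y i j s c d u (ticks n))
      (λ _ _ → refl) (λ _ _ _ → refl) (λ _ _ → refl) (flat α) 0 (noSep-flat α) le h
      (each-values _ (λ a t n q → true , a , cong not (trueNb a q) , _ , refl , tt) α (Sep ∷ t) 0
        (λ { {p , b} mem → at-value p b mem }))
    where
    trueNb : ∀ a → isNb a ≡ false → isTrueNb a ≡ false
    trueNb (Var _)   q = refl
    trueNb (Nvar _)  q = refl
    trueNb (And _)   q = refl
    trueNb (Or _)    q = refl
    trueNb (Incl _)  q = refl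
    trueNb (Bit _)   q = refl
    trueNb (Dig _)   q = refl
    trueNb (Box _ _) q = refl
    trueNb (Dia _ _) q = refl
    trueNb End       q = refl
    trueNb Mid       q = refl
    trueNb Sep       q = refl
    trueNb Tick      q = refl
    falseNb : ∀ a → isNb a ≡ false → isFalseNb a ≡ false
    falseNb (Var _)   q = refl
    falseNb (Nvar _)  q = refl
    falseNb (And _)   q = refl
    falseNb (Or _)    q = refl
    falseNb (Incl _)  q = refl
    falseNb (Bit _)   q = refl
    falseNb (Dig _)   q = refl
    falseNb (Box _ _) q = refl
    falseNb (Dia _ _) q = refl
    falseNb End       q = refl
    falseNb Mid       q = refl
    falseNb Sep       q = refl
    falseNb Tick      q = refl
    digits-bound : ∀ {p b} → (p , b) ∈ values α → length (digits p) ≤ N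
    digits-bound {p} {b} mem with value-occurs α mem
    ... | u , v , eq = prefix≤' (suffix≤ (Nb b ∷ []) {numeral p ++ v} (suffix≤ u (subst (λ b → length b ≤ N) eq le)))
      where
      prefix≤' : length (numeral p ++ v) ≤ N → length (digits p) ≤ N
      prefix≤' le = ≤-trans (≤-reflexive (sym (length-map Dig (digits p)))) (prefix≤ (List.map Dig (digits p)) (prefix≤ (numeral p) le))
    at-pair : ∀ {p} → (p , true) ∈ values α → ∀ {x} q b → (q , b) ∈ values α → ∀ t n →
      wp (_≤ N) pair (λ _ → ⊤) (st (numeral p ++ x) (Nb b ∷ numeral q ++ t) y i j s c d u (ticks n))
    at-pair mem q true  mem' t n = true , Nb true , refl , _ , refl , tt
    at-pair {p} mem q false mem' t n = false , _ , refl ,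
      differ-complete p q (digits-bound mem) (λ { refl → con mem mem' }) (λ _ → tt)
    at-value : ∀ p b → (p , b) ∈ values α → ∀ x n →
      wp (_≤ N) value (λ _ → ⊤) (st (Nb b ∷ numeral p ++ x) (flat α ++ Sep ∷ t) y i j s c d u (ticks n))
    at-value p false mem x n = true , Nb false , refl , _ , refl , tt
    at-value p true  mem x n = false , _ , refl ,
      WalkPair.walk-complete (λ w n → st (numeral p ++ x) w y i j s c d u (ticks n))
        (λ _ _ → refl) (λ _ _ _ → refl) (λ _ _ → refl) (flat α) n (noSep-flat α) le (λ _ → tt)
        (each-values _ (λ a t n q → true , a , cong not (falseNb a q) , _ , refl , tt) α (Sep ∷ t) n
          (λ { {q , b} mem' → at-pair mem q b mem' }))

-- Comparing two types position by position

-- Prevents a comparison from running across the end of a block.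
sepless : (Letter → Letter → Bool) → Letter → Letter → Bool
sepless R a b = notSep a ∧ notSep b ∧ R a b

sepless-split : ∀ R a b → sepless R a b ≡ true → notSep a ≡ true × notSep b ≡ true × R a b ≡ true
sepless-split R a b t with notSep a | notSep b
... | true  | true  = refl , refl , t
... | true  | false = contradiction t λ ()
... | false | _     = contradiction t λ ()

sepless-join : ∀ R a b → notSep a ≡ true → notSep b ≡ true → R a b ≡ true → sepless R a b ≡ true
sepless-join R a b p q t rewrite p | q = t

Rel : (Letter → Letter → Bool) → Letter → Letter → Set
Rel R a b = R a b ≡ true

module _ (R : Letter → Letter → Bool) where

  alignStep restStep : Cmd ℓ
  alignStep = pop Z Tick ⨾ popBoth Y (sepless R)
  restStep  = popBoth Y (sepless R)

  opaque
    align alignRest : Cmd ℓ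
    align     = loop alignStep ⨾ isNil Z
    alignRest = loop restStep ⨾ pop X Sep ⨾ pop Y Sep

    align-sound : ∀ n → run (align {ℓ}) k (st x w y i j s c d u (ticks n)) → ∃ λ p → ∃ λ q → ∃ λ x' → ∃ λ y' →
      x ≡ p ++ x' × y ≡ q ++ y' × Pointwise (Rel R) p q × length p ≡ n × k (st x' w y' i j s c d u [])
    align-sound {ℓ} {k} {x} {w} {y} {i} {j} {s} {c} {d} {u} n (m , _ , r) = go m n r
      where
      go : ∀ m n {x y} → iterate (run (alignStep {ℓ})) m (run (isNil {ℓ} Z) k) (st x w y i j s c d u (ticks n)) →
        ∃ λ p → ∃ λ q → ∃ λ x' → ∃ λ y' →
        x ≡ p ++ x' × y ≡ q ++ y' × Pointwise (Rel R) p q × length p ≡ n × k (st x' w y' i j s c d u [])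
      go zero    zero    (_ , r) = [] , [] , _ , _ , refl , refl , [] , refl , r
      go (suc m) (suc n) (_ , refl , a , b , t , _ , refl , _ , refl , r) with go m n r
      ... | p , q , x' , y' , refl , refl , pw , refl , r' =
        a ∷ p , b ∷ q , x' , y' , refl , refl , proj₂ (proj₂ (sepless-split R a b t)) ∷ pw , refl , r'

    align-complete : ∀ {p q x' y'} → Pointwise (Rel R) p q → NoSep p → NoSep q → length p ≤ N →
      k (st x' w y' i j s c d u []) → wp (_≤ N) (align {ℓ}) k (st (p ++ x') w (q ++ y') i j s c d u (ticks (length p)))
    align-complete {N} {k} {w} {i} {j} {s} {c} {d} {u} {ℓ} {p} {q} {x'} {y'} pw ns ns' le r = length p , le , go pw ns ns'
      where
      go : ∀ {p q} → Pointwise (Rel R) p q → NoSep p → NoSep q →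
        iterate (wp (_≤ N) (alignStep {ℓ})) (length p) (wp (_≤ N) (isNil {ℓ} Z) k) (st (p ++ x') w (q ++ y') i j s c d u (ticks (length p)))
      go []       []       []        = refl , r
      go (t ∷ pw) (a ∷ ns) (b ∷ ns') = _ , refl , _ , _ , sepless-join R _ _ a b t , _ , refl , _ , refl , go pw ns ns'

    alignRest-sound : run (alignRest {ℓ}) k (st x w y i j s c d u z) → ∃ λ p → ∃ λ q → ∃ λ x' → ∃ λ y' →
      x ≡ p ++ Sep ∷ x' × y ≡ q ++ Sep ∷ y' × Pointwise (Rel R) p q × NoSep p × NoSep q
    alignRest-sound {ℓ} {k} {x} {w} {y} {i} {j} {s} {c} {d} {u} {z} (m , _ , r) = go m r
      where
      go : ∀ m {x y} → iterate (run (restStep {ℓ})) m (run (pop {ℓ = ℓ} X Sep ⨾ pop Y Sep) k) (st x w y i j s c d u z) →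
        ∃ λ p → ∃ λ q → ∃ λ x' → ∃ λ y' →
        x ≡ p ++ Sep ∷ x' × y ≡ q ++ Sep ∷ y' × Pointwise (Rel R) p q × NoSep p × NoSep q
      go zero    (_ , refl , _ , refl , _) = [] , [] , _ , _ , refl , refl , [] , [] , []
      go (suc m) (a , b , t , _ , refl , _ , refl , r) with go m r | sepless-split R a b t
      ... | p , q , x' , y' , refl , refl , pw , ns , ns' | na , nb , t' =
        a ∷ p , b ∷ q , x' , y' , refl , refl , t' ∷ pw , na ∷ ns , nb ∷ ns'

    alignRest-complete : ∀ {p q x' y'} → Pointwise (Rel R) p q → NoSep p → NoSep q → length p ≤ N → (∀ s → k s) →
      wp (_≤ N) (alignRest {ℓ}) k (st (p ++ Sep ∷ x') w (q ++ Sep ∷ y') i j s c d u z)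
    alignRest-complete {N} {k} {ℓ} {w} {i} {j} {s} {c} {d} {u} {z} {p} {q} {x'} {y'} pw ns ns' le h = length p , le , go pw ns ns'
      where
      go : ∀ {p q} → Pointwise (Rel R) p q → NoSep p → NoSep q →
        iterate (wp (_≤ N) (restStep {ℓ})) (length p) (wp (_≤ N) (pop {ℓ = ℓ} X Sep ⨾ pop Y Sep) k) (st (p ++ Sep ∷ x') w (q ++ Sep ∷ y') i j s c d u z)
      go []       []       []        = _ , refl , _ , refl , h _
      go (t ∷ pw) (a ∷ ns) (b ∷ ns') = _ , _ , sepless-join R _ _ a b t , _ , refl , _ , refl , go pw ns ns'

isDig notMid : Letter → Bool
isDig (Dig _) = true
isDig _       = false
notMid Mid = false
notMid _   = true

opaque
  skipNumeral : Fin 10 → Cmd ℓ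
  skipNumeral r = popWhile r isDig ⨾ pop r End

  skipNumeral-sound : ∀ r p {x s} → lookup s r ≡ numeral p ++ x → run (skipNumeral {ℓ} r) k s → k (s [ r ]≔ x)
  skipNumeral-sound {k = k} r p {x} {s} eq h with popWhile-sound r isDig h
  ... | u , v , all , eq' , v' , eq'' , q with break-unique isDig all (digs-all (digits p)) refl refl
      (trans (cong (u ++_) (trans (sym eq'') (Vec.lookup∘update r s v))) (trans (sym eq') (trans eq (numeral-assoc p))))
    where
    digs-all : ∀ ds → All (λ a → isDig a ≡ true) (List.map Dig ds)
    digs-all []       = []
    digs-all (_ ∷ ds) = refl ∷ digs-all ds
  ... | _ , _ , refl = subst k (Vec.[]≔-idempotent s r) q

  skipNumeral-complete : ∀ r p {x s} → lookup s r ≡ numeral p ++ x → length (digits p) ≤ N → k (s [ r ]≔ x) →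
    wp (_≤ N) (skipNumeral {ℓ} r) k s
  skipNumeral-complete {N} {k} r p {x} {s} eq le h = popWhile-complete r isDig (List.map Dig (digits p)) (digs-all (digits p))
    (trans eq (numeral-assoc p)) (≤-trans (≤-reflexive (length-map Dig (digits p))) le)
    (x , Vec.lookup∘update r s _ , subst k (sym (Vec.[]≔-idempotent s r)) h)
    where
    digs-all : ∀ ds → All (λ a → isDig a ≡ true) (List.map Dig ds)
    digs-all []       = []
    digs-all (_ ∷ ds) = refl ∷ digs-all ds

valueStep : Cmd ℓ
valueStep = pickBit λ v → pop X (Nb v) ⨾ pop Y (Nb v) ⨾ skipNumeral X ⨾ skipNumeral Y

opaque
  -- `X` stands at the left-hand vector of one type; in `Y` the left-hand vector of the other is
  -- passed over first. Then only truth values are compared, numerals being skipped.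
  sameValues : Cmd ℓ
  sameValues = popWhile Y notMid ⨾ pop Y Mid ⨾ loop valueStep ⨾ pop X Mid ⨾ pop Y Mid

  notMid-nums : ∀ {n} (ps : Vec ℕ n) vs → All (λ a → notMid a ≡ true) (nums ps vs)
  notMid-nums ps vs = all-nums (λ _ → refl) refl (λ _ → refl) ps vs

  sameValues-sound : ∀ {n} (ps : Vec ℕ n) us us' (qs : Vec ℕ n) vs {x y} →
    run (sameValues {ℓ}) k (st (nums ps us ++ Mid ∷ x) w (nums ps us' ++ Mid ∷ nums qs vs ++ Mid ∷ y) i j s c d u z) → us ≡ vs
  sameValues-sound {ℓ} {k} {w} {i} {j} {s} {c} {d} {u} {z} ps us us' qs vs {x} {y} h with popWhile-sound Y notMid h
  ... | p , q , all , eq , q' , refl , m , _ , h' with break-unique notMid all (notMid-nums ps us') refl refl (sym eq)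
  ... | _ , _ , refl = go m ps us qs vs h'
    where
    go : ∀ m {n} (ps : Vec ℕ n) us (qs : Vec ℕ n) vs → iterate (run (valueStep {ℓ})) m (run (pop {ℓ = ℓ} X Mid ⨾ pop Y Mid) k)
      (st (nums ps us ++ Mid ∷ x) w (nums qs vs ++ Mid ∷ y) i j s c d u z) → us ≡ vs
    go m [] [] [] [] h = refl
    go zero (p ∷ ps) (v ∷ us) (q ∷ qs) (v' ∷ vs) (_ , () , _)
    go (suc m) (p ∷ ps) (v ∷ us) (q ∷ qs) (v' ∷ vs) (_ , _ , refl , _ , refl , h) =
      cong (v ∷_) (go m ps us qs vs (skipNumeral-sound Y q (++-assoc (numeral q) (nums qs vs) _)
        (skipNumeral-sound X p (++-assoc (numeral p) (nums ps us) _) h)))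

  sameValues-complete : ∀ {n} (ps : Vec ℕ n) us us' (qs : Vec ℕ n) vs {x y} → us ≡ vs →
    length (nums ps us) ≤ N → length (nums qs vs) ≤ N → (∀ s → k s) →
    wp (_≤ N) (sameValues {ℓ}) k (st (nums ps us ++ Mid ∷ x) w (nums ps us' ++ Mid ∷ nums qs vs ++ Mid ∷ y) i j s c d u z)
  sameValues-complete {N} {k} {ℓ} {w} {i} {j} {s} {c} {d} {u} {z} {n} ps us us' qs vs {x} {y} eq le le' h =
    popWhile-complete Y notMid (nums ps us') (notMid-nums ps us') refl (≤-trans (≤-reflexive (length-nums ps us' us)) le)
      (_ , refl , n , ≤-trans (≤-trans (m≤m+n n _) (≤-reflexive (sym (length-nums-toks ps us)))) le ,
        go ps us qs vs eq le le')
    where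
    bound : ∀ v p {n} (ps : Vec ℕ n) us → length (nums (p ∷ ps) (v ∷ us)) ≤ N → length (digits p) ≤ N
    bound v p ps us le = ≤-trans (≤-reflexive (sym (length-map Dig (digits p))))
      (prefix≤ (List.map Dig (digits p)) (prefix≤ (numeral p) (<⇒≤ le)))
    go : ∀ {n} (ps : Vec ℕ n) us (qs : Vec ℕ n) vs → us ≡ vs → length (nums ps us) ≤ N → length (nums qs vs) ≤ N →
      iterate (wp (_≤ N) (valueStep {ℓ})) n (wp (_≤ N) (pop {ℓ = ℓ} X Mid ⨾ pop Y Mid) k)
        (st (nums ps us ++ Mid ∷ x) w (nums qs vs ++ Mid ∷ y) i j s c d u z)
    go [] [] [] [] refl le le' = _ , refl , _ , refl , h _
    go (p ∷ ps) (v ∷ us) (q ∷ qs) (v' ∷ vs) refl le le' = v , _ , refl , _ , refl ,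
      skipNumeral-complete X p (++-assoc (numeral p) (nums ps us) _) (bound v p ps us le)
        (skipNumeral-complete Y q (++-assoc (numeral q) (nums qs vs) _) (bound v q qs vs le')
          (go ps us qs vs refl (suffix≤ (numeral p) (<⇒≤ le)) (suffix≤ (numeral q) (<⇒≤ le'))))

-- Requests for witnesses

wantsForth wantsBack wantsIncl : Letter → Bool
wantsForth (Dia b _) = b
wantsForth _         = false
wantsBack (Dia _ c) = c
wantsBack (Box _ c) = c
wantsBack _         = false
wantsIncl (Incl b) = b
wantsIncl _        = false

-- A hit must imply compatibility at its own position, since the comparisons cover only the letters
-- before and after it. For boxes this is why `hitsBack` asks for `c` as well.
hitsForth hitsBack hitsIncl : Letter → Letter → Bool
hitsForth (Dia _ _) (Dia _ c) = c
hitsForth _         _         = false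
hitsBack (Dia _ _) (Dia b _) = b
hitsBack (Box _ c) (Box b _) = b ∧ c
hitsBack _         _         = false
hitsIncl (Incl _) (Incl b) = b
hitsIncl _        _        = false

-- While `W` stands at the requesting letter, `X` is still at the start of the block and `Z` holds
-- the position. So `align` brings `X` and a guessed block in `Y` to the same occurrence.
search : (R hit : Letter → Letter → Bool) → Cmd 3F → Cmd 3F
search R hit tail = skipBlocks Y ⨾ align R ⨾ popBoth Y hit ⨾ tail

-- Whether the letter at the current position is satisfied with the blocks in Y: it wants nothing, or
-- some block hits it at the same position.
query : (Letter → Bool) → (R hit : Letter → Letter → Bool) → Cmd 3F → Cmd 3F
query wants R hit tail = pickBit λ { true → popIf W (not ∘ wants) ; false → search R hit tail }

-- Here a predecessor is sought: the block found in `Y` is the left argument of `Compat`.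
ok˘ : Letter → Letter → Bool
ok˘ a b = ok b a

opaque
  queries : Cmd 2F
  queries =
    test 3F 2<3 (query wantsForth ok hitsForth (alignRest ok)) ⨾
    test 3F 2<3 (query wantsBack ok˘ hitsBack (alignRest ok˘)) ⨾
    test 3F 2<3 (query wantsIncl (λ _ _ → true) hitsIncl sameValues)

module WalkQueries = Walk 1<2 W queries

requests : Cmd 1F
requests = WalkQueries.walk

query-wanted : ∀ {wants R hit tail a w'} → wants a ≡ true → run (query wants R hit tail) k (st x (a ∷ w') y i j s c d u z) →
  run (search R hit tail) k (st x (a ∷ w') y i j s c d u z)
query-wanted t (true  , _ , f , _ , refl , _) = contradiction (trans (sym f) (cong not t)) λ ()
query-wanted t (false , h) = h

blocksOf : ∀ {φ} → List (Ann φ) → List Letter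
blocksOf Θ = blocks (List.map flat Θ)

noSep-blocks : ∀ {φ} (Θ : List (Ann φ)) → All NoSep (List.map flat Θ)
noSep-blocks []      = []
noSep-blocks (α ∷ Θ) = noSep-flat α ∷ noSep-blocks Θ

and-flat : ∀ {φ ψ} (α : Ann (φ ∧ᵐ ψ)) → flat α ≡ And (root α) ∷ flat (and₁ α) ++ flat (and₂ α)
and-flat (and _ _ _) = refl

or-flat : ∀ {φ ψ} (α : Ann (φ ∨ᵐ ψ)) → flat α ≡ Or (root α) ∷ flat (or₁ α) ++ flat (or₂ α)
or-flat (or _ _ _) = refl

box-flat : ∀ {φ} (α : Ann (□ᵐ φ)) → flat α ≡ Box (root α) (root (unbox α)) ∷ flat (unbox α)
box-flat (box _ _) = refl

dia-flat : ∀ {φ} (α : Ann (◇ᵐ φ)) → flat α ≡ Dia (root α) (root (undia α)) ∷ flat (undia α)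
dia-flat (dia _ _) = refl

incl-flat : ∀ {κ ps qs} (α : Ann (incl κ ps qs)) →
  flat α ≡ Incl (root α) ∷ nums ps (lhs α) ++ Mid ∷ nums qs (rhs α) ++ Mid ∷ []
incl-flat (incl _ _ _) = refl

hitsForth-ok : ∀ a b → hitsForth a b ≡ true → ok a b ≡ true
hitsForth-ok (Dia _ _) (Dia _ c) h = refl

hitsBack-ok : ∀ a b → hitsBack a b ≡ true → ok˘ a b ≡ true
hitsBack-ok (Dia _ _) (Dia b _) h = refl
hitsBack-ok (Box _ true) (Box true _) h = refl

module _ {φ} (Θ : List (Ann φ)) where

  module Occurrence {ψ} {π : Ann φ → Ann ψ} (ctx : Context π) (hd : Ann ψ → Letter) (tl : Ann ψ → List Letter)
    (hd-tl : ∀ γ → flat γ ≡ hd γ ∷ tl γ) where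

    open Context ctx

    here-flat : ∀ α t → flat α ++ Sep ∷ t ≡ before α ++ hd (π α) ∷ tl (π α) ++ after α ++ Sep ∷ t
    here-flat α t = trans (cong (_++ Sep ∷ t) (decompose α)) (trans (++-assoc (before α) _ (Sep ∷ t))
      (cong (before α ++_) (trans (++-assoc (flat (π α)) (after α) (Sep ∷ t)) (cong (_++ after α ++ Sep ∷ t) (hd-tl (π α))))))

    inner-flat : ∀ α → flat α ≡ before α ++ hd (π α) ∷ tl (π α) ++ after α
    inner-flat α = trans (decompose α) (cong (λ s → before α ++ s ++ after α) (hd-tl (π α)))

    -- `align` pops as many letters as precede the occurrence in `α`. By `aligned`, equally many
    -- precede it in `β`, so `hit` has compared the same occurrence.
    search-sound : ∀ R hit tail {α t n} → n ≡ length (before α) →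
      run (search R hit tail) k (st (flat α ++ Sep ∷ t) w (blocksOf Θ) i j s c d u (ticks n)) →
      ∃ λ β → β ∈ Θ × hit (hd (π α)) (hd (π β)) ≡ true × Pointwise (Rel R) (before α) (before β) ×
      ∃ λ t' → run tail k (st (tl (π α) ++ after α ++ Sep ∷ t) w (tl (π β) ++ after β ++ Sep ∷ t') i j s c d u [])
    search-sound R hit tail {α} {t} {n} n≡ r
      with skipBlocks-sound Y (List.map flat Θ) (noSep-blocks Θ) refl r
    ... | bs₁ , bs₂ , eq , r₁ with align-sound R n r₁
    ... | p , q , x' , y' , eqx , eqy , pw , len , a , a' , t₁ , x'' , refl , y'' , refl , r₂
      with ++-cancel-length p {before α} (trans len n≡) (trans (sym eqx) (here-flat α t))
    ... | refl , refl with bs₂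
    ... | [] = contradiction eqy (nonempty q)
      where
      nonempty : ∀ q {a : Letter} {y} → [] ≢ q ++ a ∷ y
      nonempty [] ()
      nonempty (_ ∷ _) ()
    ... | b ∷ bs₃ with ∈-map⁻ flat (subst (b ∈_) (sym eq) (∈-++⁺ʳ bs₁ (here refl)))
    ... | β , mem , refl
      with ++-cancel-length q {before β} (trans (sym (Pointwise-length pw)) (aligned α β)) (trans (sym eqy) (here-flat β (blocks bs₃)))
    ... | refl , refl = β , mem , t₁ , pw , blocks bs₃ , r₂

    -- Prefix, current letter and rest are covered by `align`, `hit` and `alignRest`; together they
    -- compare the whole blocks.
    modal-sound : ∀ R hit → (∀ a b → hit a b ≡ true → R a b ≡ true) → ∀ {α t n} → n ≡ length (before α) →
      run (search R hit (alignRest R)) k (st (flat α ++ Sep ∷ t) w (blocksOf Θ) i j s c d u (ticks n)) →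
      ∃ λ β → β ∈ Θ × hit (hd (π α)) (hd (π β)) ≡ true × Pointwise (Rel R) (flat α) (flat β)
    modal-sound R hit hit→R {α} {t} n≡ r with search-sound R hit (alignRest R) {α} n≡ r
    ... | β , mem , h , pw , t' , r' with alignRest-sound R r'
    ... | p , q , x' , y' , eq , eq' , pw' , ns , ns'
      with sep-unique ns (rest α) (trans (sym eq) (sym (++-assoc (tl (π α)) (after α) (Sep ∷ t))))
         | sep-unique ns' (rest β) (trans (sym eq') (sym (++-assoc (tl (π β)) (after β) (Sep ∷ t'))))
      where
      rest : ∀ α → NoSep (tl (π α) ++ after α)
      rest α with All.++⁻ʳ (before α) (subst NoSep (inner-flat α) (noSep-flat α))
      ... | _ ∷ ns = ns
    ... | refl , _ | refl , _ = β , mem , h , subst₂ (Pointwise (Rel R)) (sym (inner-flat α)) (sym (inner-flat β))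
      (Pointwise.++⁺ pw (hit→R _ _ h ∷ pw'))

    search-complete : ∀ R hit tail {α β t n} → β ∈ Θ → n ≡ length (before α) → length (flat α) ≤ N → length (blocksOf Θ) ≤ N →
      hit (hd (π α)) (hd (π β)) ≡ true → Pointwise (Rel R) (before α) (before β) →
      (∀ t' → wp (_≤ N) tail k (st (tl (π α) ++ after α ++ Sep ∷ t) w (tl (π β) ++ after β ++ Sep ∷ t') i j s c d u [])) →
      wp (_≤ N) (search R hit tail) k (st (flat α ++ Sep ∷ t) w (blocksOf Θ) i j s c d u (ticks n))
    search-complete {N} {k} {w} {i} {j} {s} {c} {d} {u} R hit tail {α} {β} {t} mem refl le le' h pw r with ∈-∃++ mem
    ... | Θ₁ , Θ₂ , refl = skipBlocks-complete Y (List.map flat Θ₁) (List.map flat (β ∷ Θ₂)) (noSep-blocks Θ₁)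
      (cong blocks (map-++ flat Θ₁ (β ∷ Θ₂))) (subst (λ bs → length (blocks bs) ≤ N) (map-++ flat Θ₁ (β ∷ Θ₂)) le')
      (subst₂ (λ x y → wp (_≤ N) (align R) _ (st x w y i j s c d u (ticks (length (before α)))))
        (sym (here-flat α t)) (sym (here-flat β (blocksOf Θ₂)))
        (align-complete R pw (noSep-before α) (noSep-before β)
          (prefix≤ (before α) (subst (λ b → length b ≤ N) (inner-flat α) le))
          (hd (π α) , hd (π β) , h , _ , refl , _ , refl , r (blocksOf Θ₂))))
      where
      noSep-before : ∀ α → NoSep (before α)
      noSep-before α = All.++⁻ˡ (before α) (subst NoSep (inner-flat α) (noSep-flat α))

    modal-complete : ∀ R hit {α β t n} → β ∈ Θ → n ≡ length (before α) → length (flat α) ≤ N → length (blocksOf Θ) ≤ N →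
      hit (hd (π α)) (hd (π β)) ≡ true → Pointwise (Rel R) (flat α) (flat β) → (∀ s → k s) →
      wp (_≤ N) (search R hit (alignRest R)) k (st (flat α ++ Sep ∷ t) w (blocksOf Θ) i j s c d u (ticks n))
    modal-complete {N} R hit {α} {β} {t} mem n≡ le le' h pw all
      with pointwise-split (before α) {before β} (aligned α β) (subst₂ (Pointwise (Rel R)) (inner-flat α) (inner-flat β) pw)
         | All.++⁻ʳ (before α) (subst NoSep (inner-flat α) (noSep-flat α))
         | All.++⁻ʳ (before β) (subst NoSep (inner-flat β) (noSep-flat β))
    ... | pw₁ , (_ ∷ pw₂) | _ ∷ ns | _ ∷ ns' = search-complete R hit (alignRest R) {α} {β} mem n≡ le le' h pw₁ λ t' →
      subst₂ (λ x y → wp (_≤ N) (alignRest R) _ (st x _ y _ _ _ _ _ _ []))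
        (++-assoc (tl (π α)) (after α) (Sep ∷ t)) (++-assoc (tl (π β)) (after β) (Sep ∷ t'))
        (alignRest-complete R pw₂ ns ns' (<⇒≤ (suffix≤ (before α) (subst (λ b → length b ≤ N) (inner-flat α) le))) all)

  QueriesAt : (List Letter → List Letter → ℕ → Set) → Set
  QueriesAt Q = ∀ {α} → α ∈ Θ → ∃ λ t → Each (Q (flat α ++ Sep ∷ t)) (flat α) (Sep ∷ t) 0

  private
    Answered : (i j s c d u x w : List Letter) → ℕ → Set
    Answered i j s c d u x w n = run queries (λ _ → ⊤) (st x w (blocksOf Θ) i j s c d u (ticks n))

    module At {ψ} {π : Ann φ → Ann ψ} (ctx : Context π) (hd : Ann ψ → Letter) (tl : Ann ψ → List Letter)
      (hd-tl : ∀ γ → flat γ ≡ hd γ ∷ tl γ) where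

      open Occurrence ctx hd tl hd-tl public
      open Context ctx public

      answered : QueriesAt (Answered i j s c d u) → ∀ {α} → α ∈ Θ → ∃ λ t → ∃ λ w' → ∃ λ n →
        n ≡ length (before α) × Answered i j s c d u (flat α ++ Sep ∷ t) (hd (π α) ∷ w') n
      answered {i} {j} {s} {c} {d} {u} ans {α} mem with ans mem
      ... | t , e = t , _ , _ , +-identityʳ _ , each-at (Answered i j s c d u (flat α ++ Sep ∷ t)) (before α) (inner-flat α) e

  opaque
    unfolding queries

    witnessed-sound : QueriesAt (Answered i j s c d u) → ∀ ψ (π : Ann φ → Ann ψ) → Context π → Witnessed Θ ψ π
    witnessed-sound ans (var p)  π ctx = tt
    witnessed-sound ans (nvar p) π ctx = tt
    witnessed-sound ans (ψ ∧ᵐ χ) π ctx = witnessed-sound ans ψ (and₁ ∘ π) (context-and₁ ∘ᶜ ctx) , witnessed-sound ans χ (and₂ ∘ π) (context-and₂ ∘ᶜ ctx)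
    witnessed-sound ans (ψ ∨ᵐ χ) π ctx = witnessed-sound ans ψ (or₁ ∘ π) (context-or₁ ∘ᶜ ctx) , witnessed-sound ans χ (or₂ ∘ π) (context-or₂ ∘ᶜ ctx)
    witnessed-sound ans (incl κ ps qs) π ctx α mem r
      with At.answered ctx (λ α → Incl (root α)) (λ α → nums ps (lhs α) ++ Mid ∷ nums qs (rhs α) ++ Mid ∷ []) incl-flat ans mem
    ... | t , w' , n , n≡ , _ , _ , q , _
      with At.search-sound ctx (λ α → Incl (root α)) (λ α → nums ps (lhs α) ++ Mid ∷ nums qs (rhs α) ++ Mid ∷ []) incl-flat
             (λ _ _ → true) hitsIncl sameValues {α} n≡ (query-wanted {wants = wantsIncl} r q)
    ... | β , mem' , h , _ , t' , r' = β , mem' , h ,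
      sameValues-sound ps (lhs (π α)) (lhs (π β)) qs (rhs (π β))
        (subst₂ (λ x y → run sameValues _ (st x _ y _ _ _ _ _ _ []))
          (++-assoc (nums ps (lhs (π α))) _ _)
          (trans (++-assoc (nums ps (lhs (π β))) _ _) (cong (λ v → nums ps (lhs (π β)) ++ Mid ∷ v) (++-assoc (nums qs (rhs (π β))) _ _))) r')
    witnessed-sound ans (□ᵐ ψ) π ctx = back , witnessed-sound ans ψ (unbox ∘ π) (context-box ∘ᶜ ctx)
      where
      open At ctx (λ α → Box (root α) (root (unbox α))) (λ α → flat (unbox α)) box-flat
      back : Back Θ (root ∘ π) (root ∘ unbox ∘ π)
      back β mem r with answered ans mem
      ... | t , w' , n , n≡ , _ , q , _ with modal-sound ok˘ hitsBack hitsBack-ok {β} n≡ (query-wanted {wants = wantsBack} r q)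
      ... | α , mem' , h , pw = α , mem' , ok→compat α β (Pointwise.symmetric id pw) , ∧-left h
        where
        ∧-left : ∀ {a b} → a ∧ b ≡ true → a ≡ true
        ∧-left {true} h = refl
    witnessed-sound ans (◇ᵐ ψ) π ctx = forth , back , witnessed-sound ans ψ (undia ∘ π) (context-dia ∘ᶜ ctx)
      where
      open At ctx (λ α → Dia (root α) (root (undia α))) (λ α → flat (undia α)) dia-flat
      forth : Forth Θ (root ∘ π) (root ∘ undia ∘ π)
      forth α mem r with answered ans mem
      ... | t , w' , n , n≡ , q , _ with modal-sound ok hitsForth hitsForth-ok {α} n≡ (query-wanted {wants = wantsForth} r q)
      ... | β , mem' , h , pw = β , mem' , ok→compat α β pw , h
      back : Back Θ (root ∘ π) (root ∘ undia ∘ π)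
      back β mem r with answered ans mem
      ... | t , w' , n , n≡ , _ , q , _ with modal-sound ok˘ hitsBack hitsBack-ok {β} n≡ (query-wanted {wants = wantsBack} r q)
      ... | α , mem' , h , pw = α , mem' , ok→compat α β (Pointwise.symmetric id pw) , h

  private
    Quiet : Letter → Set
    Quiet a = wantsForth a ≡ false × wantsBack a ≡ false × wantsIncl a ≡ false

    quiet-nums : ∀ {n} (ps : Vec ℕ n) vs → All Quiet (nums ps vs)
    quiet-nums = all-nums (λ _ → refl , refl , refl) (refl , refl , refl) (λ _ → refl , refl , refl)

    swap-suc : ∀ a n → a + suc n ≡ n + suc a
    swap-suc = RingSolver.solve-∀

  module _ (N : ℕ) (i j s c d u : List Letter) (le' : length (blocksOf Θ) ≤ N) where

    private
      Ans : List Letter → List Letter → ℕ → Set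
      Ans x w n = wp (_≤ N) queries (λ _ → ⊤) (st x w (blocksOf Θ) i j s c d u (ticks n))

      idle : ∀ {wants R hit tail a w n x} → wants a ≡ false →
        wp (_≤ N) (query wants R hit tail) (λ _ → ⊤) (st x (a ∷ w) (blocksOf Θ) i j s c d u (ticks n))
      idle q = true , _ , cong not q , _ , refl , tt

    opaque
      unfolding queries

      private
        quiet : ∀ {a x} w n → Quiet a → Ans x (a ∷ w) n
        quiet {a} w n (f , b , q) = idle {wantsForth} {ok} {hitsForth} {alignRest ok} f ,
          idle {wantsBack} {ok˘} {hitsBack} {alignRest ok˘} b , idle {wantsIncl} {λ _ _ → true} {hitsIncl} {sameValues} q , tt

      -- `T` and `n` are variables with equations because the contexts of nested occurrences give
      -- them only up to associativity.
      witnessed-complete : ∀ ψ (π : Ann φ → Ann ψ) (ctx : Context π) → Witnessed Θ ψ π → ∀ {α} → α ∈ Θ → length (flat α) ≤ N →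
        ∀ {T t n} → T ≡ Context.after ctx α ++ Sep ∷ t → n ≡ length (Context.before ctx α) →
        Each (Ans (flat α ++ Sep ∷ t)) (flat (π α)) T n
      witnessed-complete (var p) π ctx wit {α} mem le {T} {t} {n} eq n≡ =
        each-all (Ans (flat α ++ Sep ∷ t)) {Quiet} quiet T n (letters (π α))
        where
        letters : (γ : Ann (var p)) → All Quiet (flat γ)
        letters (var _ _) = (refl , refl , refl) ∷ (refl , refl , refl) ∷ all-numeral (λ _ → refl , refl , refl) (refl , refl , refl) p
      witnessed-complete (nvar p) π ctx wit {α} mem le {T} {t} {n} eq n≡ =
        each-all (Ans (flat α ++ Sep ∷ t)) {Quiet} quiet T n (letters (π α))
        where
        letters : (γ : Ann (nvar p)) → All Quiet (flat γ)
        letters (nvar _ _) = (refl , refl , refl) ∷ (refl , refl , refl) ∷ all-numeral (λ _ → refl , refl , refl) (refl , refl , refl) p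
      witnessed-complete (ψ ∧ᵐ χ) π ctx (wit , wit') {α} mem le {T} {t} {n} eq n≡ =
        subst (λ b → Each (Ans (flat α ++ Sep ∷ t)) b T n) (sym (and-flat (π α)))
          (quiet _ n (refl , refl , refl) , each-++ (Ans (flat α ++ Sep ∷ t)) (flat (and₁ (π α)))
            (witnessed-complete ψ (and₁ ∘ π) (context-and₁ ∘ᶜ ctx) wit mem le
              (trans (cong (flat (and₂ (π α)) ++_) eq) (sym (++-assoc (flat (and₂ (π α))) (after α) (Sep ∷ t))))
              (trans (cong suc n≡) (sym (trans (length-++ (before α)) (+-comm _ 1)))))
            (witnessed-complete χ (and₂ ∘ π) (context-and₂ ∘ᶜ ctx) wit' mem le eq
              (trans (swap-suc (length (flat (and₁ (π α)))) n) (trans (cong (_+ _) n≡) (sym (length-++ (before α)))))))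
        where open Context ctx
      witnessed-complete (ψ ∨ᵐ χ) π ctx (wit , wit') {α} mem le {T} {t} {n} eq n≡ =
        subst (λ b → Each (Ans (flat α ++ Sep ∷ t)) b T n) (sym (or-flat (π α)))
          (quiet _ n (refl , refl , refl) , each-++ (Ans (flat α ++ Sep ∷ t)) (flat (or₁ (π α)))
            (witnessed-complete ψ (or₁ ∘ π) (context-or₁ ∘ᶜ ctx) wit mem le
              (trans (cong (flat (or₂ (π α)) ++_) eq) (sym (++-assoc (flat (or₂ (π α))) (after α) (Sep ∷ t))))
              (trans (cong suc n≡) (sym (trans (length-++ (before α)) (+-comm _ 1)))))
            (witnessed-complete χ (or₂ ∘ π) (context-or₂ ∘ᶜ ctx) wit' mem le eq
              (trans (swap-suc (length (flat (or₁ (π α)))) n) (trans (cong (_+ _) n≡) (sym (length-++ (before α)))))))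
        where open Context ctx
      witnessed-complete (incl κ ps qs) π ctx wit {α} mem le {T} {t} {n} eq n≡ =
        subst (λ b → Each (Ans (flat α ++ Sep ∷ t)) b T n) (sym (incl-flat (π α)))
          ((idle {wantsForth} {ok} {hitsForth} {alignRest ok} refl , idle {wantsBack} {ok˘} {hitsBack} {alignRest ok˘} refl ,
            included (root (π α)) refl , tt) ,
           each-all (Ans (flat α ++ Sep ∷ t)) {Quiet} quiet T (suc n)
             (All.++⁺ (quiet-nums ps (lhs (π α))) ((refl , refl , refl) ∷ All.++⁺ (quiet-nums qs (rhs (π α))) ((refl , refl , refl) ∷ []))))
        where
        open At ctx (λ α → Incl (root α)) (λ α → nums ps (lhs α) ++ Mid ∷ nums qs (rhs α) ++ Mid ∷ []) incl-flat
        size : length (nums ps (lhs (π α)) ++ Mid ∷ nums qs (rhs (π α)) ++ Mid ∷ []) ≤ N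
        size = prefix≤ (nums ps (lhs (π α)) ++ Mid ∷ nums qs (rhs (π α)) ++ Mid ∷ []) (<⇒≤ (suffix≤ (before α) (subst (λ b → length b ≤ N) (inner-flat α) le)))
        included : ∀ b → root (π α) ≡ b → ∀ {w} →
          wp (_≤ N) (query wantsIncl (λ _ _ → true) hitsIncl sameValues) (λ _ → ⊤)
            (st (flat α ++ Sep ∷ t) (Incl (root (π α)) ∷ w) (blocksOf Θ) i j s c d u (ticks n))
        included false r = idle {wantsIncl} {λ _ _ → true} {hitsIncl} {sameValues} r
        included true  r with wit α mem r
        ... | β , mem' , r' , same = false , search-complete (λ _ _ → true) hitsIncl sameValues {α} {β} mem' n≡ le le' r'
          (pointwise-all (All.tabulate (λ _ _ → refl)) (aligned α β)) λ t' →
          subst₂ (λ x y → wp (_≤ N) (sameValues {3F}) (λ _ → ⊤) (st x _ y i j s c d u []))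
            (sym (++-assoc (nums ps (lhs (π α))) _ _))
            (sym (trans (++-assoc (nums ps (lhs (π β))) _ _)
              (cong (λ v → nums ps (lhs (π β)) ++ Mid ∷ v) (++-assoc (nums qs (rhs (π β))) _ _))))
            (sameValues-complete ps (lhs (π α)) (lhs (π β)) qs (rhs (π β)) same (prefix≤ (nums ps (lhs (π α))) size)
              (≤-trans (≤-reflexive (length-nums qs (rhs (π β)) (rhs (π α)))) (prefix≤ (nums qs (rhs (π α))) (<⇒≤ (suffix≤ (nums ps (lhs (π α))) size))))
              (λ _ → tt))
      witnessed-complete (□ᵐ ψ) π ctx (back , wit) {α} mem le {T} {t} {n} eq n≡ =
        subst (λ b → Each (Ans (flat α ++ Sep ∷ t)) b T n) (sym (box-flat (π α)))
          ((idle {wantsForth} {ok} {hitsForth} {alignRest ok} refl , backward (root (unbox (π α))) refl ,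
            idle {wantsIncl} {λ _ _ → true} {hitsIncl} {sameValues} refl , tt) ,
           witnessed-complete ψ (unbox ∘ π) (context-box ∘ᶜ ctx) wit mem le eq
             (trans (cong suc n≡) (sym (trans (length-++ (before α)) (+-comm _ 1)))))
        where
        open At ctx (λ α → Box (root α) (root (unbox α))) (λ α → flat (unbox α)) box-flat
        backward : ∀ b → root (unbox (π α)) ≡ b → ∀ {w} →
          wp (_≤ N) (query wantsBack ok˘ hitsBack (alignRest ok˘)) (λ _ → ⊤)
            (st (flat α ++ Sep ∷ t) (Box (root (π α)) (root (unbox (π α))) ∷ w) (blocksOf Θ) i j s c d u (ticks n))
        backward false r = idle {wantsBack} {ok˘} {hitsBack} {alignRest ok˘} r
        backward true  r with back α mem r
        ... | β , mem' , com , r' = false , modal-complete ok˘ hitsBack {α} {β} mem' n≡ le le'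
          (trans (cong₂ _∧_ r' r) refl) (Pointwise.symmetric id (compat→ok β α com)) (λ _ → tt)
      witnessed-complete (◇ᵐ ψ) π ctx (forth , back , wit) {α} mem le {T} {t} {n} eq n≡ =
        subst (λ b → Each (Ans (flat α ++ Sep ∷ t)) b T n) (sym (dia-flat (π α)))
          ((forward (root (π α)) refl , backward (root (undia (π α))) refl ,
            idle {wantsIncl} {λ _ _ → true} {hitsIncl} {sameValues} refl , tt) ,
           witnessed-complete ψ (undia ∘ π) (context-dia ∘ᶜ ctx) wit mem le eq
             (trans (cong suc n≡) (sym (trans (length-++ (before α)) (+-comm _ 1)))))
        where
        open At ctx (λ α → Dia (root α) (root (undia α))) (λ α → flat (undia α)) dia-flat
        forward : ∀ b → root (π α) ≡ b → ∀ {w} →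
          wp (_≤ N) (query wantsForth ok hitsForth (alignRest ok)) (λ _ → ⊤)
            (st (flat α ++ Sep ∷ t) (Dia (root (π α)) (root (undia (π α))) ∷ w) (blocksOf Θ) i j s c d u (ticks n))
        forward false r = idle {wantsForth} {ok} {hitsForth} {alignRest ok} r
        forward true  r with forth α mem r
        ... | β , mem' , com , r' = false , modal-complete ok hitsForth {α} {β} mem' n≡ le le' r' (compat→ok α β com) (λ _ → tt)
        backward : ∀ b → root (undia (π α)) ≡ b → ∀ {w} →
          wp (_≤ N) (query wantsBack ok˘ hitsBack (alignRest ok˘)) (λ _ → ⊤)
            (st (flat α ++ Sep ∷ t) (Dia (root (π α)) (root (undia (π α))) ∷ w) (blocksOf Θ) i j s c d u (ticks n))
        backward false r = idle {wantsBack} {ok˘} {hitsBack} {alignRest ok˘} r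
        backward true  r with back α mem r
        ... | β , mem' , com , r' = false , modal-complete ok˘ hitsBack {α} {β} mem' n≡ le le' r'
          (Pointwise.symmetric id (compat→ok β α com)) (λ _ → tt)

-- The program as a whole

isRoot : Letter → Bool
isRoot (Var b)   = b
isRoot (Nvar b)  = b
isRoot (And b)   = b
isRoot (Or b)    = b
isRoot (Incl b)  = b
isRoot (Box b _) = b
isRoot (Dia b _) = b
isRoot _         = false

flat-head : ∀ {φ} (α : Ann φ) → ∃ λ a → ∃ λ v → flat α ≡ a ∷ v × isRoot a ≡ root α
flat-head (var _ _)    = _ , _ , refl , refl
flat-head (nvar _ _)   = _ , _ , refl , refl
flat-head (and _ _ _)  = _ , _ , refl , refl
flat-head (or _ _ _)   = _ , _ , refl , refl
flat-head (incl _ _ _) = _ , _ , refl , refl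
flat-head (box _ _)    = _ , _ , refl , refl
flat-head (dia _ _)    = _ , _ , refl , refl

0<1 : Fin._<_ {4} {4} 0F 1F
0<1 = s≤s z≤n

reverseStep guessStep : Cmd ℓ
reverseStep = pickBit λ b → pop I (Bit b) ⨾ push J (Bit b)
guessStep   = pick finite-Letter λ a → push X a ⨾ push W a ⨾ push Y a

opaque
  reverseᶜ guessᶜ : Cmd ℓ
  reverseᶜ = loop reverseStep ⨾ isNil I
  guessᶜ   = loop guessStep

  reverse-sound : run (reverseᶜ {ℓ}) k (st x w y i j s c d u z) → k (st x w y [] (List.reverse i ++ j) s c d u z)
  reverse-sound {ℓ} {k} {x} {w} {y} {i} {j} {s} {c} {d} {u} {z} (n , _ , r) =
    subst (λ j → k (st x w y [] j s c d u z)) (ʳ++-defn i) (go n i j r)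
    where
    go : ∀ n i j → iterate (run (reverseStep {ℓ})) n (run (isNil {ℓ} I) k) (st x w y i j s c d u z) → k (st x w y [] (i ʳ++ j) s c d u z)
    go zero    [] j (_ , r) = r
    go (suc n) i  j (b , i' , refl , r) = go n i' (Bit b ∷ j) r

  reverse-complete : ∀ bs → length bs ≤ N → k (st x w y [] (List.reverse (List.map Bit bs) ++ j) s c d u z) →
    wp (_≤ N) (reverseᶜ {ℓ}) k (st x w y (List.map Bit bs) j s c d u z)
  reverse-complete {N} {k} {x} {w} {y} {j} {s} {c} {d} {u} {z} {ℓ} bs le r =
    length bs , le , go bs j (subst (λ j → k (st x w y [] j s c d u z)) (sym (ʳ++-defn (List.map Bit bs))) r)
    where
    go : ∀ bs j → k (st x w y [] (List.map Bit bs ʳ++ j) s c d u z) →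
      iterate (wp (_≤ N) (reverseStep {ℓ})) (length bs) (wp (_≤ N) (isNil {ℓ} I) k) (st x w y (List.map Bit bs) j s c d u z)
    go []       j r = refl , r
    go (b ∷ bs) j r = b , _ , refl , go bs (Bit b ∷ j) r

  guess-sound : run (guessᶜ {ℓ}) k (st [] [] [] i j s c d u z) → ∃ λ θ → k (st θ θ θ i j s c d u z)
  guess-sound {ℓ} {k} {i} {j} {s} {c} {d} {u} {z} (n , _ , r) = go n [] r
    where
    go : ∀ n θ → iterate (run (guessStep {ℓ})) n k (st θ θ θ i j s c d u z) → ∃ λ θ → k (st θ θ θ i j s c d u z)
    go zero    θ r       = θ , r
    go (suc n) θ (a , r) = go n (a ∷ θ) r

  guess-complete : ∀ θ → length θ ≤ N → k (st θ θ θ i j s c d u z) → wp (_≤ N) (guessᶜ {ℓ}) k (st [] [] [] i j s c d u z)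
  guess-complete {N} {k} {i} {j} {s} {c} {d} {u} {z} {ℓ} θ le r = length θ , le , go θ r
    where
    go : ∀ θ {k} → k (st θ θ θ i j s c d u z) → iterate (wp (_≤ N) (guessStep {ℓ})) (length θ) k (st [] [] [] i j s c d u z)
    go []      r = r
    go (a ∷ θ) {k} r = subst (λ h → h (st [] [] [] i j s c d u z)) (iterate-snoc (length θ)) (go θ {wp (_≤ N) (guessStep {ℓ}) k} (a , r))

opaque
  rooted : Cmd 1F
  rooted = skipBlocks Y ⨾ popIf Y isRoot

  rooted-sound : ∀ {φ} (Θ : List (Ann φ)) → run rooted k (st x w (blocksOf Θ) i j s c d u z) → ∃ λ α → α ∈ Θ × root α ≡ true
  rooted-sound Θ r with skipBlocks-sound Y (List.map flat Θ) (noSep-blocks Θ) refl r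
  ... | bs₁ , b ∷ bs₂ , eq , a , t , v , eq' , _ with ∈-map⁻ flat (subst (b ∈_) (sym eq) (∈-++⁺ʳ bs₁ (here refl)))
  ... | α , mem , refl with flat-head α
  ... | a' , v' , eq'' , root≡ with trans (sym (cong (_++ Sep ∷ blocks bs₂) eq'')) eq'
  ... | refl = α , mem , trans (sym root≡) t

  rooted-complete : ∀ {φ} (Θ : List (Ann φ)) {α} → α ∈ Θ → root α ≡ true → length (blocksOf Θ) ≤ N → (∀ s → k s) →
    wp (_≤ N) rooted k (st x w (blocksOf Θ) i j s c d u z)
  rooted-complete {N} Θ {α} mem t le h with ∈-∃++ mem | flat-head α
  ... | Θ₁ , Θ₂ , refl | a , v , eq , root≡ =
    skipBlocks-complete Y (List.map flat Θ₁) (List.map flat (α ∷ Θ₂)) (noSep-blocks Θ₁)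
      (cong blocks (map-++ flat Θ₁ (α ∷ Θ₂))) (subst (λ bs → length (blocks bs) ≤ N) (map-++ flat Θ₁ (α ∷ Θ₂)) le)
      (a , trans root≡ t , _ , cong (_++ Sep ∷ blocksOf Θ₂) eq , h _)

-- Each test runs on a copy, so all three find the block from its first letter on.
checkBlock : Cmd 0F
checkBlock = test 1F 0<1 parse ⨾ test 1F 0<1 consistentᶜ ⨾ test 1F 0<1 requests ⨾ dropBlock X ⨾ dropBlock W

opaque
  checkBlocks : Cmd 0F
  checkBlocks = loop checkBlock ⨾ isNil X

-- The reversal is due to the tape, which presents the input as a stack with the last bit on top.
main : Cmd 0F
main = reverseᶜ ⨾ guessᶜ ⨾ test 1F 0<1 rooted ⨾ checkBlocks

Block : Set
Block = Σ Fml Ann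

flatᵇ : Block → List Letter
flatᵇ (_ , α) = flat α

record Checked (bits : List Bool) (y : List Letter) (b : Block) : Set where
  field
    encoded    : encode (proj₁ b) ≡ bits
    localᵇ     : Local (proj₂ b)
    consistentᵇ : Consistent (proj₂ b)
    answeredᵇ  : ∃ λ t → Each (λ w n → run queries (λ _ → ⊤) (st (flatᵇ b ++ Sep ∷ t) w y [] (List.map Bit bits) [] [] [] [] (ticks n)))
                   (flatᵇ b) (Sep ∷ t) 0

open Checked

map-Bit-injective : ∀ {bs cs} → List.map Bit bs ≡ List.map Bit cs → bs ≡ cs
map-Bit-injective = map-injective λ { refl → refl }

opaque
  unfolding checkBlocks

  checkBlocks-sound : ∀ bits → run checkBlocks k (st x x y [] (List.map Bit bits) [] [] [] [] []) →
    ∃ λ L → x ≡ blocks (List.map flatᵇ L) × All (Checked bits y) L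
  checkBlocks-sound {k} {x} {y} bits (n , _ , r) = go n x r
    where
    go : ∀ n x → iterate (run checkBlock) n (run (isNil {ℓ = 0F} X) k) (st x x y [] (List.map Bit bits) [] [] [] [] []) →
      ∃ λ L → x ≡ blocks (List.map flatᵇ L) × All (Checked bits y) L
    go zero    x (refl , _) = [] , refl , []
    go (suc n) x (r₁ , r₂ , r₃ , r₄) with parse-sound r₁
    ... | φ , α , t , l , refl , eq with dropBlock-sound X r₄
    ... | p , x' , ns , eq' , r₅ with dropBlock-sound W r₅
    ... | q , w' , ns' , eq'' , r₆ with sep-unique ns (noSep-flat α) (sym eq') | sep-unique ns' (noSep-flat α) (sym eq'')
    ... | refl , refl | refl , refl with go n t r₆
    ... | L , refl , all = (φ , α) ∷ L , refl , record
      { encoded     = sym (map-Bit-injective eq)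
      ; localᵇ      = l
      ; consistentᵇ = consistent-sound α r₂
      ; answeredᵇ   = t , WalkQueries.walk-sound (λ w n → st (flat α ++ Sep ∷ t) w y [] (List.map Bit bits) [] [] [] [] (ticks n))
          (λ _ _ → refl) (λ _ _ _ → refl) (λ _ _ → refl) (flat α) 0 (noSep-flat α) r₃
      } ∷ all

  checkBlocks-complete : ∀ {φ} (Θ : List (Ann φ)) → Good Θ → length (encode φ) ≤ N → length (blocksOf Θ) ≤ N →
    wp (_≤ N) checkBlocks (λ _ → ⊤) (st (blocksOf Θ) (blocksOf Θ) (blocksOf Θ) [] (List.map Bit (encode φ)) [] [] [] [] [])
  checkBlocks-complete {N} {φ} Θ good le le' = length Θ , ≤-trans (count Θ) le' , go Θ id
    where
    count : (Θ : List (Ann φ)) → length Θ ≤ length (blocksOf Θ)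
    count []      = z≤n
    count (α ∷ Θ) = ≤-trans (s≤s (count Θ)) (suffix≤ (flat α) ≤-refl)
    go : ∀ Θ' → (∀ {α} → α ∈ Θ' → α ∈ Θ) → iterate (wp (_≤ N) checkBlock) (length Θ') (wp (_≤ N) (isNil {ℓ = 0F} X) (λ _ → ⊤))
      (st (blocksOf Θ') (blocksOf Θ') (blocksOf Θ) [] (List.map Bit (encode φ)) [] [] [] [] [])
    go []       sub = refl , tt
    go (α ∷ Θ') sub =
      parse-complete α (Good.local good (sub (here refl)))
        (≤-trans (m≤n*m (length (fmlToks φ)) 4) (≤-trans (≤-reflexive (sym (length-encode φ))) le)) refl refl (λ _ → tt) ,
      consistent-complete α (Good.consistent good (sub (here refl))) size (λ _ → tt) ,
      WalkQueries.walk-complete (λ w n → st (flat α ++ Sep ∷ blocksOf Θ') w (blocksOf Θ) [] (List.map Bit (encode φ)) [] [] [] [] (ticks n))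
        (λ _ _ → refl) (λ _ _ _ → refl) (λ _ _ → refl) (flat α) 0 (noSep-flat α) size (λ _ → tt)
        (witnessed-complete Θ N [] (List.map Bit (encode φ)) [] [] [] [] le' φ id context-id (Good.witnessed good) (sub (here refl)) size refl refl) ,
      dropBlock-complete X (flat α) (noSep-flat α) refl size
        (dropBlock-complete W (flat α) (noSep-flat α) refl size (go Θ' (sub ∘ there)))
      where
      size : length (flat α) ≤ N
      size = ≤-trans (flat-encode α) le

initialStacks : List Bool → Stacks
initialStacks bits = st [] [] [] (List.reverse (List.map Bit bits)) [] [] [] [] [] []

same-formula : ∀ φ bits {y} → encode φ ≡ bits → ∀ L → All (Checked bits y) L → ∃ λ (Θ : List (Ann φ)) → L ≡ List.map (φ ,_) Θ
same-formula φ bits eq []             []       = [] , refl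
same-formula φ bits eq ((ψ , α) ∷ L) (ch ∷ all)
  with encode-injective ψ φ (trans (encoded ch) (sym eq)) | same-formula φ bits eq L all
... | refl | Θ , refl = α ∷ Θ , refl

main-sound : ∀ bits → run main (λ _ → ⊤) (initialStacks bits) → ∃ λ φ → encode φ ≡ bits × ∃ λ Θ → Good {φ} Θ
main-sound bits r with reverse-sound r
... | r₁ with guess-sound r₁
... | θ , r₂ , r₃
  with checkBlocks-sound bits (subst (λ j → run checkBlocks _ (st θ θ θ [] j [] [] [] [] []))
         (trans (++-identityʳ _) (reverse-involutive (List.map Bit bits))) r₃)
-- The empty list of blocks has no root; any formula can serve as the index of its types.
... | [] , refl , all with rooted-sound {φ = var 0} [] r₂
...   | _ , () , _
main-sound bits r | r₁ | θ , r₂ , r₃ | (φ , α₀) ∷ L , refl , all@(ch ∷ _)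
  with same-formula φ bits (encoded ch) ((φ , α₀) ∷ L) all
... | Θ , eq = φ , encoded ch , Θ , record
  { local      = λ mem → localᵇ (checked mem)
  ; consistent = λ mem → consistentᵇ (checked mem)
  ; witnessed  = witnessed-sound Θ (λ {α} mem → subst (λ y → ∃ λ t → Each
      (λ w n → run queries (λ _ → ⊤) (st (flat α ++ Sep ∷ t) w y [] (List.map Bit bits) [] [] [] [] (ticks n))) (flat α) (Sep ∷ t) 0)
      θ≡ (answeredᵇ (checked mem))) φ id context-id
  ; rooted     = rooted-sound Θ (subst (λ y → run rooted (λ _ → ⊤) (st (blocks (List.map flatᵇ ((φ , α₀) ∷ L))) (blocks (List.map flatᵇ ((φ , α₀) ∷ L))) y _ _ _ _ _ _ _)) θ≡ r₂)
  }
  where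
  θ≡ : blocks (List.map flatᵇ ((φ , α₀) ∷ L)) ≡ blocksOf Θ
  θ≡ = cong blocks (trans (cong (List.map flatᵇ) eq) (sym (map-∘ Θ)))
  checked : ∀ {α} → α ∈ Θ → Checked bits _ (φ , α)
  checked mem = All.lookup all (subst ((φ , _) ∈_) (sym eq) (∈-map⁺ (φ ,_) mem))

main-complete : ∀ {φ} (Θ : List (Ann φ)) → Good Θ → length (encode φ) ≤ N → length (blocksOf Θ) ≤ N →
  wp (_≤ N) main (λ _ → ⊤) (initialStacks (encode φ))
main-complete {N} {φ} Θ good le le' with Good.rooted good
... | α , mem , t = subst (λ i → wp (_≤ N) main (λ _ → ⊤) (st [] [] [] i [] [] [] [] [] [])) (reverse-map Bit (encode φ))
  (reverse-complete (List.reverse (encode φ)) (≤-trans (≤-reflexive (length-reverse (encode φ))) le)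
    (subst (λ j → wp (_≤ N) (guessᶜ ⨾ test 1F 0<1 rooted ⨾ checkBlocks) (λ _ → ⊤) (st [] [] [] [] j [] [] [] [] []))
      (sym (trans (++-identityʳ _) (trans (cong List.reverse (reverse-map Bit (encode φ))) (reverse-involutive (List.map Bit (encode φ))))))
      (guess-complete (blocksOf Θ) le' (rooted-complete Θ mem t le' (λ _ → tt) , checkBlocks-complete Θ good le le'))))

-- Running time

open Compiler Letter finite-Letter _≟L_ 10 4 0F 3F Bit using (module Machine)
open Machine main using (machine; accepted→run; run→accepted)

private
  n<2^n : ∀ n → suc n ≤ 2 ^ n
  n<2^n zero    = ≤-refl
  n<2^n (suc n) = ≤-trans (+-mono-≤ (m^n>0 2 n) (n<2^n n)) (≤-reflexive (cong (2 ^ n +_) (sym (+-identityʳ _))))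

  -- The running time for inputs of length n, when the guessed list of types has length at most 2 ^ n.
  module Time (e n a : ℕ) (1≤n : 1 ≤ n) (a≤ : a ≤ (2 + 2 ^ n * suc n) ^ e) where

    open ≤-Reasoning

    E m A : ℕ
    -- The constant factor contributes at most `4 * m` to the exponent and `A * A` contributes
    -- `4 * m * suc e`; the sum is `m * E`.
    E = 8 + 4 * e
    m = suc n
    -- With `suc e` in place of `e`, the bound `n ≤ A` holds for `e = 0` too.
    A = 2 ^ (2 * m * suc e)

    base≤ : 2 + 2 ^ n * suc n ≤ 2 ^ (2 * m)
    base≤ = begin
      2 + 2 ^ n * suc n                ≤⟨ +-mono-≤ (*-monoʳ-≤ 2 (*-mono-≤ (m^n>0 2 n) (m^n>0 2 n))) (*-monoʳ-≤ (2 ^ n) (n<2^n n)) ⟩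
      2 * (2 ^ n * 2 ^ n) + 2 ^ n * 2 ^ n   ≤⟨ m≤m+n _ (2 ^ n * 2 ^ n) ⟩
      2 * (2 ^ n * 2 ^ n) + 2 ^ n * 2 ^ n + 2 ^ n * 2 ^ n   ≡⟨ ring (2 ^ n) ⟩
      (2 * 2 ^ n) * (2 * 2 ^ n)         ≡⟨ sym (^-distribˡ-+-* 2 m m) ⟩
      2 ^ (m + m)                       ≡⟨ cong (λ l → 2 ^ (m + l)) (sym (+-identityʳ m)) ⟩
      2 ^ (2 * m) ∎
      where
      ring : ∀ b → 2 * (b * b) + b * b + b * b ≡ (2 * b) * (2 * b)
      ring = RingSolver.solve-∀

    a≤A : a ≤ A
    a≤A = begin
      a                          ≤⟨ a≤ ⟩
      (2 + 2 ^ n * suc n) ^ e    ≤⟨ ^-monoˡ-≤ e base≤ ⟩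
      (2 ^ (2 * m)) ^ e          ≡⟨ ^-*-assoc 2 (2 * m) e ⟩
      2 ^ (2 * m * e)            ≤⟨ ^-monoʳ-≤ 2 (*-monoʳ-≤ (2 * m) (n≤1+n e)) ⟩
      A ∎

    n≤A : n ≤ A
    n≤A = begin
      n                    ≤⟨ n≤1+n n ⟩
      suc n                ≤⟨ n<2^n n ⟩
      2 ^ n                ≤⟨ ^-monoʳ-≤ 2 (≤-trans (n≤1+n n) (≤-trans (m≤m+n m (m + 0)) (m≤m*n (2 * m) (suc e)))) ⟩
      A ∎

    1≤A : 1 ≤ A
    1≤A = m^n>0 2 (2 * m * suc e)

    -- The left side is at most `8 * (A * A)`, rounded up to `2 ^ 4 * (A * A)`. The product `m * E`
    -- becomes a power of `m` by `E < 2 ^ E ≤ m ^ E`, where `1 ≤ n` makes `m` at least two.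
    time≤ : suc (a * (3 + 2 * (n + a))) ≤ 2 ^ (m ^ suc E)
    time≤ = begin
      suc (a * (3 + 2 * (n + a)))
        ≤⟨ +-mono-≤ (*-mono-≤ 1≤A 1≤A) (*-mono-≤ a≤A (+-mono-≤ (*-monoʳ-≤ 3 1≤A) (*-monoʳ-≤ 2 (+-mono-≤ n≤A a≤A)))) ⟩
      A * A + A * (3 * A + 2 * (A + A))       ≤⟨ m≤m+n _ (8 * (A * A)) ⟩
      A * A + A * (3 * A + 2 * (A + A)) + 8 * (A * A)   ≡⟨ ring A ⟩
      2 ^ 4 * (A * A)                         ≡⟨ cong (2 ^ 4 *_) (sym (^-distribˡ-+-* 2 (2 * m * suc e) (2 * m * suc e))) ⟩
      2 ^ 4 * 2 ^ (2 * m * suc e + 2 * m * suc e)   ≡⟨ sym (^-distribˡ-+-* 2 4 (2 * m * suc e + 2 * m * suc e)) ⟩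
      2 ^ (4 + (2 * m * suc e + 2 * m * suc e))     ≤⟨ ^-monoʳ-≤ 2 (+-monoˡ-≤ _ (m≤m*n 4 m)) ⟩
      2 ^ (4 * m + (2 * m * suc e + 2 * m * suc e)) ≡⟨ cong (2 ^_) (ring' m e) ⟩
      2 ^ (m * E)                             ≤⟨ ^-monoʳ-≤ 2 (*-monoʳ-≤ m (≤-trans (n≤1+n E) (≤-trans (n<2^n E) (^-monoˡ-≤ E (s≤s 1≤n))))) ⟩
      2 ^ (m ^ suc E) ∎
      where
      ring : ∀ A → A * A + A * (3 * A + 2 * (A + A)) + 8 * (A * A) ≡ 2 ^ 4 * (A * A)
      ring = RingSolver.solve-∀
      ring' : ∀ m e → 4 * m + (2 * m * suc e + 2 * m * suc e) ≡ m * (8 + 4 * e)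
      ring' = RingSolver.solve-∀

  exponent : ℕ
  exponent = suc (8 + 4 * degree main)

  length-blocksOf : ∀ {φ} (Θ : List (Ann φ)) → length (blocksOf Θ) ≤ length Θ * suc (length (encode φ))
  length-blocksOf []      = z≤n
  length-blocksOf {φ} (α ∷ Θ) = begin
    length (flat α ++ Sep ∷ blocksOf Θ)              ≡⟨ length-++ (flat α) ⟩
    length (flat α) + suc (length (blocksOf Θ))      ≡⟨ +-suc _ _ ⟩
    suc (length (flat α)) + length (blocksOf Θ)      ≤⟨ +-mono-≤ (s≤s (flat-encode α)) (length-blocksOf Θ) ⟩
    suc (length (encode φ)) + length Θ * suc (length (encode φ)) ∎
    where open ≤-Reasoning

  encode-nonempty : ∀ φ → 1 ≤ length (encode φ)
  encode-nonempty φ = ≤-trans (go φ) (annBits-encode φ)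
    where
    go : ∀ φ → 1 ≤ annBits φ
    go (var _)      = s≤s z≤n
    go (nvar _)     = s≤s z≤n
    go (_ ∧ᵐ _)     = s≤s z≤n
    go (_ ∨ᵐ _)     = s≤s z≤n
    go (incl _ _ _) = s≤s z≤n
    go (□ᵐ _)       = s≤s z≤n
    go (◇ᵐ _)       = s≤s z≤n

  good→accepted : ∀ {φ} (Θ : List (Ann φ)) → length Θ ≤ 2 ^ annBits φ → Good Θ →
    AcceptsWithin machine (2 ^ (suc (length (encode φ)) ^ exponent)) (encode φ)
  good→accepted {φ} Θ le good =
    let (c , w , eq) = run→accepted B (main-complete Θ good n≤B θ≤B) in c , within-mono machine time≤ w , eq
    where
    n B : ℕ
    n = length (encode φ)
    -- At most `2 ^ n` blocks, each of at most `n` letters and a separator.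
    B = 2 ^ n * suc n
    n≤B : n ≤ B
    n≤B = ≤-trans (n≤1+n n) (m≤n*m (suc n) (2 ^ n) {{m^n≢0 2 n}})
    θ≤B : length (blocksOf Θ) ≤ B
    θ≤B = ≤-trans (length-blocksOf Θ) (*-monoˡ-≤ (suc n) (≤-trans le (^-monoʳ-≤ 2 (annBits-encode φ))))
    open Time (degree main) n (cost B main + 0) (encode-nonempty φ)
      (≤-trans (≤-reflexive (+-identityʳ _)) (cost≤ B main)) using (time≤)

  satisfiable→accepted : ∀ x → SAT x → AcceptsWithin machine (2 ^ (suc (length x) ^ exponent)) x
  satisfiable→accepted x (φ , refl , sat) = decidable-stable (acceptsWithin? machine _ (encode φ))
    (satisfiable→good sat >>= λ (Θ , le , good) → return (good→accepted {φ} Θ le good))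

  accepted→finSatisfiable : ∀ n x → AcceptsWithin machine n x → FINSAT x
  accepted→finSatisfiable n x acc with main-sound x (accepted→run {n} acc)
  ... | φ , eq , Θ , good = φ , eq , good→finSatisfiable good

  finSat→sat : ∀ x → FINSAT x → SAT x
  finSat→sat x (φ , eq , n , M , T , sat) = φ , eq , Fin n , M , T , sat

theorem3 : InNEXPTIME SAT × InNEXPTIME FINSAT
theorem3 =
  (machine , exponent , λ x → satisfiable→accepted x , finSat→sat x ∘ accepted→finSatisfiable _ x) ,
  (machine , exponent , λ x → satisfiable→accepted x ∘ finSat→sat x , accepted→finSatisfiable _ x)
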